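{- The map associating to each matroid $\mathsf{M}$ the flag $f$-vector $\alpha_{\mathsf{M}}$ of its lattice of flats $\mathcal{L}(\mathsf{M})$ is a valuative invariant.
   Context: All matroids have finite ground sets contained in the positive integers. $\mathcal{L}(\mathsf{M})$ is the lattice of flats of $\mathsf{M}$. The flag $f$-vector of $\mathcal{L}(\mathsf{M})$ is the function $\alpha_{\mathsf{M}}$ from finite sets of non-negative integers to $\mathbb{Z}$ given, for $r_1<\dots<r_s$, by \[\alpha_{\mathsf{M}}(\{r_1,\dots,r_s\})=\#\{\text{flags } F_1\subseteq\cdots\subseteq F_s \text{ in } \mathcal{L}(\mathsf{M}) : \operatorname{rk}(F_i)=r_i \text{ for each } i\}.\] It is regarded as an element of the abelian group of $\mathbb{Z}$-valued functions on finite sets of non-negative integers. The base polytope of a matroid $\mathsf{M}$ on $E$ with bases $\mathscr{B}$ is $\mathscr{P}(\mathsf{M})=\operatorname{conv}\{\sum_{i\in B}e_i : B\in\mathscr{B}\}\subseteq\mathbb{R}^E$, with indicator function $\mathbf{1}_{\mathscr{P}(\mathsf{M})}:\mathbb{R}^E\to\mathbb{Z}$. A map $f$ from matroids to an abelian group is a valuation if $\sum_{i}a_if(\mathsf{M}_i)=0$ whenever $\mathsf{M}_1,\dots,\mathsf{M}_s$ are matroids on a common ground set and $a_i\in\mathbb{Z}$ satisfy $\sum_i a_i\mathbf{1}_{\mathscr{P}(\mathsf{M}_i)}=0$. (This is known to be equivalent to the inclusion–exclusion property under matroid subdivisions.) A valuative invariant is a valuation with $f(\mathsf{M})=f(\mathsf{N})$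 whenever $\mathsf{M}\cong\mathsf{N}$. -}

module Defs where

open import Level using (Level; 0ℓ) renaming (suc to lsuc; _⊔_ to _⊔ˡ_)
open import Algebra.Bundles using (AbelianGroup)
import Algebra.Construct.Pointwise as Pointwise
import Algebra.Definitions.RawMonoid as RawMonoidOps
open import Data.Bool.Base using (if_then_else_)
open import Data.Fin.Base as Fin using (Fin)
open import Data.Fin.Properties using (all?)
open import Data.Fin.Subset
  using (Subset; inside; outside; _∈_; _∉_; _⊆_; _∪_; _-_; ⁅_⁆; ∣_∣)
open import Data.Fin.Subset.Properties using (_∈?_; _⊆?_; anySubset?)
open import Data.Integer.Base as ℤ using (ℤ; +_; -[1+_]; 0ℤ; 1ℤ)
import Data.Integer.Properties as ℤ
open import Data.List.Base as List using (List; []; _∷_; cartesianProductWith; filter; length)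
open import Data.List.Extrema.Nat using (max)
open import Data.Nat.Base as ℕ using (ℕ; zero; suc)
import Data.Nat.Properties as ℕ
open import Data.Product.Base using (Σ; ∃; ∃-syntax; _×_; _,_; proj₁; proj₂)
open import Data.Rational.Base as ℚ using (ℚ; 0ℚ; 1ℚ; ½)
import Data.Rational.Properties as ℚ
open import Data.Rational.Solver using (module +-*-Solver)
open import Data.Vec.Base as Vec using (Vec; []; _∷_)
open import Data.Vec.Functional using (Vector; foldr)
open import Data.Vec.Relation.Binary.Pointwise.Inductive as VecPointwise using () renaming (Pointwise to VecPointwise)
open import Data.Vec.Relation.Unary.Linked using (Linked; linked?)
open import Function.Base using (_∘_)
open import Function.Bundles using (_↔_; _⇔_; Inverse)
open import Relation.Binary.PropositionalEquality using (_≡_; refl; sym; cong; subst)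
open import Relation.Nullary.Decidable using (Dec; does; _×-dec_; _→-dec_; ¬?)
open import Relation.Unary using (Pred; Decidable)

private
  variable
    a c ℓ : Level
    k n : ℕ

------------------------------------------------------------------------
-- Real numbers: Cauchy sequences of rationals, compared by _≈ᴿ_ rather than
-- by propositional equality.

record ℝ : Set where
  field
    seq    : ℕ → ℚ
    cauchy : ∀ ε → 0ℚ ℚ.< ε →
             ∃[ N ] ∀ m n → N ℕ.≤ m → N ℕ.≤ n → ℚ.∣ seq m ℚ.- seq n ∣ ℚ.≤ ε

open ℝ public

infix  4 _≈ᴿ_ _≤ᴿ_
infixl 6 _+ᴿ_
infixl 7 _*ᴿ_

_≈ᴿ_ : ℝ → ℝ → Set
x ≈ᴿ y = ∀ ε → 0ℚ ℚ.< ε → ∃[ N ] ∀ n → N ℕ.≤ n → ℚ.∣ seq x n ℚ.- seq y n ∣ ℚ.≤ ε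

_≤ᴿ_ : ℝ → ℝ → Set
x ≤ᴿ y = ∀ ε → 0ℚ ℚ.< ε → ∃[ N ] ∀ n → N ℕ.≤ n → seq x n ℚ.≤ seq y n ℚ.+ ε

fromℚ : ℚ → ℝ
fromℚ q = record
  { seq    = λ _ → q
  ; cauchy = λ ε 0<ε → 0 , λ _ _ _ _ →
      subst (ℚ._≤ ε) (sym (cong ℚ.∣_∣ (ℚ.+-inverseʳ q))) (ℚ.<⇒≤ 0<ε)
  }

0ᴿ 1ᴿ : ℝ
0ᴿ = fromℚ 0ℚ
1ᴿ = fromℚ 1ℚ

private
  half-pos : ∀ {ε} → 0ℚ ℚ.< ε → 0ℚ ℚ.< ½ ℚ.* ε
  half-pos {ε} 0<ε = subst (ℚ._< ½ ℚ.* ε) (ℚ.*-zeroʳ ½) (ℚ.*-monoʳ-<-pos ½ 0<ε)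

  ½ε+½ε≡ε : ∀ ε → ½ ℚ.* ε ℚ.+ ½ ℚ.* ε ≡ ε
  ½ε+½ε≡ε = solve 1 (λ ε → con ½ :* ε :+ con ½ :* ε := ε) refl
    where open +-*-Solver

  +-regroup : ∀ p q r s → (p ℚ.+ q) ℚ.- (r ℚ.+ s) ≡ (p ℚ.- r) ℚ.+ (q ℚ.- s)
  +-regroup = solve 4 (λ p q r s → (p :+ q) :- (r :+ s) := (p :- r) :+ (q :- s)) refl
    where open +-*-Solver

  *-regroup : ∀ p q r s → (p ℚ.* q) ℚ.- (r ℚ.* s) ≡ p ℚ.* (q ℚ.- s) ℚ.+ s ℚ.* (p ℚ.- r)
  *-regroup = solve 4 (λ p q r s → (p :* q) :- (r :* s) := p :* (q :- s) :+ s :* (p :- r)) refl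
    where open +-*-Solver

  cancel : ∀ p q → p ≡ (p ℚ.- q) ℚ.+ q
  cancel = solve 2 (λ p q → p := (p :- q) :+ q) refl
    where open +-*-Solver

  0≤⇒0<1+ : ∀ {p} → 0ℚ ℚ.≤ p → 0ℚ ℚ.< 1ℚ ℚ.+ p
  0≤⇒0<1+ {p} 0≤p = subst (ℚ._< 1ℚ ℚ.+ p) (ℚ.+-identityʳ 0ℚ)
    (ℚ.+-mono-<-≤ (ℚ.positive⁻¹ 1ℚ) 0≤p)

  eventuallyBounded : ∀ x → ∃[ B ] 0ℚ ℚ.< B × ∃[ N ] ∀ n → N ℕ.≤ n → ℚ.∣ seq x n ∣ ℚ.≤ B
  eventuallyBounded x =
    1ℚ ℚ.+ ℚ.∣ seq x N ∣ , 0≤⇒0<1+ (ℚ.0≤∣p∣ (seq x N)) , N , λ n N≤n → begin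
      ℚ.∣ seq x n ∣                                ≡⟨ cong ℚ.∣_∣ (cancel (seq x n) (seq x N)) ⟩
      ℚ.∣ (seq x n ℚ.- seq x N) ℚ.+ seq x N ∣      ≤⟨ ℚ.∣p+q∣≤∣p∣+∣q∣ (seq x n ℚ.- seq x N) (seq x N) ⟩
      ℚ.∣ seq x n ℚ.- seq x N ∣ ℚ.+ ℚ.∣ seq x N ∣  ≤⟨ ℚ.+-monoˡ-≤ ℚ.∣ seq x N ∣ (close n N N≤n ℕ.≤-refl) ⟩
      1ℚ ℚ.+ ℚ.∣ seq x N ∣                         ∎
    where
    open ℚ.≤-Reasoning
    open Σ (cauchy x 1ℚ (ℚ.positive⁻¹ 1ℚ)) renaming (proj₁ to N; proj₂ to close)

  *-bound : ∀ {p q B δ} → ℚ.∣ p ∣ ℚ.≤ B → 0ℚ ℚ.< B → ℚ.∣ q ∣ ℚ.≤ δ → ℚ.∣ p ℚ.* q ∣ ℚ.≤ B ℚ.* δ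
  *-bound {p} {q} {B} {δ} p≤B 0<B q≤δ = begin
    ℚ.∣ p ℚ.* q ∣        ≡⟨ ℚ.∣p*q∣≡∣p∣*∣q∣ p q ⟩
    ℚ.∣ p ∣ ℚ.* ℚ.∣ q ∣  ≤⟨ ℚ.*-monoʳ-≤-nonNeg ℚ.∣ q ∣ {{ℚ.∣-∣-nonNeg q}} p≤B ⟩
    B ℚ.* ℚ.∣ q ∣        ≤⟨ ℚ.*-monoˡ-≤-nonNeg B {{ℚ.nonNegative (ℚ.<⇒≤ 0<B)}} q≤δ ⟩
    B ℚ.* δ              ∎
    where open ℚ.≤-Reasoning

_+ᴿ_ : ℝ → ℝ → ℝ
seq (x +ᴿ y) n = seq x n ℚ.+ seq y n
cauchy (x +ᴿ y) ε 0<ε = N₁ ℕ.⊔ N₂ , λ m n N≤m N≤n → begin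
    ℚ.∣ (seq x m ℚ.+ seq y m) ℚ.- (seq x n ℚ.+ seq y n) ∣
      ≡⟨ cong ℚ.∣_∣ (+-regroup (seq x m) (seq y m) (seq x n) (seq y n)) ⟩
    ℚ.∣ (seq x m ℚ.- seq x n) ℚ.+ (seq y m ℚ.- seq y n) ∣
      ≤⟨ ℚ.∣p+q∣≤∣p∣+∣q∣ (seq x m ℚ.- seq x n) (seq y m ℚ.- seq y n) ⟩
    ℚ.∣ seq x m ℚ.- seq x n ∣ ℚ.+ ℚ.∣ seq y m ℚ.- seq y n ∣
      ≤⟨ ℚ.+-mono-≤
           (close₁ m n (ℕ.m⊔n≤o⇒m≤o N₁ N₂ N≤m) (ℕ.m⊔n≤o⇒m≤o N₁ N₂ N≤n))
           (close₂ m n (ℕ.m⊔n≤o⇒n≤o N₁ N₂ N≤m) (ℕ.m⊔n≤o⇒n≤o N₁ N₂ N≤n)) ⟩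
    ½ ℚ.* ε ℚ.+ ½ ℚ.* ε
      ≡⟨ ½ε+½ε≡ε ε ⟩
    ε ∎
  where
  open ℚ.≤-Reasoning
  open Σ (cauchy x (½ ℚ.* ε) (half-pos 0<ε)) renaming (proj₁ to N₁; proj₂ to close₁)
  open Σ (cauchy y (½ ℚ.* ε) (half-pos 0<ε)) renaming (proj₁ to N₂; proj₂ to close₂)

_*ᴿ_ : ℝ → ℝ → ℝ
seq (x *ᴿ y) n = seq x n ℚ.* seq y n
cauchy (x *ᴿ y) ε 0<ε = N , λ m n N≤m N≤n → begin
    ℚ.∣ (seq x m ℚ.* seq y m) ℚ.- (seq x n ℚ.* seq y n) ∣
      ≡⟨ cong ℚ.∣_∣ (*-regroup (seq x m) (seq y m) (seq x n) (seq y n)) ⟩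
    ℚ.∣ seq x m ℚ.* (seq y m ℚ.- seq y n) ℚ.+ seq y n ℚ.* (seq x m ℚ.- seq x n) ∣
      ≤⟨ ℚ.∣p+q∣≤∣p∣+∣q∣ (seq x m ℚ.* (seq y m ℚ.- seq y n)) (seq y n ℚ.* (seq x m ℚ.- seq x n)) ⟩
    ℚ.∣ seq x m ℚ.* (seq y m ℚ.- seq y n) ∣ ℚ.+ ℚ.∣ seq y n ℚ.* (seq x m ℚ.- seq x n) ∣
      ≤⟨ ℚ.+-mono-≤
           (*-bound (x≤A m (ℕ.m⊔n≤o⇒m≤o M₁ M₂ (M≤ N≤m))) 0<A
                    (closeʸ m n (Nʸ≤ N≤m) (Nʸ≤ N≤n)))
           (*-bound (y≤B n (ℕ.m⊔n≤o⇒n≤o M₁ M₂ (M≤ N≤n))) 0<B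
                    (closeˣ m n (Nˣ≤ N≤m) (Nˣ≤ N≤n))) ⟩
    A ℚ.* δ ℚ.+ B ℚ.* δ
      ≡⟨ ℚ.*-distribʳ-+ δ A B ⟨
    (A ℚ.+ B) ℚ.* (ℚ.1/ (A ℚ.+ B) ℚ.* ε)
      ≡⟨ ℚ.*-assoc (A ℚ.+ B) (ℚ.1/ (A ℚ.+ B)) ε ⟨
    (A ℚ.+ B) ℚ.* ℚ.1/ (A ℚ.+ B) ℚ.* ε
      ≡⟨ cong (ℚ._* ε) (ℚ.*-inverseʳ (A ℚ.+ B)) ⟩
    1ℚ ℚ.* ε
      ≡⟨ ℚ.*-identityˡ ε ⟩
    ε ∎
  where
  open ℚ.≤-Reasoning
  boundˣ = eventuallyBounded x
  boundʸ = eventuallyBounded y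
  A = proj₁ boundˣ
  B = proj₁ boundʸ
  0<A = proj₁ (proj₂ boundˣ)
  0<B = proj₁ (proj₂ boundʸ)
  M₁ = proj₁ (proj₂ (proj₂ boundˣ))
  M₂ = proj₁ (proj₂ (proj₂ boundʸ))
  x≤A = proj₂ (proj₂ (proj₂ boundˣ))
  y≤B = proj₂ (proj₂ (proj₂ boundʸ))
  instance
    A+B>0 : ℚ.Positive (A ℚ.+ B)
    A+B>0 = ℚ.positive (subst (ℚ._< A ℚ.+ B) (ℚ.+-identityʳ 0ℚ) (ℚ.+-mono-< 0<A 0<B))
    A+B≢0 : ℚ.NonZero (A ℚ.+ B)
    A+B≢0 = ℚ.pos⇒nonZero (A ℚ.+ B)
  δ : ℚ
  δ = ℚ.1/ (A ℚ.+ B) ℚ.* ε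
  0<δ : 0ℚ ℚ.< δ
  0<δ = subst (ℚ._< δ) (ℚ.*-zeroʳ (ℚ.1/ (A ℚ.+ B)))
    (ℚ.*-monoʳ-<-pos (ℚ.1/ (A ℚ.+ B)) {{ℚ.1/pos⇒pos (A ℚ.+ B)}} 0<ε)
  open Σ (cauchy x δ 0<δ) renaming (proj₁ to Nˣ; proj₂ to closeˣ)
  open Σ (cauchy y δ 0<δ) renaming (proj₁ to Nʸ; proj₂ to closeʸ)
  N : ℕ
  N = (M₁ ℕ.⊔ M₂) ℕ.⊔ (Nˣ ℕ.⊔ Nʸ)
  M≤ : ∀ {m} → N ℕ.≤ m → M₁ ℕ.⊔ M₂ ℕ.≤ m
  M≤ = ℕ.m⊔n≤o⇒m≤o (M₁ ℕ.⊔ M₂) (Nˣ ℕ.⊔ Nʸ)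
  Nˣ≤ : ∀ {m} → N ℕ.≤ m → Nˣ ℕ.≤ m
  Nˣ≤ = ℕ.m⊔n≤o⇒m≤o Nˣ Nʸ ∘ ℕ.m⊔n≤o⇒n≤o (M₁ ℕ.⊔ M₂) (Nˣ ℕ.⊔ Nʸ)
  Nʸ≤ : ∀ {m} → N ℕ.≤ m → Nʸ ℕ.≤ m
  Nʸ≤ = ℕ.m⊔n≤o⇒n≤o Nˣ Nʸ ∘ ℕ.m⊔n≤o⇒n≤o (M₁ ℕ.⊔ M₂) (Nˣ ℕ.⊔ Nʸ)

sumᴿ : Vector ℝ n → ℝ
sumᴿ = foldr _+ᴿ_ 0ᴿ

conv : Pred (Vector ℝ n) ℓ → Pred (Vector ℝ n) ℓ
conv {n = n} X x =
  ∃[ k ] Σ (Vector ℝ k) λ t → Σ (Vector (Vector ℝ n) k) λ v →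
    (∀ j → X (v j)) ×
    (∀ j → 0ᴿ ≤ᴿ t j) ×
    sumᴿ t ≈ᴿ 1ᴿ ×
    (∀ i → x i ≈ᴿ sumᴿ (λ j → t j *ᴿ v j i))

------------------------------------------------------------------------
-- Matroids

-- A finite set of positive integers, listed in increasing order. Elements
-- and subsets are referred to by position, so that subsets of E are
-- Subset (size E) and ℝ^E is Vector ℝ (size E).
record GroundSet : Set where
  field
    size       : ℕ
    element    : Fin size → ℕ
    positive   : ∀ i → 0 ℕ.< element i
    increasing : ∀ {i j} → i Fin.< j → element i ℕ.< element j

open GroundSet public using (size)

record Matroid (E : GroundSet) : Set₁ where
  field
    Basis    : Pred (Subset (size E)) 0ℓ
    basis?   : Decidable Basis
    nonempty : ∃ Basis
    exchange : ∀ {A B} → Basis A → Basis B → ∀ {x} → x ∈ A → x ∉ B →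
               ∃[ y ] y ∈ B × y ∉ A × Basis ((A - x) ∪ ⁅ y ⁆)

-- All vectors of length n with entries from xs; each occurs exactly once
-- when xs is duplicate-free.
vectors : {A : Set a} → List A → ∀ n → List (Vec A n)
vectors xs zero    = [] ∷ []
vectors xs (suc n) = cartesianProductWith _∷_ xs (vectors xs n)

subsets : ∀ n → List (Subset n)
subsets = vectors (outside ∷ inside ∷ [])

image : ∀ {m n} → Fin m ↔ Fin n → Subset m → Subset n
image φ S = Vec.tabulate (λ j → Vec.lookup S (Inverse.from φ j))

infix 4 _≅_

_≅_ : ∀ {E E′} → Matroid E → Matroid E′ → Set
_≅_ {E} {E′} M N = Σ (Fin (size E) ↔ Fin (size E′)) λ φ →
  ∀ B → Matroid.Basis M B ⇔ Matroid.Basis N (image φ B)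

module _ {E : GroundSet} (M : Matroid E) where
  open Matroid M

  Independent : Pred (Subset (size E)) 0ℓ
  Independent I = ∃[ B ] Basis B × I ⊆ B

  independent? : Decidable Independent
  independent? I = anySubset? (λ B → basis? B ×-dec I ⊆? B)

  rank : Subset (size E) → ℕ
  rank S = max 0 (List.map ∣_∣
    (filter (λ I → independent? I ×-dec I ⊆? S) (subsets (size E))))

  Flat : Pred (Subset (size E)) 0ℓ
  Flat F = ∀ e → e ∉ F → rank F ℕ.< rank (F ∪ ⁅ e ⁆)

  flat? : Decidable Flat
  flat? F = all? (λ e → ¬? (e ∈? F) →-dec rank F ℕ.<? rank (F ∪ ⁅ e ⁆))

  Flag : Vec ℕ k → Pred (Vec (Subset (size E)) k) 0ℓ
  Flag rs Fs = VecPointwise (λ F r → Flat F × rank F ≡ r) Fs rs × Linked _⊆_ Fs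

  flag? : (rs : Vec ℕ k) → Decidable (Flag rs)
  flag? rs Fs =
    VecPointwise.decidable (λ F r → flat? F ×-dec rank F ℕ.≟ r) Fs rs
      ×-dec linked? _⊆?_ Fs

record FiniteSet : Set where
  field
    {card}    : ℕ
    elements  : Vec ℕ card
    ascending : Linked ℕ._<_ elements

α : ∀ {E} → Matroid E → FiniteSet → ℤ
α {E} M R = + length (filter (flag? M elements) (vectors (subsets (size E)) card))
  where open FiniteSet R

ℤ-Functions : AbelianGroup 0ℓ 0ℓ
ℤ-Functions = Pointwise.abelianGroup FiniteSet ℤ.+-0-abelianGroup

------------------------------------------------------------------------
-- Base polytopes and valuations

-- Σ_{i ∈ B} e_i
vertex : Subset n → Vector ℝ n
vertex B i = if does (i ∈? B) then 1ᴿ else 0ᴿ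

BasePolytope : ∀ {E} → Matroid E → Pred (Vector ℝ (size E)) 0ℓ
BasePolytope M = conv (λ v → ∃[ B ] Matroid.Basis M B × v ≡ vertex B)

𝟙 : {P : Set ℓ} → Dec P → ℤ
𝟙 d = if does d then 1ℤ else 0ℤ

sumᶻ : Vector ℤ n → ℤ
sumᶻ = foldr ℤ._+_ 0ℤ

-- Σ_i a_i 1_{P(M_i)} = 0 as functions on ℝ^E. Membership of a real point in
-- a polytope is not constructively decidable, so the value of the indicator
-- function at x is read off from any decision of x ∈ P(M_i); under excluded
-- middle such decisions exist at every x, and the values do not depend on
-- their choice.
IndicatorRelation : ∀ {E s} → Vector ℤ s → Vector (Matroid E) s → Set
IndicatorRelation a M =
  ∀ x (d : ∀ i → Dec (BasePolytope (M i) x)) → sumᶻ (λ i → a i ℤ.* 𝟙 (d i)) ≡ 0ℤ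

module _ (G : AbelianGroup c ℓ) where
  open AbelianGroup G
  open RawMonoidOps rawMonoid using () renaming (_×_ to _×ᴺ_; sum to sumᴳ)

  infixr 8 _·_

  _·_ : ℤ → Carrier → Carrier
  (+ n)    · x = n ×ᴺ x
  -[1+ n ] · x = (suc n ×ᴺ x) ⁻¹

  IsValuation : (∀ {E} → Matroid E → Carrier) → Set (lsuc 0ℓ ⊔ˡ ℓ)
  IsValuation f = ∀ {E s} (a : Vector ℤ s) (M : Vector (Matroid E) s) →
    IndicatorRelation a M → sumᴳ (λ i → a i · f (M i)) ≈ ε

  IsInvariant : (∀ {E} → Matroid E → Carrier) → Set (lsuc 0ℓ ⊔ˡ ℓ)
  IsInvariant f = ∀ {E E′} (M : Matroid E) (N : Matroid E′) → M ≅ N → f M ≈ f N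

  record IsValuativeInvariant (f : ∀ {E} → Matroid E → Carrier) : Set (lsuc 0ℓ ⊔ˡ ℓ) where
    field
      isValuation : IsValuation f
      isInvariant : IsInvariant f

{-# OPTIONS --safe #-}
module Submission where

-- For a chain F and L ⊆ E refine the chain to F₁ ⊆ F₁ ∪ L₁ ⊆ F₂ ⊆ F₂ ∪ L₂ ⊆ …, where Lᵢ is the
-- part of L in the next step of the chain. Inclusion–exclusion over L expresses the indicator of
-- "F is a chain of flats of ranks r" by indicators of "the members of the refined chain have
-- prescribed ranks". Each of the latter is a function of the greedy basis of M for an order of E
-- in which the refined chain consists of initial segments, so it suffices that M ↦ [B is the
-- greedy basis of M] is valuative. This indicator is a signed count of finitely many points of
-- P(M): if (e , j) ranges over the potential improvements of B (e ∉ B, j ∈ B, e before j), then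
--
--   [B is greedy] = Σ_G (-1)^|G| [ B + Σ_{(e , j) ∈ G} δ_e (e_e - e_j) ∈ P(M) ]
--
-- over all sets G of improvements, where δ_e is small and increases rapidly with e: if an
-- improvement is available in M, toggling a suitable one does not affect membership; otherwise
-- only G = ∅ contributes. Membership of rational points is decided by Edmonds' inequalities
-- x(S) ≤ rk(S), x(E) = rk(E).

open import Level using (0ℓ)
open import Algebra.Bundles using (AbelianGroup; CommutativeRing)
import Algebra.Definitions.RawMonoid as RawMonoidOps
import Algebra.Properties.Semiring.Sum as SemiringSum
open import Data.Bool.Base using (true; false; if_then_else_)
open import Data.Fin.Base as Fin using (Fin; zero; suc)
import Data.Fin.Properties as Fin
open import Data.Fin.Properties using (any?; all?)
open import Data.Fin.Subset
  using (Subset; inside; outside; _∈_; _∉_; _⊆_; _∪_; _∩_; _─_; ⁅_⁆; ∣_∣; ⊥; ⊤)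
  renaming (_-_ to _∖_)
open import Data.Fin.Subset.Properties
open import Data.Integer.Base as ℤ using (ℤ; +_; 0ℤ; 1ℤ; _+_; _*_; _-_; -_; _≤_; _<_)
import Data.Integer.Properties as ℤ
open import Data.Integer.Tactic.RingSolver using (solve-∀)
open import Data.List.Base as List using (List; []; _∷_)
open import Data.List.Extrema.Nat using (max; xs≤max; argmax-sel)
open import Data.List.Membership.Propositional using () renaming (_∈_ to _∈ˡ_)
open import Data.List.Membership.Propositional.Properties
  using (∈-lookup; ∈-allFin; ∈-map⁺; ∈-map⁻; ∈-filter⁺; ∈-filter⁻;
         ∈-cartesianProduct⁺; ∈-cartesianProductWith⁺)
import Data.List.Properties as List
open import Data.List.Relation.Unary.All as All using (All; []; _∷_)
import Data.List.Relation.Unary.All.Properties as All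
open import Data.List.Relation.Unary.AllPairs using ([]; _∷_)
open import Data.List.Relation.Unary.Any using (here; there; index)
open import Data.List.Relation.Unary.Any.Properties using (lookup-index)
open import Data.List.Relation.Unary.Unique.Propositional using (Unique)
import Data.List.Relation.Unary.Unique.Propositional.Properties as Unique
open import Data.Nat.Base as ℕ using (ℕ; zero; suc)
open import Data.Nat.Induction using (<-wellFounded)
import Data.Nat.Properties as ℕ
open import Data.Nat.Tactic.RingSolver using () renaming (solve-∀ to ℕsolve-∀)
open import Data.Product.Base as Product using (∃; ∃-syntax; _×_; _,_; proj₁; proj₂)
open import Data.Rational.Base as ℚ using (ℚ; 0ℚ; 1ℚ; ½)
import Data.Rational.Properties as ℚ
open import Data.Rational.Solver using (module +-*-Solver)
import Data.Rational.Unnormalised.Base as ℚᵘ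
import Data.Rational.Unnormalised.Properties as ℚᵘ
open import Data.Sum.Base as Sum using (_⊎_; inj₁; inj₂)
open import Data.Vec.Base as Vec using (Vec; []; _∷_; lookup; here; there)
open import Data.Vec.Functional using (Vector)
import Data.Vec.Properties as Vec
open import Data.Vec.Relation.Binary.Pointwise.Inductive as VecPointwise
  using () renaming (Pointwise to VecPointwise)
open import Data.Vec.Relation.Unary.Linked as Linked using (Linked; _∷_; linked?)
import Data.Vec.Relation.Unary.Linked.Properties as Linked
open import Function.Base using (_∘_; id; case_of_)
open import Function.Bundles using (mk⇔; _↔_; Inverse; Equivalence)
open import Function.Properties.Inverse using (↔-sym)
open import Induction.WellFounded using (Acc; acc)
open import Relation.Binary.Definitions using (tri<; tri≈; tri>)
open import Relation.Binary.PropositionalEquality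
open import Relation.Nullary using (¬_; Dec; yes; no; contradiction)
open import Relation.Nullary.Decidable
  using (¬?; _×-dec_; _→-dec_; _⊎-dec_; does; dec-true; dec-false; does-⇔; decidable-stable; map′)
open import Relation.Unary using (Pred; Decidable)

open import Defs

open import Algebra.Properties.Semiring.Sum ℤ.+-*-semiring
  using (sum-cong-≗; ∑-distrib-+; sum-permute; *-distribˡ-sum; sum-replicate-zero)

-- `IndicatorRelation` gives an equation at a point only after membership of that point in all the
-- polytopes has been decided, and for arbitrary real points no decision is at hand. So everything
-- must come from finitely many evaluations at rational points, and N · P(M) is studied through
-- integer vectors. The toggle works at the first place e where B falls behind the rank. There some
-- j in the fundamental circuit of e comes after e, and (e , j) is toggled. Inserting it is
-- harmless, because a set that gains weight has a whole unit of room. Removing it is the delicate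
-- direction and dictates the growth of δ: written in base K, all other moves present contribute
-- multiples of the digit of e, and too few of them sit at that digit to cause a carry. A constraint
-- that holds with the move therefore holds without it. Flatness of F compares F with the mutually
-- incomparable sets F ∪ e, which no single order of E exhibits as initial segments. That all
-- elements of a given L are spanned does concern a single chain, hence the sum over L.

private
  variable
    m n : ℕ

-- Weights of subsets

total : Vector ℤ n → Subset n → ℤ
total x []            = 0ℤ
total x (inside ∷ S)  = x zero + total (x ∘ suc) S
total x (outside ∷ S) = total (x ∘ suc) S

χ : Subset n → Vector ℤ n
χ S i = if lookup S i then 1ℤ else 0ℤ

total-cong : ∀ {x y : Vector ℤ n} → x ≗ y → ∀ S → total x S ≡ total y S
total-cong eq []            = refl
total-cong eq (inside ∷ S)  = cong₂ _+_ (eq zero) (total-cong (eq ∘ suc) S)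
total-cong eq (outside ∷ S) = total-cong (eq ∘ suc) S

private
  interchange : ∀ a b c d → (a + b) + (c + d) ≡ (a + c) + (b + d)
  interchange = solve-∀

total-+ : ∀ (x y : Vector ℤ n) S → total (λ i → x i + y i) S ≡ total x S + total y S
total-+ x y []            = refl
total-+ x y (inside ∷ S)  = trans
  (cong (_+_ (x zero + y zero)) (total-+ (x ∘ suc) (y ∘ suc) S))
  (interchange (x zero) (y zero) (total (x ∘ suc) S) (total (y ∘ suc) S))
total-+ x y (outside ∷ S) = total-+ (x ∘ suc) (y ∘ suc) S

total-* : ∀ c (x : Vector ℤ n) S → total (λ i → c * x i) S ≡ c * total x S
total-* c x []            = sym (ℤ.*-zeroʳ c)
total-* c x (inside ∷ S)  = trans
  (cong (_+_ (c * x zero)) (total-* c (x ∘ suc) S))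
  (sym (ℤ.*-distribˡ-+ c (x zero) (total (x ∘ suc) S)))
total-* c x (outside ∷ S) = total-* c (x ∘ suc) S

total-0 : ∀ (S : Subset n) → total (λ _ → 0ℤ) S ≡ 0ℤ
total-0 []            = refl
total-0 (inside ∷ S)  = trans (ℤ.+-identityˡ _) (total-0 S)
total-0 (outside ∷ S) = total-0 S

total-sum : ∀ (f : Fin m → Vector ℤ n) S →
            total (λ i → sumᶻ (λ p → f p i)) S ≡ sumᶻ (λ p → total (f p) S)
total-sum {m = zero}  f S = total-0 S
total-sum {m = suc m} f S = trans
  (total-+ (f zero) (λ i → sumᶻ (λ p → f (suc p) i)) S)
  (cong (_+_ (total (f zero) S)) (total-sum (f ∘ suc) S))

total-∪∩ : ∀ (x : Vector ℤ n) S T → total x (S ∪ T) + total x (S ∩ T) ≡ total x S + total x T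
total-∪∩ x []            []            = refl
total-∪∩ x (inside ∷ S)  (inside ∷ T)  = trans
  (interchange (x zero) (total (x ∘ suc) (S ∪ T)) (x zero) (total (x ∘ suc) (S ∩ T)))
  (trans (cong (_+_ (x zero + x zero)) (total-∪∩ (x ∘ suc) S T))
         (interchange (x zero) (x zero) (total (x ∘ suc) S) (total (x ∘ suc) T)))
total-∪∩ x (inside ∷ S)  (outside ∷ T) = trans
  (ℤ.+-assoc (x zero) _ _)
  (trans (cong (_+_ (x zero)) (total-∪∩ (x ∘ suc) S T)) (sym (ℤ.+-assoc (x zero) _ _)))
total-∪∩ x (outside ∷ S) (inside ∷ T)  = trans
  (ℤ.+-assoc (x zero) _ _)
  (trans (cong (_+_ (x zero)) (total-∪∩ (x ∘ suc) S T))
         (swap (x zero) (total (x ∘ suc) S) (total (x ∘ suc) T)))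
  where
  swap : ∀ a b c → a + (b + c) ≡ b + (a + c)
  swap = solve-∀
total-∪∩ x (outside ∷ S) (outside ∷ T) = total-∪∩ (x ∘ suc) S T

total-χ : ∀ (B S : Subset n) → total (χ B) S ≡ + ∣ B ∩ S ∣
total-χ []            []            = refl
total-χ (inside ∷ B)  (inside ∷ S)  = cong (_+_ 1ℤ) (total-χ B S)
total-χ (outside ∷ B) (inside ∷ S)  = trans (ℤ.+-identityˡ _) (total-χ B S)
total-χ (inside ∷ B)  (outside ∷ S) = total-χ B S
total-χ (outside ∷ B) (outside ∷ S) = total-χ B S

private
  χ-⊥ : ∀ (i : Fin n) → χ ⊥ i ≡ 0ℤ
  χ-⊥ i = cong (λ b → if b then 1ℤ else 0ℤ) (Vec.lookup-replicate i outside)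

total-χ⁅⁆ : ∀ (e : Fin n) S → total (χ ⁅ e ⁆) S ≡ χ S e
total-χ⁅⁆ zero    (inside ∷ S)  = cong (_+_ 1ℤ) (trans (total-cong χ-⊥ S) (total-0 S))
total-χ⁅⁆ zero    (outside ∷ S) = trans (total-cong χ-⊥ S) (total-0 S)
total-χ⁅⁆ (suc e) (inside ∷ S)  = trans (ℤ.+-identityˡ _) (total-χ⁅⁆ e S)
total-χ⁅⁆ (suc e) (outside ∷ S) = total-χ⁅⁆ e S

χ-∈ : ∀ {S : Subset n} {e} → e ∈ S → χ S e ≡ 1ℤ
χ-∈ e∈S = cong (λ b → if b then 1ℤ else 0ℤ) (Vec.[]=⇒lookup e∈S)

χ-∉ : ∀ {S : Subset n} {e} → e ∉ S → χ S e ≡ 0ℤ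
χ-∉ {S = S} {e} e∉S with lookup S e in eq
... | true  = contradiction (Vec.lookup⇒[]= e S eq) e∉S
... | false = refl

-- Ranks

∣p∖x∣ : ∀ {x} {p : Subset n} → x ∈ p → suc ∣ p ∖ x ∣ ≡ ∣ p ∣
∣p∖x∣ {p = inside ∷ p} here = cong (suc ∘ ∣_∣) (p─⊥≡p p)
∣p∖x∣ {p = inside ∷ p}  (there x∈p) = cong suc (∣p∖x∣ x∈p)
∣p∖x∣ {p = outside ∷ p} (there x∈p) = ∣p∖x∣ x∈p

∣p∪⁅x⁆∣ : ∀ {x} {p : Subset n} → x ∉ p → ∣ p ∪ ⁅ x ⁆ ∣ ≡ suc ∣ p ∣
∣p∪⁅x⁆∣ {x = zero}  {inside ∷ p}  x∉p = contradiction here x∉p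
∣p∪⁅x⁆∣ {x = zero}  {outside ∷ p} x∉p = cong (suc ∘ ∣_∣) (∪-identityʳ p)
∣p∪⁅x⁆∣ {x = suc x} {inside ∷ p}  x∉p = cong suc (∣p∪⁅x⁆∣ (x∉p ∘ there))
∣p∪⁅x⁆∣ {x = suc x} {outside ∷ p} x∉p = ∣p∪⁅x⁆∣ (x∉p ∘ there)

∣p∩q∣+∣p─q∣ : ∀ (p q : Subset n) → ∣ p ∩ q ∣ ℕ.+ ∣ p ─ q ∣ ≡ ∣ p ∣
∣p∩q∣+∣p─q∣ []            []            = refl
∣p∩q∣+∣p─q∣ (inside ∷ p)  (inside ∷ q)  = cong suc (∣p∩q∣+∣p─q∣ p q)
∣p∩q∣+∣p─q∣ (inside ∷ p)  (outside ∷ q) = trans (ℕ.+-suc _ _) (cong suc (∣p∩q∣+∣p─q∣ p q))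
∣p∩q∣+∣p─q∣ (outside ∷ p) (inside ∷ q)  = ∣p∩q∣+∣p─q∣ p q
∣p∩q∣+∣p─q∣ (outside ∷ p) (outside ∷ q) = ∣p∩q∣+∣p─q∣ p q

∣∩∪∣+∣∩∩∣ : ∀ (B S T : Subset n) → ∣ B ∩ (S ∪ T) ∣ ℕ.+ ∣ B ∩ (S ∩ T) ∣ ≡ ∣ B ∩ S ∣ ℕ.+ ∣ B ∩ T ∣
∣∩∪∣+∣∩∩∣ B S T = ℤ.+-injective (begin
  + (∣ B ∩ (S ∪ T) ∣ ℕ.+ ∣ B ∩ (S ∩ T) ∣)     ≡⟨ ℤ.pos-+ ∣ B ∩ (S ∪ T) ∣ _ ⟩
  + ∣ B ∩ (S ∪ T) ∣ + + ∣ B ∩ (S ∩ T) ∣       ≡⟨ cong₂ _+_ (total-χ B (S ∪ T)) (total-χ B (S ∩ T)) ⟨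
  total (χ B) (S ∪ T) + total (χ B) (S ∩ T)   ≡⟨ total-∪∩ (χ B) S T ⟩
  total (χ B) S + total (χ B) T               ≡⟨ cong₂ _+_ (total-χ B S) (total-χ B T) ⟩
  + ∣ B ∩ S ∣ + + ∣ B ∩ T ∣                   ≡⟨ ℤ.pos-+ ∣ B ∩ S ∣ _ ⟨
  + (∣ B ∩ S ∣ ℕ.+ ∣ B ∩ T ∣)                 ∎)
  where open ≡-Reasoning

x∈p─q⁻ : ∀ {x} (p q : Subset n) → x ∈ p ─ q → x ∈ p × x ∉ q
x∈p─q⁻ {x = x} p q x∈p─q = p─q⊆p p q x∈p─q , x∉q p q x∈p─q
  where
  x∉q : ∀ {n} {x} (p q : Subset n) → x ∈ p ─ q → x ∉ q
  x∉q (_ ∷ p) (outside ∷ q) here            ()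
  x∉q (_ ∷ p) (inside ∷ q)  (there x∈p─q) (there x∈q) = x∉q p q x∈p─q x∈q
  x∉q (_ ∷ p) (outside ∷ q) (there x∈p─q) (there x∈q) = x∉q p q x∈p─q x∈q

∩-monoʳ : ∀ (B : Subset n) {S T} → S ⊆ T → B ∩ S ⊆ B ∩ T
∩-monoʳ B {S} S⊆T x∈ = let x∈B , x∈S = x∈p∩q⁻ B S x∈ in x∈p∩q⁺ (x∈B , S⊆T x∈S)

allSubsets? : ∀ {P : Pred (Subset n) 0ℓ} → Decidable P → Dec (∀ S → P S)
allSubsets? P? with anySubset? (¬? ∘ P?)
... | yes (S , ¬PS) = no λ all → ¬PS (all S)
... | no ¬∃         = yes λ S → decidable-stable (P? S) λ ¬PS → ¬∃ (S , ¬PS)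

module _ {A : Set} (f : A → ℕ) (search : ∀ {P : Pred A 0ℓ} → Decidable P → Dec (∃ P)) where

  minimalBy : ∀ {P : Pred A 0ℓ} → Decidable P → ∃ P → ∃[ x ] P x × ∀ y → P y → f x ℕ.≤ f y
  minimalBy {P} P? (x₀ , Px₀) = go x₀ Px₀ (<-wellFounded (f x₀))
    where
    go : ∀ x → P x → Acc ℕ._<_ (f x) → ∃[ x ] P x × ∀ y → P y → f x ℕ.≤ f y
    go x Px (acc rs) with search (λ y → P? y ×-dec f y ℕ.<? f x)
    ... | yes (y , Py , lt) = go y Py (rs lt)
    ... | no ¬∃ = x , Px , λ y Py → ℕ.≮⇒≥ λ lt → ¬∃ (y , Py , lt)

-- For families closed under intersection: a member T of least size lies inside every member S,
-- because S ∩ T is again a member.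
∩-minimal⇒⊆ : ∀ (S T : Subset n) → ∣ T ∣ ℕ.≤ ∣ S ∩ T ∣ → T ⊆ S
∩-minimal⇒⊆ S T T≤S∩T {x} x∈T with x ∈? S
... | yes x∈S = x∈S
... | no  x∉S = contradiction T≤S∩T
  (ℕ.<⇒≱ (p⊂q⇒∣p∣<∣q∣ (p∩q⊆q S T , x , x∈T , x∉S ∘ proj₁ ∘ x∈p∩q⁻ S T)))

module _ {A : Set} where
  ∈-vectors : ∀ {xs : List A} → (∀ x → x ∈ˡ xs) → ∀ {n} (v : Vec A n) → v ∈ˡ vectors xs n
  ∈-vectors all []      = here refl
  ∈-vectors all (x ∷ v) = ∈-cartesianProductWith⁺ _∷_ (all x) (∈-vectors all v)

∈-subsets : ∀ (S : Subset n) → S ∈ˡ subsets n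
∈-subsets = ∈-vectors λ { false → here refl ; true → there (here refl) }

module _ {E : GroundSet} (M : Matroid E) where
  open Matroid M

  ∣B∩S∣≤rank : ∀ {B} → Basis B → ∀ S → ∣ B ∩ S ∣ ℕ.≤ rank M S
  ∣B∩S∣≤rank {B} bB S = All.lookup (xs≤max 0 _)
    (∈-map⁺ ∣_∣ (∈-filter⁺ (λ I → independent? M I ×-dec I ⊆? S) (∈-subsets (B ∩ S)) ((B , bB , p∩q⊆p B S) , p∩q⊆q B S)))

  rank-attained : ∀ S → ∃[ B ] Basis B × ∣ B ∩ S ∣ ≡ rank M S
  rank-attained S with argmax-sel id 0 sizes
    where sizes = List.map ∣_∣ (List.filter (λ I → independent? M I ×-dec I ⊆? S) (subsets (size E)))
  -- Here `max` returned its default value 0, which any basis attains.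
  ... | inj₁ eq0 = let B , bB = nonempty in
    B , bB , ℕ.≤-antisym (∣B∩S∣≤rank bB S) (ℕ.≤-trans (ℕ.≤-reflexive eq0) ℕ.z≤n)
  ... | inj₂ mem with ∈-map⁻ ∣_∣ mem
  ... | I , I∈ , eq with ∈-filter⁻ (λ I → independent? M I ×-dec I ⊆? S) {xs = subsets (size E)} I∈
  ... | _ , (B , bB , I⊆B) , I⊆S = B , bB , ℕ.≤-antisym (∣B∩S∣≤rank bB S)
    (ℕ.≤-trans (ℕ.≤-reflexive eq) (p⊆q⇒∣p∣≤∣q∣ λ x∈I → x∈p∩q⁺ (I⊆B x∈I , I⊆S x∈I)))

  -- Exchanging elements of A outside T ∪ B until none is left.
  exchangeTowards : ∀ {A B} → Basis A → Basis B → ∀ T →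
    ∃[ A′ ] Basis A′ × A′ ─ T ⊆ B × ∣ A′ ∣ ≡ ∣ A ∣ × (∀ {S} → S ⊆ T → ∣ A ∩ S ∣ ℕ.≤ ∣ A′ ∩ S ∣)
  exchangeTowards {A} {B} bA bB T = go bA (<-wellFounded ∣ A ─ B ∣)
    where
    go : ∀ {A} → Basis A → Acc ℕ._<_ ∣ A ─ B ∣ →
      ∃[ A′ ] Basis A′ × A′ ─ T ⊆ B × ∣ A′ ∣ ≡ ∣ A ∣ × (∀ {S} → S ⊆ T → ∣ A ∩ S ∣ ℕ.≤ ∣ A′ ∩ S ∣)
    go {A} bA (acc rs) with nonempty? ((A ─ T) ─ B)
    ... | no empty = A , bA , A─T⊆B , refl , λ _ → ℕ.≤-refl
      where
      A─T⊆B : A ─ T ⊆ B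
      A─T⊆B {x} x∈ with x ∈? B
      ... | yes x∈B = x∈B
      ... | no  x∉B = contradiction (x , x∈p∧x∉q⇒x∈p─q x∈ x∉B) empty
    ... | yes (x , x∈) =
      let x∈A─T , x∉B = x∈p─q⁻ (A ─ T) B x∈
          x∈A , x∉T = x∈p─q⁻ A T x∈A─T
          y , y∈B , y∉A , bA′ = exchange bA bB x∈A x∉B
          A′ = (A ∖ x) ∪ ⁅ y ⁆
          y∉A∖x = λ y∈ → y∉A (p─q⊆p A ⁅ x ⁆ y∈)
          A′─B⊆A─B : A′ ─ B ⊆ A ─ B
          A′─B⊆A─B = λ {z} z∈ → let z∈A′ , z∉B = x∈p─q⁻ A′ B z∈ in
            case (x∈p∪q⁻ (A ∖ x) ⁅ y ⁆ z∈A′) of λ where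
              (inj₁ z∈A∖x) → x∈p∧x∉q⇒x∈p─q (p─q⊆p A ⁅ x ⁆ z∈A∖x) z∉B
              (inj₂ z∈y) → contradiction (subst (_∈ B) (sym (x∈⁅y⁆⇒x≡y y z∈y)) y∈B) z∉B
          x∉A′─B : x ∉ A′ ─ B
          x∉A′─B = λ x∈ → case (x∈p∪q⁻ (A ∖ x) ⁅ y ⁆ (p─q⊆p A′ B x∈)) of λ where
              (inj₁ x∈A∖x) → proj₂ (x∈p─q⁻ A ⁅ x ⁆ x∈A∖x) (x∈⁅x⁆ x)
              (inj₂ x∈y) → x∉B (subst (_∈ B) (sym (x∈⁅y⁆⇒x≡y y x∈y)) y∈B)
          A″ , bA″ , A″─T⊆B , card , grow = go bA′
            (rs (p⊂q⇒∣p∣<∣q∣ (A′─B⊆A─B , x , x∈p∧x∉q⇒x∈p─q x∈A x∉B , x∉A′─B)))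
      in A″ , bA″ , A″─T⊆B
       , trans card (trans (∣p∪⁅x⁆∣ y∉A∖x) (∣p∖x∣ x∈A))
       -- The removed x is outside T, so no element of S ⊆ T is ever lost.
       , λ {S} S⊆T → ℕ.≤-trans (p⊆q⇒∣p∣≤∣q∣ {q = A′ ∩ S} λ {z} z∈ →
           let z∈A , z∈S = x∈p∩q⁻ A S z∈ in
           x∈p∩q⁺ (x∈p∪q⁺ {q = ⁅ y ⁆} (inj₁ (x∈p∧x≢y⇒x∈p-y z∈A λ { refl → x∉T (S⊆T z∈S) })) , z∈S))
           (grow S⊆T)
      where open import Function.Base using (case_of_)

  -- With `T = ⊥` the whole of A is traded into B without changing its size.
  basis-card≤ : ∀ {A B} → Basis A → Basis B → ∣ A ∣ ℕ.≤ ∣ B ∣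
  basis-card≤ bA bB =
    let A′ , _ , A′⊆B , card , _ = exchangeTowards bA bB ⊥ in
    ℕ.≤-trans (ℕ.≤-reflexive (sym card))
      (p⊆q⇒∣p∣≤∣q∣ λ x∈ → A′⊆B (x∈p∧x∉q⇒x∈p─q x∈ ∉⊥))

  basis-card : ∀ {A B} → Basis A → Basis B → ∣ A ∣ ≡ ∣ B ∣
  basis-card bA bB = ℕ.≤-antisym (basis-card≤ bA bB) (basis-card≤ bB bA)

  -- Trade A towards a basis B that attains the rank of T. Outside T the result is contained in B,
  -- and all bases have equal size, so inside T it has at least as many elements as B. Since nothing
  -- is lost on subsets of T, the sets of a chain can be saturated one after another.
  saturate : ∀ {A} → Basis A → ∀ T → ∃[ A′ ] Basis A′ × ∣ A′ ∩ T ∣ ≡ rank M T ×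
             (∀ {S} → S ⊆ T → ∣ A ∩ S ∣ ℕ.≤ ∣ A′ ∩ S ∣)
  saturate bA T =
    let B , bB , B∩T≡ = rank-attained T
        A′ , bA′ , A′─T⊆B , _ , grow = exchangeTowards bA bB T
        A′─T≤B─T : ∣ A′ ─ T ∣ ℕ.≤ ∣ B ─ T ∣
        A′─T≤B─T = p⊆q⇒∣p∣≤∣q∣ λ x∈ →
          x∈p∧x∉q⇒x∈p─q (A′─T⊆B x∈) (proj₂ (x∈p─q⁻ A′ T x∈))
        sizes : ∣ B ∩ T ∣ ℕ.+ ∣ B ─ T ∣ ≡ ∣ A′ ∩ T ∣ ℕ.+ ∣ A′ ─ T ∣
        sizes = trans (∣p∩q∣+∣p─q∣ B T) (trans (basis-card bB bA′) (sym (∣p∩q∣+∣p─q∣ A′ T)))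
    in A′ , bA′
     , ℕ.≤-antisym (∣B∩S∣≤rank bA′ T) (subst (ℕ._≤ ∣ A′ ∩ T ∣) B∩T≡
         (ℕ.+-cancelʳ-≤ ∣ B ─ T ∣ _ _ (ℕ.≤-trans (ℕ.≤-reflexive sizes)
           (ℕ.+-monoʳ-≤ ∣ A′ ∩ T ∣ A′─T≤B─T))))
     , grow

  rank-mono : ∀ {S T} → S ⊆ T → rank M S ℕ.≤ rank M T
  rank-mono {S} {T} S⊆T = let B , bB , eq = rank-attained S in
    subst (ℕ._≤ rank M T) eq
      (ℕ.≤-trans (p⊆q⇒∣p∣≤∣q∣ (∩-monoʳ B S⊆T)) (∣B∩S∣≤rank bB T))

  rank≤card : ∀ S → rank M S ℕ.≤ ∣ S ∣
  rank≤card S = let B , _ , eq = rank-attained S in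
    subst (ℕ._≤ ∣ S ∣) eq (∣p∩q∣≤∣q∣ B S)

  -- A single basis attains the rank on both S ∩ T and S ∪ T; for its intersections with the four
  -- sets equality holds.
  rank-submodular : ∀ S T → rank M (S ∪ T) ℕ.+ rank M (S ∩ T) ℕ.≤ rank M S ℕ.+ rank M T
  rank-submodular S T =
    let A , bA , A∩≡ = rank-attained (S ∩ T)
        B , bB , B∪≡ , grow = saturate bA (S ∪ T)
        S∩T⊆S∪T : S ∩ T ⊆ S ∪ T
        S∩T⊆S∪T x∈ = p⊆p∪q T (p∩q⊆p S T x∈)
    in begin
      rank M (S ∪ T) ℕ.+ rank M (S ∩ T)        ≡⟨ cong₂ ℕ._+_ B∪≡ A∩≡ ⟨
      ∣ B ∩ (S ∪ T) ∣ ℕ.+ ∣ A ∩ (S ∩ T) ∣      ≤⟨ ℕ.+-monoʳ-≤ ∣ B ∩ (S ∪ T) ∣ (grow S∩T⊆S∪T) ⟩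
      ∣ B ∩ (S ∪ T) ∣ ℕ.+ ∣ B ∩ (S ∩ T) ∣      ≡⟨ ∣∩∪∣+∣∩∩∣ B S T ⟩
      ∣ B ∩ S ∣ ℕ.+ ∣ B ∩ T ∣                  ≤⟨ ℕ.+-mono-≤ (∣B∩S∣≤rank bB S) (∣B∩S∣≤rank bB T) ⟩
      rank M S ℕ.+ rank M T                    ∎
    where open ℕ.≤-Reasoning

  rank-∪⁅⁆ : ∀ S e → rank M (S ∪ ⁅ e ⁆) ℕ.≤ suc (rank M S)
  rank-∪⁅⁆ S e = begin
    rank M (S ∪ ⁅ e ⁆)                            ≤⟨ ℕ.m≤m+n _ _ ⟩
    rank M (S ∪ ⁅ e ⁆) ℕ.+ rank M (S ∩ ⁅ e ⁆)     ≤⟨ rank-submodular S ⁅ e ⁆ ⟩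
    rank M S ℕ.+ rank M ⁅ e ⁆                     ≤⟨ ℕ.+-monoʳ-≤ (rank M S) (rank≤card ⁅ e ⁆) ⟩
    rank M S ℕ.+ ∣ ⁅ e ⁆ ∣                        ≡⟨ cong (rank M S ℕ.+_) (∣⁅x⁆∣≡1 e) ⟩
    rank M S ℕ.+ 1                                ≡⟨ ℕ.+-comm (rank M S) 1 ⟩
    suc (rank M S)                                ∎
    where open ℕ.≤-Reasoning

  rank-⊥ : rank M ⊥ ≡ 0
  rank-⊥ = ℕ.n≤0⇒n≡0 (ℕ.≤-trans (rank≤card ⊥) (ℕ.≤-reflexive (∣⊥∣≡0 (size E))))

  basis⇒∣B∣≡rank : ∀ {B} → Basis B → ∣ B ∣ ≡ rank M ⊤
  basis⇒∣B∣≡rank {B} bB = let A , bA , eq = rank-attained ⊤ in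
    trans (basis-card bB bA) (trans (cong ∣_∣ (sym (∩-identityʳ A))) eq)

  full-rank⇒basis : ∀ {B} → ∣ B ∣ ≡ rank M ⊤ → ∣ B ∣ ℕ.≤ rank M B → Basis B
  full-rank⇒basis {B} card≡ card≤ =
    let A , bA , eq = rank-attained B
        B⊆A : B ⊆ A
        B⊆A = ∩-minimal⇒⊆ A B (ℕ.≤-trans card≤ (ℕ.≤-reflexive (sym eq)))
        A⊆B : A ⊆ B
        A⊆B = ∩-minimal⇒⊆ B A (ℕ.≤-trans
          (ℕ.≤-reflexive (trans (basis⇒∣B∣≡rank bA) (sym card≡)))
          (p⊆q⇒∣p∣≤∣q∣ λ x∈B → x∈p∩q⁺ (x∈B , B⊆A x∈B)))
    in subst Basis (⊆-antisym A⊆B B⊆A) bA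

-- Transfers of weight between elements

0≤+ : ∀ {a b} → 0ℤ ≤ a → 0ℤ ≤ b → 0ℤ ≤ a + b
0≤+ = ℤ.+-mono-≤

-- The pattern of the linear estimates: a ring identity displays b - a as a sum of terms known to be
-- nonnegative.
≤-lin : ∀ {a b c} → 0ℤ ≤ c → b - a ≡ c → a ≤ b
≤-lin {a} {b} 0≤c eq = ℤ.0≤i-j⇒j≤i {b} {a} (subst (0ℤ ≤_) (sym eq) 0≤c)

total-∖ : ∀ (x : Vector ℤ n) {j S} → j ∈ S → total x (S ∖ j) + x j ≡ total x S
total-∖ x {S = inside ∷ S} here = trans (cong (λ p → total (x ∘ suc) p + x zero) (p─⊥≡p S)) (ℤ.+-comm _ (x zero))
total-∖ x {suc j} {inside ∷ S}  (there j∈S) = trans (ℤ.+-assoc (x zero) _ _)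
  (cong (_+_ (x zero)) (total-∖ (x ∘ suc) j∈S))
total-∖ x {suc j} {outside ∷ S} (there j∈S) = total-∖ (x ∘ suc) j∈S

total-⁅⁆ : ∀ (x : Vector ℤ n) j → total x ⁅ j ⁆ ≡ x j
total-⁅⁆ x zero    = trans (cong (_+_ (x zero)) (total-⊥ (x ∘ suc))) (ℤ.+-identityʳ _)
  where
  total-⊥ : ∀ {n} (x : Vector ℤ n) → total x ⊥ ≡ 0ℤ
  total-⊥ {zero}  x = refl
  total-⊥ {suc n} x = total-⊥ (x ∘ suc)
total-⁅⁆ x (suc j) = total-⁅⁆ (x ∘ suc) j

shift : Fin n → Fin n → Vector ℤ n
shift i j e = χ ⁅ i ⁆ e - χ ⁅ j ⁆ e

total-shift : ∀ (i j : Fin n) S → total (shift i j) S ≡ χ S i - χ S j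
total-shift i j S = begin
  total (λ e → χ ⁅ i ⁆ e - χ ⁅ j ⁆ e) S               ≡⟨ total-cong (λ e → cong (_+_ (χ ⁅ i ⁆ e)) (sym (ℤ.-1*i≡-i (χ ⁅ j ⁆ e)))) S ⟩
  total (λ e → χ ⁅ i ⁆ e + ℤ.-1ℤ * χ ⁅ j ⁆ e) S       ≡⟨ total-+ (χ ⁅ i ⁆) (λ e → ℤ.-1ℤ * χ ⁅ j ⁆ e) S ⟩
  total (χ ⁅ i ⁆) S + total (λ e → ℤ.-1ℤ * χ ⁅ j ⁆ e) S ≡⟨ cong (_+_ (total (χ ⁅ i ⁆) S)) (total-* ℤ.-1ℤ (χ ⁅ j ⁆) S) ⟩
  total (χ ⁅ i ⁆) S + ℤ.-1ℤ * total (χ ⁅ j ⁆) S       ≡⟨ cong₂ (λ a b → a + ℤ.-1ℤ * b) (total-χ⁅⁆ i S) (total-χ⁅⁆ j S) ⟩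
  χ S i + ℤ.-1ℤ * χ S j                               ≡⟨ cong (_+_ (χ S i)) (ℤ.-1*i≡-i (χ S j)) ⟩
  χ S i - χ S j                                       ∎
  where open ≡-Reasoning

moved : Vector ℤ n → ℤ → Fin n → Fin n → Vector ℤ n
moved x t i j e = x e + t * shift i j e

total-moved : ∀ (x : Vector ℤ n) t i j S → total (moved x t i j) S ≡ total x S + t * (χ S i - χ S j)
total-moved x t i j S = trans (total-+ x (λ e → t * shift i j e) S)
  (cong (_+_ (total x S)) (trans (total-* t (shift i j) S) (cong (t *_) (total-shift i j S))))

χ-cases : ∀ (S : Subset n) e → (e ∈ S × χ S e ≡ 1ℤ) ⊎ (e ∉ S × χ S e ≡ 0ℤ)
χ-cases S e with e ∈? S
... | yes e∈S = inj₁ (e∈S , χ-∈ e∈S)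
... | no  e∉S = inj₂ (e∉S , χ-∉ e∉S)

module _ {A : Set} {P Q : Pred A 0ℓ} (P? : Decidable P) (Q? : Decidable Q)
         (P⇒Q : ∀ {x} → P x → Q x) where

  length-filter-mono : ∀ xs → List.length (List.filter P? xs) ℕ.≤ List.length (List.filter Q? xs)
  length-filter-mono []       = ℕ.z≤n
  length-filter-mono (x ∷ xs) with P? x | Q? x
  ... | yes _  | yes _  = ℕ.s≤s (length-filter-mono xs)
  ... | yes Px | no ¬Qx = contradiction (P⇒Q Px) ¬Qx
  ... | no _   | yes _  = ℕ.m≤n⇒m≤1+n (length-filter-mono xs)
  ... | no _   | no _   = length-filter-mono xs

  length-filter-strict : ∀ {y xs} → y ∈ˡ xs → Q y → ¬ P y →
    List.length (List.filter P? xs) ℕ.< List.length (List.filter Q? xs)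
  length-filter-strict {y} {x ∷ xs} y∈ Qy ¬Py with P? x | Q? x | y∈
  ... | yes Px | no ¬Qx | _         = contradiction (P⇒Q Px) ¬Qx
  ... | yes Px | yes _  | here refl = contradiction Px ¬Py
  ... | no _   | no ¬Qx | here refl = contradiction Qy ¬Qx
  ... | no _   | yes _  | here refl = ℕ.s≤s (length-filter-mono xs)
  ... | yes _  | yes _  | there y∈′ = ℕ.s≤s (length-filter-strict y∈′ Qy ¬Py)
  ... | no _   | yes _  | there y∈′ = ℕ.m<n⇒m<1+n (length-filter-strict y∈′ Qy ¬Py)
  ... | no _   | no _   | there y∈′ = length-filter-strict y∈′ Qy ¬Py

-- Edmonds' inequalities

-- The inequalities cutting out N · P(M).
module _ {E : GroundSet} (M : Matroid E) (N : ℕ) where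

  bound : Subset (size E) → ℤ
  bound S = + N * + rank M S

  Feasible : Pred (Vector ℤ (size E)) 0ℓ
  Feasible x = (∀ S → total x S ≤ bound S) × total x ⊤ ≡ bound ⊤

  feasible? : Decidable Feasible
  feasible? x = allSubsets? (λ S → total x S ℤ.≤? bound S) ×-dec total x ⊤ ℤ.≟ bound ⊤

  Tight : Vector ℤ (size E) → Pred (Subset (size E)) 0ℓ
  Tight x S = total x S ≡ bound S

  bound-mono : ∀ {S T} → S ⊆ T → bound S ≤ bound T
  bound-mono S⊆T = ℤ.*-monoˡ-≤-nonNeg (+ N) (ℤ.+≤+ (rank-mono M S⊆T))

  bound-submodular : ∀ S T → bound (S ∪ T) + bound (S ∩ T) ≤ bound S + bound T
  bound-submodular S T = subst₂ _≤_
    (distrib (S ∪ T) (S ∩ T)) (distrib S T)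
    (ℤ.*-monoˡ-≤-nonNeg (+ N) (ℤ.+≤+ (rank-submodular M S T)))
    where
    distrib : ∀ S T → + N * + (rank M S ℕ.+ rank M T) ≡ bound S + bound T
    distrib S T = trans (cong (+ N *_) (ℤ.pos-+ (rank M S) (rank M T))) (ℤ.*-distribˡ-+ (+ N) _ _)

  module _ {x} (below : ∀ S → total x S ≤ bound S) where
    private
      slack : ∀ S → 0ℤ ≤ bound S - total x S
      slack S = ℤ.i≤j⇒0≤j-i (below S)

      -- Totals are modular and bounds submodular, so the slacks of S ∪ T and S ∩ T have sum at most
      -- 0. Each slack is nonnegative, hence both vanish.
      uncross : ∀ {S T} → Tight x S → Tight x T →
        0ℤ ≤ (total x (S ∪ T) + total x (S ∩ T)) - (bound (S ∪ T) + bound (S ∩ T))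
      uncross {S} {T} tS tT = subst (λ z → 0ℤ ≤ z - (bound (S ∪ T) + bound (S ∩ T)))
        (trans (sym (cong₂ _+_ tS tT)) (sym (total-∪∩ x S T)))
        (ℤ.i≤j⇒0≤j-i (bound-submodular S T))

      rearrange : ∀ a b c d → a - b ≡ (c - d) + ((d + a) - (c + b))
      rearrange = solve-∀

      rearrange′ : ∀ a b c d → a - b ≡ (c - d) + ((a + d) - (b + c))
      rearrange′ = solve-∀

    tight-∩ : ∀ {S T} → Tight x S → Tight x T → Tight x (S ∩ T)
    tight-∩ {S} {T} tS tT = ℤ.≤-antisym (below (S ∩ T))
      (≤-lin (0≤+ (slack (S ∪ T)) (uncross {S} {T} tS tT))
        (rearrange (total x (S ∩ T)) (bound (S ∩ T)) (bound (S ∪ T)) (total x (S ∪ T))))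

    tight-∪ : ∀ {S T} → Tight x S → Tight x T → Tight x (S ∪ T)
    tight-∪ {S} {T} tS tT = ℤ.≤-antisym (below (S ∪ T))
      (≤-lin (0≤+ (slack (S ∩ T)) (uncross {S} {T} tS tT))
        (rearrange′ (total x (S ∪ T)) (bound (S ∪ T)) (bound (S ∩ T)) (total x (S ∩ T))))

  -- Nonnegativity is not among the defining inequalities. It follows from x i = x(E) - x(E - i),
  -- the bound on E - i and monotonicity of the rank.
  coordinate≥0 : ∀ {x} → Feasible x → ∀ i → 0ℤ ≤ x i
  coordinate≥0 {x} (below , full) i = ≤-lin
    (0≤+ (ℤ.i≤j⇒0≤j-i (below (⊤ ∖ i))) (ℤ.i≤j⇒0≤j-i (bound-mono {⊤ ∖ i} ⊆⊤)))
    (trans (cong (_- 0ℤ) (x≡ (total x (⊤ ∖ i)) (x i)))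
      (trans (cong (λ z → z - total x (⊤ ∖ i) - 0ℤ) (trans (total-∖ x (∈⊤ {x = i})) full))
        (arith (bound ⊤) (total x (⊤ ∖ i)) (bound (⊤ ∖ i)))))
    where
    x≡ : ∀ a b → b ≡ a + b - a
    x≡ = solve-∀
    arith : ∀ a b c → a - b - 0ℤ ≡ (c - b) + (a - c)
    arith = solve-∀

  coordinate≤N : ∀ {x} → Feasible x → ∀ i → x i ≤ + N
  coordinate≤N {x} (below , _) i = begin
    x i             ≡⟨ total-⁅⁆ x i ⟨
    total x ⁅ i ⁆   ≤⟨ below ⁅ i ⁆ ⟩
    bound ⁅ i ⁆     ≤⟨ ℤ.*-monoˡ-≤-nonNeg (+ N) (ℤ.+≤+ (subst (rank M ⁅ i ⁆ ℕ.≤_) (∣⁅x⁆∣≡1 i) (rank≤card M ⁅ i ⁆))) ⟩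
    + N * 1ℤ        ≡⟨ ℤ.*-identityʳ (+ N) ⟩
    + N             ∎
    where open ℤ.≤-Reasoning

  -- Weight is moved from j to i until a new set becomes tight; at the latest this
  -- happens when x j is exhausted, as the complement of j is then tight.
  module _ {x} (feas : Feasible x) {i j} (i∼j : ∀ S → Tight x S → (i ∈ S → j ∈ S) × (j ∈ S → i ∈ S))
           (i≢j : i ≢ j) (0<xj : 0ℤ < x j) where

    -- A tight set contains both or neither of i and j, so the transfer leaves its weight unchanged.
    tight-moved : ∀ t {S} → Tight x S → Tight (moved x t i j) S
    tight-moved t {S} tS = trans (total-moved x t i j S)
      (trans (cong (λ z → total x S + t * z) χ-diff)
        (trans (cong (_+_ (total x S)) (ℤ.*-zeroʳ t)) (trans (ℤ.+-identityʳ _) tS)))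
      where
      χ-diff : χ S i - χ S j ≡ 0ℤ
      χ-diff with χ-cases S i | χ-cases S j
      ... | inj₁ (_ , p)   | inj₁ (_ , q)   = cong₂ _-_ p q
      ... | inj₂ (_ , p)   | inj₂ (_ , q)   = cong₂ _-_ p q
      ... | inj₁ (i∈S , _) | inj₂ (j∉S , _) = contradiction (proj₁ (i∼j S tS) i∈S) j∉S
      ... | inj₂ (i∉S , _) | inj₁ (j∈S , _) = contradiction (proj₂ (i∼j S tS) j∈S) i∉S

    Pushed : Set
    Pushed = ∃[ t ] Feasible (moved x (+ suc t) i j) × ∃[ S ] Tight (moved x (+ suc t) i j) S × ¬ Tight x S

    push : Pushed
    push = go ℤ.∣ x j ∣ 0 (sym (trans (ℤ.+-identityʳ _) (ℤ.0≤i⇒+∣i∣≡i (ℤ.<⇒≤ 0<xj)))) feas₀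
      where
      moved-0 : moved x 0ℤ i j ≗ x
      moved-0 e = ℤ.+-identityʳ (x e)
      feas₀ : Feasible (moved x 0ℤ i j)
      feas₀ = (λ S → subst (_≤ bound S) (sym (total-cong moved-0 S)) (proj₁ feas S))
            , trans (total-cong moved-0 ⊤) (proj₂ feas)
      -- After t unit transfers coordinate j holds k, which therefore bounds the remaining steps.
      go : ∀ k t → x j ≡ + k + + t → Feasible (moved x (+ t) i j) → Pushed
      go k t eq fy with anySubset? (λ S → total (moved x (+ t) i j) S ℤ.≟ bound S ×-dec ¬? (total x S ℤ.≟ bound S))
      go k zero    eq fy | yes (S , tS , ¬tS) = contradiction (trans (sym (total-cong moved-0 S)) tS) ¬tS
      go k (suc t) eq fy | yes new = t , fy , new
      go zero t eq fy | no ¬new = contradiction (⊤ ∖ j , tight , nontight) ¬new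
        where
        y = moved x (+ t) i j
        yj≡0 : y j ≡ 0ℤ
        yj≡0 = trans (cong₂ (λ a b → x j + + t * (a - b))
            (χ-∉ {S = ⁅ i ⁆} (i≢j ∘ sym ∘ x∈⁅y⁆⇒x≡y i)) (χ-∈ (x∈⁅x⁆ j)))
          (trans (cong (_+ + t * ℤ.-1ℤ) eq) (cancel (+ t)))
          where
          cancel : ∀ a → 0ℤ + a + a * ℤ.-1ℤ ≡ 0ℤ
          cancel = solve-∀
        y∖j : total y (⊤ ∖ j) ≡ bound ⊤
        y∖j = trans (sym (ℤ.+-identityʳ _))
          (trans (cong (_+_ (total y (⊤ ∖ j))) (sym yj≡0)) (trans (total-∖ y (∈⊤ {x = j})) (proj₂ fy)))
        bound∖j : bound (⊤ ∖ j) ≡ bound ⊤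
        bound∖j = ℤ.≤-antisym (bound-mono {⊤ ∖ j} ⊆⊤) (subst (_≤ bound (⊤ ∖ j)) y∖j (proj₁ fy (⊤ ∖ j)))
        tight : Tight y (⊤ ∖ j)
        tight = trans y∖j (sym bound∖j)
        nontight : ¬ Tight x (⊤ ∖ j)
        nontight t = ℤ.<⇒≢ 0<xj (sym (cancelˡ (total x (⊤ ∖ j)) (x j)
          (trans (total-∖ x (∈⊤ {x = j})) (trans (proj₂ feas) (sym (trans t bound∖j))))))
          where
          cancelˡ : ∀ a b → a + b ≡ a → b ≡ 0ℤ
          cancelˡ a b eq = trans (x≡ a b) (trans (cong (_- a) eq) (ℤ.+-inverseʳ a))
            where
            x≡ : ∀ a b → b ≡ a + b - a
            x≡ = solve-∀
      go (suc k) t eq fy | no ¬new = go k (suc t) eq′ (below , full)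
        where
        y = moved x (+ t) i j
        eq′ : x j ≡ + k + + suc t
        eq′ = trans eq (cong +_ (sym (ℕ.+-suc k t)))
        step : ∀ S → total (moved x (+ suc t) i j) S ≡ total y S + (χ S i - χ S j)
        step S = trans (total-moved x (+ suc t) i j S)
          (trans (arith (total x S) (+ t) (χ S i - χ S j))
            (cong (_+ (χ S i - χ S j)) (sym (total-moved x (+ t) i j S))))
          where
          arith : ∀ a t d → a + (1ℤ + t) * d ≡ (a + t * d) + d
          arith = solve-∀
        full : total (moved x (+ suc t) i j) ⊤ ≡ bound ⊤
        full = tight-moved (+ suc t) (proj₂ feas)
        below : ∀ S → total (moved x (+ suc t) i j) S ≤ bound S
        below S with χ-cases S i | χ-cases S j
        ... | inj₁ (_ , p)   | inj₁ (_ , q)   = subst (_≤ bound S) (sym (trans (step S)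
                (trans (cong₂ (λ a b → total y S + (a - b)) p q) (ℤ.+-identityʳ _)))) (proj₁ fy S)
        ... | inj₂ (_ , p)   | inj₂ (_ , q)   = subst (_≤ bound S) (sym (trans (step S)
                (trans (cong₂ (λ a b → total y S + (a - b)) p q) (ℤ.+-identityʳ _)))) (proj₁ fy S)
        ... | inj₂ (_ , p)   | inj₁ (_ , q)   = ℤ.≤-trans (ℤ.≤-reflexive (trans (step S)
                (cong₂ (λ a b → total y S + (a - b)) p q))) (ℤ.≤-trans (ℤ.i-j≤i (total y S) 1ℤ) (proj₁ fy S))
        -- S gains one unit. It is not tight at y: it was not tight at x, as it separates i from j,
        -- and no new set has become tight. By integrality there is room for the unit.
        ... | inj₁ (i∈S , p) | inj₂ (j∉S , q) = ℤ.≤-trans (ℤ.≤-reflexive (trans (step S)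
                (trans (cong₂ (λ a b → total y S + (a - b)) p q) (ℤ.+-comm (total y S) 1ℤ))))
                (ℤ.i<j⇒suc[i]≤j (ℤ.≤∧≢⇒< (proj₁ fy S) ¬tight-y))
          where
          ¬tight-y : ¬ Tight y S
          ¬tight-y tS with total x S ℤ.≟ bound S
          ... | yes tx = j∉S (proj₁ (i∼j S tx) i∈S)
          ... | no ¬tx = ¬new (S , tS , ¬tx)

-- Rational convex combinations of bases

count : List (Subset n) → Vector ℤ n
count []      i = 0ℤ
count (B ∷ L) i = χ B i + count L i

count-++ : ∀ (K L : List (Subset n)) i → count (K List.++ L) i ≡ count K i + count L i
count-++ []      L i = sym (ℤ.+-identityˡ _)
count-++ (B ∷ K) L i = trans (cong (_+_ (χ B i)) (count-++ K L i)) (sym (ℤ.+-assoc (χ B i) _ _))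

copies : ℕ → List (Subset n) → List (Subset n)
copies zero    L = []
copies (suc k) L = L List.++ copies k L

count-copies : ∀ k (L : List (Subset n)) i → count (copies k L) i ≡ + k * count L i
count-copies zero    L i = refl
count-copies (suc k) L i = trans (count-++ L (copies k L) i)
  (trans (cong (_+_ (count L i)) (count-copies k L i)) (arith (count L i) (+ k)))
  where
  arith : ∀ a k → a + k * a ≡ (1ℤ + k) * a
  arith = solve-∀

length-copies : ∀ k (L : List (Subset n)) → List.length (copies k L) ≡ k ℕ.* List.length L
length-copies zero    L = refl
length-copies (suc k) L = trans (List.length-++ L) (cong (List.length L ℕ.+_) (length-copies k L))

All-copies : ∀ {P : Pred (Subset n) 0ℓ} k {L} → All P L → All P (copies k L)
All-copies zero    PL = []
All-copies (suc k) PL = All.++⁺ PL (All-copies k PL)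

-- Used for divisibility: a tight set has a multiple of N as total, so it cannot contain exactly one
-- coordinate strictly between 0 and N.
multiple-or-fractional : ∀ (x : Vector ℤ n) N S →
  (∃[ q ] total x S ≡ q * N) ⊎ (∃[ i ] i ∈ S × x i ≢ 0ℤ × x i ≢ N)
multiple-or-fractional x N []            = inj₁ (0ℤ , sym (ℤ.*-zeroˡ N))
multiple-or-fractional x N (outside ∷ S) with multiple-or-fractional (x ∘ suc) N S
... | inj₁ p                   = inj₁ p
... | inj₂ (i , i∈S , ≢0 , ≢N) = inj₂ (suc i , there i∈S , ≢0 , ≢N)
multiple-or-fractional x N (inside ∷ S) with multiple-or-fractional (x ∘ suc) N S
... | inj₂ (i , i∈S , ≢0 , ≢N) = inj₂ (suc i , there i∈S , ≢0 , ≢N)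
... | inj₁ (q , eq) with x zero ℤ.≟ 0ℤ | x zero ℤ.≟ N
... | yes x≡0 | _       = inj₁ (q , trans (cong₂ _+_ x≡0 eq) (ℤ.+-identityˡ _))
... | no  _   | yes x≡N = inj₁ (1ℤ + q , trans (cong₂ _+_ x≡N eq) (arith N q))
  where
  arith : ∀ N q → N + q * N ≡ (1ℤ + q) * N
  arith = solve-∀
... | no  ≢0  | no  ≢N  = inj₂ (zero , here , ≢0 , ≢N)

private
  no-multiple : ∀ {x} d N → 0ℤ < x → x < + N → x ≢ d * + N
  no-multiple {x} d N 0<x x<N refl with d
  ... | + zero       = ℤ.<-irrefl (sym (ℤ.*-zeroˡ (+ N))) 0<x
  ... | ℤ.+[1+ d ]   = ℤ.<⇒≱ x<N (ℤ.≤-trans (ℤ.≤-reflexive (sym (ℤ.*-identityˡ (+ N))))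
                         (ℤ.*-monoʳ-≤-nonNeg (+ N) {1ℤ} {ℤ.+[1+ d ]} (ℤ.+≤+ (ℕ.s≤s ℕ.z≤n))))
  ... | ℤ.-[1+ d ]   = ℤ.<⇒≱ 0<x (ℤ.≤-trans
                         (ℤ.*-monoʳ-≤-nonNeg (+ N) {ℤ.-[1+ d ]} {0ℤ} ℤ.-≤+)
                         (ℤ.≤-reflexive (ℤ.*-zeroˡ (+ N))))

-- x / N is a convex combination of bases with rational coefficients of common
-- denominator c N: here the coefficients are multiplicities in the list L.
record Combination {E : GroundSet} (M : Matroid E) (N : ℕ) (x : Vector ℤ (size E)) : Set where
  field
    denominator : ℕ
    positive    : 0 ℕ.< denominator
    bases       : List (Subset (size E))
    areBases    : All (Matroid.Basis M) bases
    number      : List.length bases ≡ denominator ℕ.* N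
    sums        : ∀ i → count bases i ≡ + denominator * x i

module _ {E : GroundSet} (M : Matroid E) (N : ℕ) .{{_ : ℕ.NonZero N}} where

  open Combination

  -- The point x divides the segment between the two moved points, so they enter with weights
  -- proportional to the opposite distances, `suc t` and `suc s`. The factors d and c bring the two
  -- combinations to a common denominator.
  mix : ∀ {x : Vector ℤ (size E)} s t i j → Combination M N (moved x (+ suc s) i j) →
        Combination M N (moved x (+ suc t) j i) → Combination M N x
  mix {x} s t i j p q = record
    { denominator = c ℕ.* d ℕ.* (suc s ℕ.+ suc t)
    ; positive    = ℕ.*-mono-< (ℕ.*-mono-< (positive p) (positive q)) (ℕ.s≤s ℕ.z≤n)
    ; bases       = copies a (bases p) List.++ copies b (bases q)
    ; areBases    = All.++⁺ (All-copies a (areBases p)) (All-copies b (areBases q))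
    ; number      = trans (List.length-++ (copies a (bases p)))
        (trans (cong₂ ℕ._+_ (trans (length-copies a (bases p)) (cong (a ℕ.*_) (number p)))
                            (trans (length-copies b (bases q)) (cong (b ℕ.*_) (number q))))
               (numbers c d (suc s) (suc t) N))
    ; sums        = λ e → trans (count-++ (copies a (bases p)) (copies b (bases q)) e)
        (trans (cong₂ _+_ (trans (count-copies a (bases p) e) (cong₂ _*_ (ℤ.pos-* d (suc t)) (sums p e)))
                          (trans (count-copies b (bases q) e) (cong₂ _*_ (ℤ.pos-* c (suc s)) (sums q e))))
          (trans (arith (+ c) (+ d) (+ suc s) (+ suc t) (x e) (χ ⁅ i ⁆ e) (χ ⁅ j ⁆ e))
            (cong (_* x e) (sym (trans (ℤ.pos-* (c ℕ.* d) (suc s ℕ.+ suc t))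
              (cong₂ _*_ (ℤ.pos-* c d) (ℤ.pos-+ (suc s) (suc t))))))))
    }
    where
    c = denominator p
    d = denominator q
    a = d ℕ.* suc t
    b = c ℕ.* suc s
    numbers : ∀ c d s t N → d ℕ.* t ℕ.* (c ℕ.* N) ℕ.+ c ℕ.* s ℕ.* (d ℕ.* N) ≡ c ℕ.* d ℕ.* (s ℕ.+ t) ℕ.* N
    numbers = ℕsolve-∀
    arith : ∀ c d s t x a b → d * t * (c * (x + s * (a - b))) + c * s * (d * (x + t * (b - a)))
                            ≡ c * d * (s + t) * x
    arith = solve-∀

  -- Such a point is N χ B. Divided by N, the equation at `⊤` and the inequality at B are the two
  -- conditions of `full-rank⇒basis`.
  integral⇒combination : ∀ {x} → Feasible M N x → (∀ i → x i ≡ 0ℤ ⊎ x i ≡ + N) → Combination M N x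
  integral⇒combination {x} (below , full) integral = record
    { denominator = 1
    ; positive    = ℕ.s≤s ℕ.z≤n
    ; bases       = copies N (B ∷ [])
    ; areBases    = All-copies N (isBasis ∷ [])
    ; number      = trans (length-copies N (B ∷ [])) (trans (ℕ.*-identityʳ N) (sym (ℕ.*-identityˡ N)))
    ; sums        = λ i → trans (count-copies N (B ∷ []) i)
        (trans (cong (+ N *_) (ℤ.+-identityʳ (χ B i))) (trans (sym (x≡NχB i)) (sym (ℤ.*-identityˡ (x i)))))
    }
    where
    B : Subset (size E)
    B = Vec.tabulate λ i → does (x i ℤ.≟ + N)
    x≡NχB : ∀ i → x i ≡ + N * χ B i
    x≡NχB i rewrite Vec.lookup∘tabulate (λ i → does (x i ℤ.≟ + N)) i with x i ℤ.≟ + N | integral i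
    ... | yes x≡N | _        = trans x≡N (sym (ℤ.*-identityʳ (+ N)))
    ... | no  x≢N | inj₁ x≡0 = trans x≡0 (sym (ℤ.*-zeroʳ (+ N)))
    ... | no  x≢N | inj₂ x≡N = contradiction x≡N x≢N
    total≡ : ∀ S → total x S ≡ + N * + ∣ B ∩ S ∣
    total≡ S = trans (total-cong x≡NχB S) (trans (total-* (+ N) (χ B) S) (cong (+ N *_) (total-χ B S)))
    instance
      N>0 : ℤ.Positive (+ N)
      N>0 = ℤ.positive (ℤ.+<+ (ℕ.>-nonZero⁻¹ N))
      N≠0 : ℤ.NonZero (+ N)
      N≠0 = ℤ.≢-nonZero λ eq → ℕ.≢-nonZero⁻¹ N (ℤ.+-injective eq)
    isBasis : Matroid.Basis M B
    isBasis = full-rank⇒basis M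
      (trans (cong ∣_∣ (sym (∩-identityʳ B)))
        (ℤ.+-injective (ℤ.*-cancelˡ-≡ (+ N) _ _ (trans (sym (total≡ ⊤)) full))))
      (subst (ℕ._≤ rank M B) (cong ∣_∣ (∩-idem B))
        (ℤ.drop‿+≤+ (ℤ.*-cancelˡ-≤-pos _ _ (+ N) (subst (_≤ bound M N B) (total≡ B) (below B)))))

  nontight : Vector ℤ (size E) → ℕ
  nontight x = List.length (List.filter (λ S → ¬? (total x S ℤ.≟ bound M N S)) (subsets (size E)))

  -- Two fractional coordinates in a smallest tight set having any: tight sets are
  -- closed under intersection.
  inseparable-pair : ∀ {x} → Feasible M N x → ∃[ i ] x i ≢ 0ℤ × x i ≢ + N →
    ∃[ i ] ∃[ j ] i ≢ j × 0ℤ < x i × 0ℤ < x j ×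
      (∀ S → Tight M N x S → (i ∈ S → j ∈ S) × (j ∈ S → i ∈ S))
  inseparable-pair {x} feas (i₀ , i₀-frac)
    with minimalBy ∣_∣ anySubset? (λ S → total x S ℤ.≟ bound M N S ×-dec
           any? (λ i → i ∈? S ×-dec ¬? (x i ℤ.≟ 0ℤ) ×-dec ¬? (x i ℤ.≟ + N)))
         (⊤ , proj₂ feas , i₀ , ∈⊤ , i₀-frac)
  ... | T , (tT , i , i∈T , i-frac) , smallest
    with multiple-or-fractional x (+ N) (T ∖ i)
  -- If i were the only fractional coordinate in T, then x i = N (rank T - q) would be a multiple of
  -- N strictly between 0 and N.
  ... | inj₁ (q , eq) = contradiction
          (trans (x≡ (total x (T ∖ i)) (x i)) (trans (cong₂ _-_ (trans (total-∖ x i∈T) tT) eq)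
            (arith (+ N) (+ rank M T) q)))
          (no-multiple (+ rank M T - q) N
            (ℤ.≤∧≢⇒< (coordinate≥0 M N feas i) (proj₁ i-frac ∘ sym))
            (ℤ.≤∧≢⇒< (coordinate≤N M N feas i) (proj₂ i-frac)))
    where
    x≡ : ∀ a b → b ≡ a + b - a
    x≡ = solve-∀
    arith : ∀ N r q → N * r - q * N ≡ (r - q) * N
    arith = solve-∀
  ... | inj₂ (j , j∈T∖i , j-frac) =
    i , j , i≢j
    , ℤ.≤∧≢⇒< (coordinate≥0 M N feas i) (proj₁ i-frac ∘ sym)
    , ℤ.≤∧≢⇒< (coordinate≥0 M N feas j) (proj₁ j-frac ∘ sym)
    , λ S tS → (λ i∈S → T⊆ S tS i∈S i∈T i-frac j∈T) , (λ j∈S → T⊆ S tS j∈S j∈T j-frac i∈T)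
    where
    j∈T = proj₁ (x∈p─q⁻ T ⁅ i ⁆ j∈T∖i)
    i≢j : i ≢ j
    i≢j i≡j = proj₂ (x∈p─q⁻ T ⁅ i ⁆ j∈T∖i) (subst (_∈ ⁅ i ⁆) i≡j (x∈⁅x⁆ i))
    T⊆ : ∀ S {k} → Tight M N x S → k ∈ S → k ∈ T → x k ≢ 0ℤ × x k ≢ + N → T ⊆ S
    T⊆ S {k} tS k∈S k∈T k-frac = ∩-minimal⇒⊆ S T (smallest (S ∩ T)
      (tight-∩ M N (proj₁ feas) {S} {T} tS tT , k , x∈p∩q⁺ (k∈S , k∈T) , k-frac))

  -- Edmonds' theorem. A point with fractional coordinates lies between two feasible
  -- points with more tight sets.
  feasible⇒combination : ∀ {x} → Feasible M N x → Combination M N x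
  feasible⇒combination {x} feas = go feas (<-wellFounded (nontight x))
    where
    go : ∀ {x} → Feasible M N x → Acc ℕ._<_ (nontight x) → Combination M N x
    go {x} feas (acc rs) with any? (λ i → ¬? (x i ℤ.≟ 0ℤ) ×-dec ¬? (x i ℤ.≟ + N))
    ... | no ¬fractional = integral⇒combination feas integral
      where
      integral : ∀ i → x i ≡ 0ℤ ⊎ x i ≡ + N
      integral i with x i ℤ.≟ 0ℤ | x i ℤ.≟ + N
      ... | yes x≡0 | _       = inj₁ x≡0
      ... | no  _   | yes x≡N = inj₂ x≡N
      ... | no  x≢0 | no  x≢N = contradiction (i , x≢0 , x≢N) ¬fractional
    ... | yes fractional with inseparable-pair feas fractional
    ... | i , j , i≢j , i>0 , j>0 , i∼j
      with push M N feas i∼j i≢j j>0 | push M N feas (λ S tS → Product.swap (i∼j S tS)) (i≢j ∘ sym) i>0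
    ... | s , feasₛ , newₛ | t , feasₜ , newₜ = mix s t i j
        (go feasₛ (rs (decreased i∼j i≢j j>0 s newₛ)))
        (go feasₜ (rs (decreased (λ S tS → Product.swap (i∼j S tS)) (i≢j ∘ sym) i>0 t newₜ)))
      where
      decreased : ∀ {i j} (i∼j : ∀ S → Tight M N x S → (i ∈ S → j ∈ S) × (j ∈ S → i ∈ S))
        (i≢j : i ≢ j) (0<xj : 0ℤ < x j) t → (∃[ S ] Tight M N (moved x (+ suc t) i j) S × ¬ Tight M N x S) →
        nontight (moved x (+ suc t) i j) ℕ.< nontight x
      decreased i∼j i≢j 0<xj t (S , tS , ¬tS) = length-filter-strict _ _
        (λ {S} ¬t t′ → ¬t (tight-moved M N feas i∼j i≢j 0<xj (+ suc t) {S} t′))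
        (∈-subsets S) ¬tS (λ ¬t → ¬t tS)

-- Real points of the base polytope

private module ℚSum = SemiringSum (CommutativeRing.semiring ℚ.+-*-commutativeRing)

opaque
  -- Defined through unnormalised fractions, whose equality and order are cross-multiplication, so
  -- that its laws become statements about integers.
  ι : ℤ → ℚ
  ι z = ℚ.fromℚᵘ (ℚᵘ.mkℚᵘ z 0)

  ι-0 : ι 0ℤ ≡ 0ℚ
  ι-0 = refl

  ι-1 : ι 1ℤ ≡ 1ℚ
  ι-1 = refl

  toℚᵘ-ι : ∀ z → ℚ.toℚᵘ (ι z) ℚᵘ.≃ ℚᵘ.mkℚᵘ z 0
  toℚᵘ-ι z = ℚ.toℚᵘ-fromℚᵘ (ℚᵘ.mkℚᵘ z 0)

  ι-+ : ∀ a b → ι (a + b) ≡ ι a ℚ.+ ι b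
  ι-+ a b = ℚ.toℚᵘ-injective (ℚᵘ.≃-trans (toℚᵘ-ι (a + b)) (ℚᵘ.≃-trans (ℚᵘ.*≡* (arith a b))
    (ℚᵘ.≃-sym (ℚᵘ.≃-trans (ℚ.toℚᵘ-homo-+ (ι a) (ι b)) (ℚᵘ.+-cong (toℚᵘ-ι a) (toℚᵘ-ι b))))))
    where
    arith : ∀ a b → (a + b) * 1ℤ ≡ (a * 1ℤ + b * 1ℤ) * 1ℤ
    arith = solve-∀

  ι-* : ∀ a b → ι (a * b) ≡ ι a ℚ.* ι b
  ι-* a b = ℚ.toℚᵘ-injective (ℚᵘ.≃-trans (toℚᵘ-ι (a * b)) (ℚᵘ.≃-trans (ℚᵘ.*≡* refl)
    (ℚᵘ.≃-sym (ℚᵘ.≃-trans (ℚ.toℚᵘ-homo-* (ι a) (ι b)) (ℚᵘ.*-cong (toℚᵘ-ι a) (toℚᵘ-ι b))))))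

  ι-mono-≤ : ∀ {a b} → a ≤ b → ι a ℚ.≤ ι b
  ι-mono-≤ {a} {b} a≤b = ℚ.toℚᵘ-cancel-≤ (ℚᵘ.≤-respˡ-≃ (ℚᵘ.≃-sym (toℚᵘ-ι a))
    (ℚᵘ.≤-respʳ-≃ (ℚᵘ.≃-sym (toℚᵘ-ι b)) (ℚᵘ.*≤* (ℤ.*-monoʳ-≤-nonNeg 1ℤ a≤b))))

  ι-cancel-≤ : ∀ {a b} → ι a ℚ.≤ ι b → a ≤ b
  ι-cancel-≤ {a} {b} le = ℤ.*-cancelʳ-≤-pos a b 1ℤ (ℚᵘ.drop-*≤* (ℚᵘ.≤-respˡ-≃ (toℚᵘ-ι a)
    (ℚᵘ.≤-respʳ-≃ (toℚᵘ-ι b) (ℚ.toℚᵘ-mono-≤ le))))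

  recip : (N : ℕ) .{{_ : ℕ.NonZero N}} → ℚ
  recip (suc k) = ℚ.fromℚᵘ (ℚᵘ.mkℚᵘ 1ℤ k)

  recip-inverse : ∀ N .{{_ : ℕ.NonZero N}} → ι (+ N) ℚ.* recip N ≡ 1ℚ
  recip-inverse (suc k) = ℚ.toℚᵘ-injective (ℚᵘ.≃-trans (ℚ.toℚᵘ-homo-* (ι (+ suc k)) (recip (suc k)))
    (ℚᵘ.≃-trans (ℚᵘ.*-cong (toℚᵘ-ι (+ suc k)) (ℚ.toℚᵘ-fromℚᵘ (ℚᵘ.mkℚᵘ 1ℤ k)))
      (ℚᵘ.*≡* (arith (+ suc k)))))
    where
    arith : ∀ a → a * 1ℤ * 1ℤ ≡ 1ℤ * (1ℤ * a)
    arith = solve-∀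

  recip-nonNeg : ∀ N .{{_ : ℕ.NonZero N}} → 0ℚ ℚ.≤ recip N
  recip-nonNeg (suc k) = ℚ.toℚᵘ-cancel-≤ (ℚᵘ.≤-respʳ-≃ (ℚᵘ.≃-sym (ℚ.toℚᵘ-fromℚᵘ (ℚᵘ.mkℚᵘ 1ℤ k)))
    (ℚᵘ.*≤* (ℤ.+≤+ ℕ.z≤n)))

0*≡ι0* : ∀ q → 0ℚ ≡ ι 0ℤ ℚ.* q
0*≡ι0* q = sym (trans (cong (ℚ._* q) ι-0) (ℚ.*-zeroˡ q))

ι[1+] : ∀ z → ι (1ℤ + z) ≡ 1ℚ ℚ.+ ι z
ι[1+] z = trans (ι-+ 1ℤ z) (cong (ℚ._+ ι z) ι-1)

sumℚ : Vector ℚ n → ℚ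
sumℚ = ℚSum.sum

seq-sumᴿ : ∀ (f : Vector ℝ n) k → seq (sumᴿ f) k ≡ sumℚ (λ j → seq (f j) k)
seq-sumᴿ {n = zero}  f k = refl
seq-sumᴿ {n = suc n} f k = cong (seq (f zero) k ℚ.+_) (seq-sumᴿ (f ∘ suc) k)

seq≡⇒≈ : ∀ (x y : ℝ) → (∀ k → seq x k ≡ seq y k) → x ≈ᴿ y
seq≡⇒≈ x y eq ε 0<ε = 0 , λ k _ → subst (ℚ._≤ ε)
  (sym (cong ℚ.∣_∣ (trans (cong (ℚ._- seq y k) (eq k)) (ℚ.+-inverseʳ (seq y k))))) (ℚ.<⇒≤ 0<ε)

seq-vertex : ∀ (B : Subset n) i k → seq (vertex B i) k ≡ ι (χ B i)
seq-vertex B i k with χ-cases B i | i ∈? B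
... | inj₁ (_ , p)   | yes _   = trans (sym ι-1) (cong ι (sym p))
... | inj₂ (_ , p)   | no _    = trans (sym ι-0) (cong ι (sym p))
... | inj₁ (i∈B , _) | no i∉B  = contradiction i∈B i∉B
... | inj₂ (i∉B , _) | yes i∈B = contradiction i∈B i∉B

point : (N : ℕ) .{{_ : ℕ.NonZero N}} → Vector ℤ n → Vector ℝ n
point N x i = fromℚ (ι (x i) ℚ.* recip N)

module _ {E : GroundSet} (M : Matroid E) (N : ℕ) .{{_ : ℕ.NonZero N}} where

  -- Repetitions in the list of bases are kept as separate vertices, so all coefficients equal
  -- 1/(cN).
  combination⇒∈BasePolytope : ∀ {x} → Combination M N x → BasePolytope M (point N x)
  combination⇒∈BasePolytope {x} comb =
    List.length bases , (λ _ → fromℚ t) , (λ j → vertex (List.lookup bases j))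
    , (λ j → List.lookup bases j , All.lookup areBases (∈-lookup j) , refl)
    , (λ _ ε 0<ε → 0 , λ _ _ → ℚ.≤-trans 0≤t (subst (ℚ._≤ t ℚ.+ ε) (ℚ.+-identityʳ t) (ℚ.+-monoʳ-≤ t (ℚ.<⇒≤ 0<ε))))
    , seq≡⇒≈ (sumᴿ {List.length bases} (λ _ → fromℚ t)) 1ᴿ
        (λ k → trans (seq-sumᴿ {List.length bases} (λ _ → fromℚ t) k)
            (trans (constant (List.length bases)) total-weight))
    , λ i → seq≡⇒≈ (point N x i) (sumᴿ (λ j → fromℚ t *ᴿ vertex (List.lookup bases j) i)) λ k →
        sym (trans (seq-sumᴿ (λ j → fromℚ t *ᴿ vertex (List.lookup bases j) i) k)
        (trans (weighted bases i k) (coordinate i)))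
    where
    open Combination comb
    c = denominator
    instance
      c≠0 : ℕ.NonZero c
      c≠0 = ℕ.>-nonZero positive
    t = recip c ℚ.* recip N
    0≤t : 0ℚ ℚ.≤ t
    0≤t = subst (ℚ._≤ t) (ℚ.*-zeroʳ (recip c))
      (ℚ.*-monoˡ-≤-nonNeg (recip c) {{ℚ.nonNegative (recip-nonNeg c)}} (recip-nonNeg N))
    constant : ∀ k → sumℚ {k} (λ _ → t) ≡ ι (+ k) ℚ.* t
    constant zero    = 0*≡ι0* t
    constant (suc k) = trans (cong₂ ℚ._+_ (sym (ℚ.*-identityˡ t)) (constant k))
      (trans (sym (ℚ.*-distribʳ-+ t 1ℚ (ι (+ k)))) (cong (ℚ._* t) (sym (ι[1+] (+ k)))))
    regroup : ∀ a b c d → a ℚ.* b ℚ.* (c ℚ.* d) ≡ (a ℚ.* c) ℚ.* (b ℚ.* d)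
    regroup = solve 4 (λ a b c d → a :* b :* (c :* d) := (a :* c) :* (b :* d)) refl
      where open +-*-Solver
    total-weight : ι (+ List.length bases) ℚ.* t ≡ 1ℚ
    total-weight = begin
      ι (+ List.length bases) ℚ.* t        ≡⟨ cong (λ l → ι l ℚ.* t) (trans (cong +_ number) (ℤ.pos-* c N)) ⟩
      ι (+ c * + N) ℚ.* t                  ≡⟨ cong (ℚ._* t) (ι-* (+ c) (+ N)) ⟩
      ι (+ c) ℚ.* ι (+ N) ℚ.* t            ≡⟨ regroup (ι (+ c)) (ι (+ N)) (recip c) (recip N) ⟩
      (ι (+ c) ℚ.* recip c) ℚ.* (ι (+ N) ℚ.* recip N)
                                           ≡⟨ cong₂ ℚ._*_ (recip-inverse c) (recip-inverse N) ⟩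
      1ℚ ℚ.* 1ℚ                            ≡⟨ ℚ.*-identityˡ 1ℚ ⟩
      1ℚ                                   ∎
      where open ≡-Reasoning
    weighted : ∀ L i k → sumℚ (λ j → t ℚ.* seq (vertex (List.lookup L j) i) k) ≡ ι (count L i) ℚ.* t
    weighted []      i k = 0*≡ι0* t
    weighted (B ∷ L) i k = trans
      (cong₂ ℚ._+_ (trans (cong (t ℚ.*_) (seq-vertex B i k)) (ℚ.*-comm t _)) (weighted L i k))
      (trans (sym (ℚ.*-distribʳ-+ t (ι (χ B i)) (ι (count L i))))
        (cong (ℚ._* t) (sym (ι-+ (χ B i) (count L i)))))
    coordinate : ∀ i → ι (count bases i) ℚ.* t ≡ ι (x i) ℚ.* recip N
    coordinate i = begin
      ι (count bases i) ℚ.* t                           ≡⟨ cong (λ l → ι l ℚ.* t) (sums i) ⟩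
      ι (+ c * x i) ℚ.* t                               ≡⟨ cong (ℚ._* t) (ι-* (+ c) (x i)) ⟩
      ι (+ c) ℚ.* ι (x i) ℚ.* t                         ≡⟨ regroup (ι (+ c)) (ι (x i)) (recip c) (recip N) ⟩
      (ι (+ c) ℚ.* recip c) ℚ.* (ι (x i) ℚ.* recip N)   ≡⟨ cong (ℚ._* (ι (x i) ℚ.* recip N)) (recip-inverse c) ⟩
      1ℚ ℚ.* (ι (x i) ℚ.* recip N)                      ≡⟨ ℚ.*-identityˡ _ ⟩
      ι (x i) ℚ.* recip N                               ∎
      where open ≡-Reasoning

-- Inequalities of rational sequences up to arbitrarily small errors

infix 4 _≲_

-- The order `_≤ᴿ_` freed from the Cauchy condition: intermediate sums and products can be
-- rearranged in ℚ without being real numbers themselves.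
record _≲_ (a b : ℕ → ℚ) : Set where
  constructor eventually
  field
    within : ∀ ε → 0ℚ ℚ.< ε → ∃[ N ] ∀ k → N ℕ.≤ k → a k ℚ.≤ b k ℚ.+ ε

open _≲_ using (within)

private
  half : ∀ {ε} → 0ℚ ℚ.< ε → 0ℚ ℚ.< ½ ℚ.* ε
  half {ε} 0<ε = subst (ℚ._< ½ ℚ.* ε) (ℚ.*-zeroʳ ½) (ℚ.*-monoʳ-<-pos ½ 0<ε)

  halves : ∀ ε → ½ ℚ.* ε ℚ.+ ½ ℚ.* ε ≡ ε
  halves ε = trans (sym (ℚ.*-distribʳ-+ ε ½ ½)) (ℚ.*-identityˡ ε)

≲-refl : ∀ {a b} → (∀ k → a k ≡ b k) → a ≲ b
≲-refl {a} {b} eq = eventually λ ε 0<ε → 0 , λ k _ → subst₂ ℚ._≤_ (ℚ.+-identityʳ (a k)) (cong (ℚ._+ ε) (eq k))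
  (ℚ.+-monoʳ-≤ (a k) (ℚ.<⇒≤ 0<ε))

≲-trans : ∀ {a b c} → a ≲ b → b ≲ c → a ≲ c
≲-trans {a} {b} {c} a≲b b≲c = eventually λ ε 0<ε →
  let N₁ , h₁ = within a≲b (½ ℚ.* ε) (half 0<ε)
      N₂ , h₂ = within b≲c (½ ℚ.* ε) (half 0<ε)
  in N₁ ℕ.⊔ N₂ , λ k N≤k → ℚ.≤-trans (h₁ k (ℕ.m⊔n≤o⇒m≤o N₁ N₂ N≤k))
    (ℚ.≤-trans (ℚ.+-monoˡ-≤ (½ ℚ.* ε) (h₂ k (ℕ.m⊔n≤o⇒n≤o N₁ N₂ N≤k)))
      (ℚ.≤-reflexive (trans (ℚ.+-assoc (c k) _ _) (cong (c k ℚ.+_) (halves ε)))))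

≲-+ : ∀ {a b c d} → a ≲ b → c ≲ d → (λ k → a k ℚ.+ c k) ≲ (λ k → b k ℚ.+ d k)
≲-+ {a} {b} {c} {d} a≲b c≲d = eventually λ ε 0<ε →
  let N₁ , h₁ = within a≲b (½ ℚ.* ε) (half 0<ε)
      N₂ , h₂ = within c≲d (½ ℚ.* ε) (half 0<ε)
  in N₁ ℕ.⊔ N₂ , λ k N≤k → ℚ.≤-trans
    (ℚ.+-mono-≤ (h₁ k (ℕ.m⊔n≤o⇒m≤o N₁ N₂ N≤k)) (h₂ k (ℕ.m⊔n≤o⇒n≤o N₁ N₂ N≤k)))
    (ℚ.≤-reflexive (trans (arith (b k) (d k) (½ ℚ.* ε)) (cong (b k ℚ.+ d k ℚ.+_) (halves ε))))
  where
  arith : ∀ b d e → (b ℚ.+ e) ℚ.+ (d ℚ.+ e) ≡ (b ℚ.+ d) ℚ.+ (e ℚ.+ e)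
  arith = solve 3 (λ b d e → (b :+ e) :+ (d :+ e) := (b :+ d) :+ (e :+ e)) refl
    where open +-*-Solver

≲-sum : ∀ {f g : Fin n → ℕ → ℚ} → (∀ j → f j ≲ g j) →
        (λ k → sumℚ (λ j → f j k)) ≲ (λ k → sumℚ (λ j → g j k))
≲-sum {n = zero}  f≲g = ≲-refl {λ _ → 0ℚ} λ _ → refl
≲-sum {n = suc n} {f} {g} f≲g = ≲-+ {f zero} {g zero} (f≲g zero) (≲-sum (f≲g ∘ suc))

-- Repeated addition suffices: the factors that occur are natural numbers, namely sizes, ranks,
-- their differences and values of `χ`.
≲-* : ∀ r {a b} → a ≲ b → (λ k → ι (+ r) ℚ.* a k) ≲ (λ k → ι (+ r) ℚ.* b k)
≲-* zero    {a} {b} a≲b = ≲-refl λ k → trans (sym (0*≡ι0* (a k))) (0*≡ι0* (b k))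
≲-* (suc r) {a} {b} a≲b = ≲-trans (≲-refl (expand a))
  (≲-trans (≲-+ a≲b (≲-* r a≲b)) (≲-refl (sym ∘ expand b)))
  where
  expand : ∀ (a : ℕ → ℚ) k → ι (+ suc r) ℚ.* a k ≡ a k ℚ.+ ι (+ r) ℚ.* a k
  expand a k = trans (cong (ℚ._* a k) (ι[1+] (+ r)))
    (trans (ℚ.*-distribʳ-+ (a k) 1ℚ (ι (+ r))) (cong (ℚ._+ ι (+ r) ℚ.* a k) (ℚ.*-identityˡ (a k))))

≲-const : ∀ {p q} → (λ _ → p) ≲ (λ _ → q) → p ℚ.≤ q
≲-const {p} {q} p≲q = ℚ.≮⇒≥ λ q<p →
  let d , q<d , d<p = ℚ.<-dense q<p
      N , h = within p≲q (d ℚ.- q) (subst (ℚ._< d ℚ.- q) (ℚ.+-inverseʳ q) (ℚ.+-monoˡ-< (ℚ.- q) q<d))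
  in ℚ.<-irrefl refl (ℚ.<-≤-trans d<p (ℚ.≤-trans (h N ℕ.≤-refl) (ℚ.≤-reflexive (arith q d))))
  where
  arith : ∀ q d → q ℚ.+ (d ℚ.- q) ≡ d
  arith = solve 2 (λ q d → q :+ (d :- q) := d) refl
    where open +-*-Solver

private
  ≤∣∣ : ∀ p → p ℚ.≤ ℚ.∣ p ∣
  ≤∣∣ p with ℚ.≤-total 0ℚ p
  ... | inj₁ 0≤p = ℚ.≤-reflexive (sym (ℚ.0≤p⇒∣p∣≡p 0≤p))
  ... | inj₂ p≤0 = ℚ.≤-trans p≤0 (ℚ.0≤∣p∣ p)

  a-b≤c : ∀ {a b c} → a ℚ.- b ℚ.≤ c → a ℚ.≤ b ℚ.+ c
  a-b≤c {a} {b} {c} le = subst (ℚ._≤ b ℚ.+ c) (arith a b) (ℚ.+-monoʳ-≤ b le)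
    where
    arith : ∀ a b → b ℚ.+ (a ℚ.- b) ≡ a
    arith = solve 2 (λ a b → b :+ (a :- b) := a) refl
      where open +-*-Solver

≈⇒≲ : ∀ {x y} → x ≈ᴿ y → seq x ≲ seq y
≈⇒≲ {x} {y} x≈y = eventually λ ε 0<ε → let N , h = x≈y ε 0<ε in
  N , λ k N≤k → a-b≤c (ℚ.≤-trans (≤∣∣ (seq x k ℚ.- seq y k)) (h k N≤k))

≈⇒≳ : ∀ {x y} → x ≈ᴿ y → seq y ≲ seq x
≈⇒≳ {x} {y} x≈y = eventually λ ε 0<ε → let N , h = x≈y ε 0<ε in
  N , λ k N≤k → a-b≤c (ℚ.≤-trans (≤∣∣ (seq y k ℚ.- seq x k))
    (subst (ℚ._≤ ε) (trans (sym (ℚ.∣-p∣≡∣p∣ (seq x k ℚ.- seq y k))) (cong ℚ.∣_∣ (arith (seq x k) (seq y k))))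
      (h k N≤k)))
  where
  arith : ∀ a b → ℚ.- (a ℚ.- b) ≡ b ℚ.- a
  arith = solve 2 (λ a b → :- (a :- b) := b :- a) refl
    where open +-*-Solver

sum-ι : ∀ (x : Vector ℤ n) S q → sumℚ (λ i → ι (χ S i) ℚ.* (ι (x i) ℚ.* q)) ≡ ι (total x S) ℚ.* q
sum-ι x []            q = 0*≡ι0* q
sum-ι x (inside ∷ S)  q = trans
    (cong₂ ℚ._+_ (trans (cong (ℚ._* (ι (x zero) ℚ.* q)) ι-1) (ℚ.*-identityˡ (ι (x zero) ℚ.* q)))
        (sum-ι (x ∘ suc) S q))
  (trans (sym (ℚ.*-distribʳ-+ q (ι (x zero)) _)) (cong (ℚ._* q) (sym (ι-+ (x zero) (total (x ∘ suc) S)))))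
sum-ι x (outside ∷ S) q = trans (cong₂ ℚ._+_ (sym (0*≡ι0* (ι (x zero) ℚ.* q))) (sum-ι (x ∘ suc) S q)) (ℚ.+-identityˡ _)

χ-ℕ : ∀ (S : Subset n) i → ∃[ r ] χ S i ≡ + r
χ-ℕ S i with χ-cases S i
... | inj₁ (_ , p) = 1 , p
... | inj₂ (_ , p) = 0 , p

scale-χ : ∀ (S : Subset n) i {a b} → a ≲ b → (λ m → ι (χ S i) ℚ.* a m) ≲ (λ m → ι (χ S i) ℚ.* b m)
scale-χ S i {a} {b} a≲b with χ-ℕ S i
... | r , eq = subst (λ c → (λ m → ι c ℚ.* a m) ≲ (λ m → ι c ℚ.* b m)) (sym eq) (≲-* r a≲b)

module _ {s} (B : Fin s → Subset n) (τ : Fin s → ℕ → ℚ) where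
  private
    combine : Fin n → ℕ → ℚ
    combine i m = sumℚ (λ j → τ j m ℚ.* ι (χ (B j) i))

    weighted : (Fin s → ℕ) → ℕ → ℚ
    weighted r m = sumℚ (λ j → ι (+ r j) ℚ.* τ j m)

  -- Interchanging the sums replaces coordinates by the numbers ∣ B j ∩ S ∣, to which rank bounds
  -- apply.
  combine-total : ∀ S m → sumℚ (λ i → ι (χ S i) ℚ.* combine i m) ≡ weighted (λ j → ∣ B j ∩ S ∣) m
  combine-total S m = begin
    sumℚ (λ i → ι (χ S i) ℚ.* combine i m)
      ≡⟨ ℚSum.sum-cong-≗ (λ i → ℚSum.*-distribˡ-sum (ι (χ S i)) (λ j → τ j m ℚ.* ι (χ (B j) i))) ⟩
    sumℚ (λ i → sumℚ (λ j → ι (χ S i) ℚ.* (τ j m ℚ.* ι (χ (B j) i))))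
      ≡⟨ ℚSum.∑-comm (λ i j → ι (χ S i) ℚ.* (τ j m ℚ.* ι (χ (B j) i))) ⟩
    sumℚ (λ j → sumℚ (λ i → ι (χ S i) ℚ.* (τ j m ℚ.* ι (χ (B j) i))))
      ≡⟨ ℚSum.sum-cong-≗ (λ j → trans
           (ℚSum.sum-cong-≗ (λ i → cong (ι (χ S i) ℚ.*_) (ℚ.*-comm (τ j m) (ι (χ (B j) i)))))
           (trans (sum-ι (χ (B j)) S (τ j m)) (cong (λ z → ι z ℚ.* τ j m) (total-χ (B j) S)))) ⟩
    weighted (λ j → ∣ B j ∩ S ∣) m ∎
    where open ≡-Reasoning

  module _ (p : Fin n → ℚ)
           (τ≥0 : ∀ j → (λ _ → 0ℚ) ≲ τ j)
           (Στ≲1 : (λ m → sumℚ (λ j → τ j m)) ≲ (λ _ → 1ℚ))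
           (1≲Στ : (λ _ → 1ℚ) ≲ (λ m → sumℚ (λ j → τ j m)))
           (p≲ : ∀ i → (λ _ → p i) ≲ combine i) (≲p : ∀ i → combine i ≲ (λ _ → p i)) where
    private
      weighted-const : ∀ r m → ι (+ r) ℚ.* sumℚ (λ j → τ j m) ≡ weighted (λ _ → r) m
      weighted-const r m = ℚSum.*-distribˡ-sum (ι (+ r)) (λ j → τ j m)

      weighted-≲ : ∀ r → weighted (λ _ → r) ≲ (λ _ → ι (+ r))
      weighted-≲ r = ≲-trans (≲-refl {b = λ m → ι (+ r) ℚ.* sumℚ (λ j → τ j m)} λ m → sym (weighted-const r m))
        (≲-trans (≲-* r Στ≲1) (≲-refl λ _ → ℚ.*-identityʳ (ι (+ r))))

      ≲-weighted : ∀ r → (λ _ → ι (+ r)) ≲ weighted (λ _ → r)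
      ≲-weighted r = ≲-trans (≲-refl {b = λ _ → ι (+ r) ℚ.* 1ℚ} λ _ → sym (ℚ.*-identityʳ (ι (+ r))))
        (≲-trans (≲-* r 1≲Στ) (≲-refl (weighted-const r)))

      -- Individual terms of τ j may be negative, since it is nonnegative only up to ε. So (b - a) τ
      -- j is added as an asymptotic inequality in place of a termwise comparison.
      τ-mono : ∀ j {a b} → a ℕ.≤ b → (λ m → ι (+ a) ℚ.* τ j m) ≲ (λ m → ι (+ b) ℚ.* τ j m)
      τ-mono j {a} {b} a≤b = ≲-trans
        (≲-refl {b = λ m → ι (+ a) ℚ.* τ j m ℚ.+ ι (+ d) ℚ.* 0ℚ} λ m → sym (trans
          (cong (ι (+ a) ℚ.* τ j m ℚ.+_) (ℚ.*-zeroʳ (ι (+ d)))) (ℚ.+-identityʳ _)))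
        (≲-trans (≲-+ (≲-refl {a = λ m → ι (+ a) ℚ.* τ j m} λ m → refl) (≲-* d (τ≥0 j)))
          (≲-refl λ m → trans (sym (ℚ.*-distribʳ-+ (τ j m) (ι (+ a)) (ι (+ d))))
            (cong (ℚ._* τ j m) (trans (sym (ι-+ (+ a) (+ d))) (cong (ι ∘ +_) (ℕ.m+[n∸m]≡n a≤b))))))
        where d = b ℕ.∸ a

    total≲ : ∀ S {r} → (∀ j → ∣ B j ∩ S ∣ ℕ.≤ r) → (λ _ → sumℚ (λ i → ι (χ S i) ℚ.* p i)) ≲ (λ _ → ι (+ r))
    total≲ S {r} B≤r =
      ≲-trans (≲-sum {f = λ i _ → ι (χ S i) ℚ.* p i} {g = λ i m → ι (χ S i) ℚ.* combine i m} λ i → scale-χ S i (p≲ i))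
      (≲-trans (≲-refl (combine-total S))
      (≲-trans (≲-sum {f = λ j m → ι (+ ∣ B j ∩ S ∣) ℚ.* τ j m} {g = λ j m → ι (+ r) ℚ.* τ j m} λ j → τ-mono j (B≤r j))
        (weighted-≲ r)))

    ≲total : ∀ S {r} → (∀ j → r ≡ ∣ B j ∩ S ∣) → (λ _ → ι (+ r)) ≲ (λ _ → sumℚ (λ i → ι (χ S i) ℚ.* p i))
    ≲total S {r} r≡B =
      ≲-trans (≲-weighted r)
      (≲-trans (≲-refl {b = weighted (λ j → ∣ B j ∩ S ∣)} λ m → ℚSum.sum-cong-≗ λ j → cong (λ r → ι (+ r) ℚ.* τ j m) (r≡B j))
      (≲-trans (≲-refl {b = λ m → sumℚ (λ i → ι (χ S i) ℚ.* combine i m)} λ m → sym (combine-total S m))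
        (≲-sum {f = λ i m → ι (χ S i) ℚ.* combine i m} {g = λ i _ → ι (χ S i) ℚ.* p i} λ i → scale-χ S i (≲p i))))

module _ {E : GroundSet} (M : Matroid E) (N : ℕ) .{{_ : ℕ.NonZero N}} where
  private
    q = recip N

    N-nonNeg : ℚ.NonNegative (ι (+ N))
    N-nonNeg = ℚ.nonNegative (subst (ℚ._≤ ι (+ N)) ι-0 (ι-mono-≤ (ℤ.+≤+ ℕ.z≤n)))

    clear : ∀ z → ι (+ N) ℚ.* (ι z ℚ.* q) ≡ ι z
    clear z = trans (arith (ι (+ N)) (ι z) q) (trans (cong (ι z ℚ.*_) (recip-inverse N)) (ℚ.*-identityʳ (ι z)))
      where
      arith : ∀ a b c → a ℚ.* (b ℚ.* c) ≡ b ℚ.* (a ℚ.* c)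
      arith = solve 3 (λ a b c → a :* (b :* c) := b :* (a :* c)) refl
        where open +-*-Solver

  clear-≤ : ∀ {z r} → ι z ℚ.* q ℚ.≤ ι (+ r) → z ≤ + N * + r
  clear-≤ {z} {r} le = ι-cancel-≤ (subst₂ ℚ._≤_ (clear z) (sym (ι-* (+ N) (+ r)))
    (ℚ.*-monoˡ-≤-nonNeg (ι (+ N)) {{N-nonNeg}} le))

  clear-≥ : ∀ {z r} → ι (+ r) ℚ.≤ ι z ℚ.* q → + N * + r ≤ z
  clear-≥ {z} {r} le = ι-cancel-≤ (subst₂ ℚ._≤_ (sym (ι-* (+ N) (+ r))) (clear z)
    (ℚ.*-monoˡ-≤-nonNeg (ι (+ N)) {{N-nonNeg}} le))

  -- The easy half of Edmonds' theorem: the inequalities hold at the vertices, with equality for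
  -- `⊤`, and pass to convex combinations. Both sides are then constant sequences, so the errors ε
  -- disappear.
  ∈BasePolytope⇒feasible : ∀ {x} → BasePolytope M (point N x) → Feasible M N x
  ∈BasePolytope⇒feasible {x} (s , t , v , v∈ , t≥0 , Σt≈1 , x≈) =
    (λ S → clear-≤ (subst (ℚ._≤ ι (+ rank M S)) (sum-ι x S q)
      (≲-const (total≲ B τ p τ≥0 Στ≲1 1≲Στ p≲ ≲p S λ j → ∣B∩S∣≤rank M (isBasis j) S))))
    , ℤ.≤-antisym
      (clear-≤ (subst (ℚ._≤ ι (+ rank M ⊤)) (sum-ι x ⊤ q)
        (≲-const (total≲ B τ p τ≥0 Στ≲1 1≲Στ p≲ ≲p ⊤ λ j → ∣B∩S∣≤rank M (isBasis j) ⊤))))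
      (clear-≥ (subst (ι (+ rank M ⊤) ℚ.≤_) (sum-ι x ⊤ q)
        (≲-const (≲total B τ p τ≥0 Στ≲1 1≲Στ p≲ ≲p ⊤ λ j →
          sym (trans (cong ∣_∣ (∩-identityʳ (B j))) (basis⇒∣B∣≡rank M (isBasis j)))))))
    where
    B : Fin s → Subset (size E)
    B j = proj₁ (v∈ j)
    isBasis : ∀ j → Matroid.Basis M (B j)
    isBasis j = proj₁ (proj₂ (v∈ j))
    τ : Fin s → ℕ → ℚ
    τ j m = seq (t j) m
    p : Fin (size E) → ℚ
    p i = ι (x i) ℚ.* q
    τ≥0 : ∀ j → (λ _ → 0ℚ) ≲ τ j
    τ≥0 j = eventually (t≥0 j)
    Στ≲1 : (λ m → sumℚ (λ j → τ j m)) ≲ (λ _ → 1ℚ)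
    Στ≲1 = ≲-trans (≲-refl λ m → sym (seq-sumᴿ t m)) (≈⇒≲ {sumᴿ t} {1ᴿ} Σt≈1)
    1≲Στ : (λ _ → 1ℚ) ≲ (λ m → sumℚ (λ j → τ j m))
    1≲Στ = ≲-trans (≈⇒≳ {sumᴿ t} {1ᴿ} Σt≈1) (≲-refl (seq-sumᴿ t))
    coordinate : ∀ i m → seq (sumᴿ (λ j → t j *ᴿ v j i)) m ≡ sumℚ (λ j → τ j m ℚ.* ι (χ (B j) i))
    coordinate i m = trans (seq-sumᴿ (λ j → t j *ᴿ v j i) m) (ℚSum.sum-cong-≗ λ j →
      cong (τ j m ℚ.*_) (trans (cong (λ w → seq (w i) m) (proj₂ (proj₂ (v∈ j)))) (seq-vertex (B j) i m)))
    p≲ : ∀ i → (λ _ → p i) ≲ (λ m → sumℚ (λ j → τ j m ℚ.* ι (χ (B j) i)))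
    p≲ i = ≲-trans (≈⇒≲ {point N x i} {sumᴿ (λ j → t j *ᴿ v j i)} (x≈ i)) (≲-refl (coordinate i))
    ≲p : ∀ i → (λ m → sumℚ (λ j → τ j m ℚ.* ι (χ (B j) i))) ≲ (λ _ → p i)
    ≲p i = ≲-trans (≲-refl λ m → sym (coordinate i m)) (≈⇒≳ {point N x i} {sumᴿ (λ j → t j *ᴿ v j i)} (x≈ i))

  basePolytope? : ∀ x → Dec (BasePolytope M (point N x))
  basePolytope? x = map′ (λ feas → combination⇒∈BasePolytope M N (feasible⇒combination M N feas))
    ∈BasePolytope⇒feasible (feasible? M N x)

-- Perturbations of the indicator vector of a basis

-- The sum of (-1)^∣G∣ φ G over all G; the recursion keeps the signs implicit.
altsum : (Subset m → ℤ) → ℤ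
altsum {zero}  φ = φ []
altsum {suc m} φ = altsum (φ ∘ (outside ∷_)) - altsum (φ ∘ (inside ∷_))

altsum-cong : ∀ {φ ψ : Subset m → ℤ} → φ ≗ ψ → altsum φ ≡ altsum ψ
altsum-cong {zero}  eq = eq []
altsum-cong {suc m} eq = cong₂ _-_ (altsum-cong (eq ∘ (outside ∷_))) (altsum-cong (eq ∘ (inside ∷_)))

altsum-0 : ∀ {φ : Subset m → ℤ} → (∀ G → φ G ≡ 0ℤ) → altsum φ ≡ 0ℤ
altsum-0 {zero}  eq = eq []
altsum-0 {suc m} eq = cong₂ _-_ (altsum-0 (eq ∘ (outside ∷_))) (altsum-0 (eq ∘ (inside ∷_)))

-- G and G ∪ p carry opposite signs, so the terms cancel in pairs.
altsum-toggle : ∀ p {φ : Subset m → ℤ} →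
  (∀ G → lookup G p ≡ outside → φ (G Vec.[ p ]≔ inside) ≡ φ G) → altsum φ ≡ 0ℤ
altsum-toggle zero    {φ} toggle = trans
  (cong (_- altsum (φ ∘ (inside ∷_))) (altsum-cong λ G → sym (toggle (outside ∷ G) refl)))
  (ℤ.+-inverseʳ (altsum (φ ∘ (inside ∷_))))
altsum-toggle (suc p) toggle = cong₂ _-_
  (altsum-toggle p (toggle ∘ (outside ∷_))) (altsum-toggle p (toggle ∘ (inside ∷_)))

altsum-⊥ : ∀ {φ : Subset m → ℤ} → (∀ {p} G → p ∈ G → φ G ≡ 0ℤ) → altsum φ ≡ φ ⊥
altsum-⊥ {zero}      vanish = refl
altsum-⊥ {suc m} {φ} vanish = trans
  (cong₂ _-_ (altsum-⊥ {φ = φ ∘ (outside ∷_)} λ G p∈G → vanish (outside ∷ G) (there p∈G))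
             (altsum-0 λ G → vanish (inside ∷ G) here))
  (ℤ.+-identityʳ _)

sumᶻ-mono : ∀ {f g : Vector ℤ m} → (∀ p → f p ≤ g p) → sumᶻ f ≤ sumᶻ g
sumᶻ-mono {zero}  le = ℤ.≤-refl
sumᶻ-mono {suc m} le = ℤ.+-mono-≤ (le zero) (sumᶻ-mono (le ∘ suc))

sumᶻ-≥0 : ∀ {f : Vector ℤ m} → (∀ p → 0ℤ ≤ f p) → 0ℤ ≤ sumᶻ f
sumᶻ-≥0 {zero}  f≥0 = ℤ.≤-refl
sumᶻ-≥0 {suc m} f≥0 = 0≤+ (f≥0 zero) (sumᶻ-≥0 (f≥0 ∘ suc))

sumᶻ->0 : ∀ {f : Vector ℤ m} p → (∀ q → 0ℤ ≤ f q) → 0ℤ < f p → 0ℤ < sumᶻ f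
sumᶻ->0 zero    f≥0 fp>0 = ℤ.+-mono-<-≤ fp>0 (sumᶻ-≥0 (f≥0 ∘ suc))
sumᶻ->0 (suc p) f≥0 fp>0 = ℤ.+-mono-≤-< (f≥0 zero) (sumᶻ->0 p (f≥0 ∘ suc) fp>0)

sumᶻ-const : ∀ m c → sumᶻ {m} (λ _ → c) ≡ + m * c
sumᶻ-const zero    c = sym (ℤ.*-zeroˡ c)
sumᶻ-const (suc m) c = trans (cong (_+_ c) (sumᶻ-const m c)) (arith c (+ m))
  where
  arith : ∀ c m → c + m * c ≡ (1ℤ + m) * c
  arith = solve-∀

sumᶻ-insert : ∀ (G : Subset m) p (f : Vector ℤ m) → lookup G p ≡ outside →
  sumᶻ (λ q → χ (G Vec.[ p ]≔ inside) q * f q) ≡ sumᶻ (λ q → χ G q * f q) + f p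
sumᶻ-insert (s ∷ G) (suc p) f eq = trans (cong (_+_ (χ (s ∷ G) zero * f zero)) (sumᶻ-insert G p (f ∘ suc) eq))
  (sym (ℤ.+-assoc (χ (s ∷ G) zero * f zero) _ _))
sumᶻ-insert (_ ∷ G) zero f refl = arith (f zero) (sumᶻ (λ q → χ G q * f (suc q)))
  where
  arith : ∀ a b → 1ℤ * a + b ≡ (0ℤ * a + b) + a
  arith = solve-∀

-- Bookkeeping in base K: the summands are multiples of a K less at most one unit a each, so their
-- sum is a multiple of a K less at most m units.
sumᶻ-carry : ∀ {f : Vector ℤ m} a K →
  (∀ q → ∃[ Q ] ∃[ c ] f q ≡ a * (K * Q - c) × 0ℤ ≤ c × c ≤ 1ℤ) →
  ∃[ Q ] ∃[ c ] sumᶻ f ≡ a * (K * Q - c) × 0ℤ ≤ c × c ≤ + m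
sumᶻ-carry {zero}  a K each = 0ℤ , 0ℤ , sym (arith a K) , ℤ.≤-refl , ℤ.≤-refl
  where
  arith : ∀ a K → a * (K * 0ℤ - 0ℤ) ≡ 0ℤ
  arith = solve-∀
sumᶻ-carry {suc m} a K each =
  let Q , c , eq , 0≤c , c≤1 = each zero
      Q′ , c′ , eq′ , 0≤c′ , c′≤m = sumᶻ-carry a K (each ∘ suc)
  in Q + Q′ , c + c′ , trans (cong₂ _+_ eq eq′) (arith a K Q c Q′ c′) , 0≤+ 0≤c 0≤c′ , ℤ.+-mono-≤ c≤1 c′≤m
  where
  arith : ∀ a K Q c Q′ c′ → a * (K * Q - c) + a * (K * Q′ - c′) ≡ a * (K * (Q + Q′) - (c + c′))
  arith = solve-∀

χ≥0 : ∀ (S : Subset n) i → 0ℤ ≤ χ S i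
χ≥0 S i with χ-cases S i
... | inj₁ (_ , p) rewrite p = ℤ.+≤+ ℕ.z≤n
... | inj₂ (_ , p) rewrite p = ℤ.≤-refl

χ≤1 : ∀ (S : Subset n) i → χ S i ≤ 1ℤ
χ≤1 S i with χ-cases S i
... | inj₁ (_ , p) rewrite p = ℤ.≤-refl
... | inj₂ (_ , p) rewrite p = ℤ.+≤+ ℕ.z≤n

-- Initial segments and greedy bases

select : {P : Pred (Fin n) 0ℓ} → Decidable P → Subset n
select P? = Vec.tabulate (does ∘ P?)

∈-select⁺ : ∀ {P : Pred (Fin n) 0ℓ} (P? : Decidable P) {i} → P i → i ∈ select P?
∈-select⁺ P? {i} Pi = Vec.lookup⇒[]= i _ (trans (Vec.lookup∘tabulate (does ∘ P?) i) (dec-true (P? i) Pi))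

∈-select⁻ : ∀ {P : Pred (Fin n) 0ℓ} (P? : Decidable P) {i} → i ∈ select P? → P i
∈-select⁻ P? {i} i∈ with P? i | trans (sym (Vec.lookup∘tabulate (does ∘ P?) i)) (Vec.[]=⇒lookup i∈)
... | yes Pi | _ = Pi

prefix : (Fin n → ℕ) → ℕ → Subset n
prefix h k = select (λ i → h i ℕ.<? k)

module _ (h : Fin n → ℕ) where
  ∈-prefix⁺ : ∀ {k i} → h i ℕ.< k → i ∈ prefix h k
  ∈-prefix⁺ {k} = ∈-select⁺ (λ i → h i ℕ.<? k)

  ∈-prefix⁻ : ∀ {k i} → i ∈ prefix h k → h i ℕ.< k
  ∈-prefix⁻ {k} = ∈-select⁻ (λ i → h i ℕ.<? k)

  prefix-mono : ∀ {k l} → k ℕ.≤ l → prefix h k ⊆ prefix h l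
  prefix-mono k≤l i∈ = ∈-prefix⁺ (ℕ.<-≤-trans (∈-prefix⁻ i∈) k≤l)

  prefix-0 : prefix h 0 ≡ ⊥
  prefix-0 = ⊆-antisym (λ i∈ → contradiction (∈-prefix⁻ i∈) ℕ.n≮0) (λ i∈⊥ → contradiction i∈⊥ ∉⊥)

module _ {E : GroundSet} (M : Matroid E) (h : Fin (size E) → ℕ) where
  open Matroid M using (Basis; basis?)

  Saturated : Subset (size E) → ℕ → Set
  Saturated B k = ∣ B ∩ prefix h k ∣ ≡ rank M (prefix h k)

  -- The basis chosen by the greedy algorithm in order of increasing height.
  Greedy : Pred (Subset (size E)) 0ℓ
  Greedy B = Basis B × ∀ e → Saturated B (suc (h e))

  greedy? : Decidable Greedy
  greedy? B = basis? B ×-dec all? (λ e → ∣ B ∩ prefix h (suc (h e)) ∣ ℕ.≟ rank M (prefix h (suc (h e))))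

  -- Initial segments change only just after a height that is attained, so the thresholds in
  -- `Greedy` account for all the others.
  saturated-prefix : ∀ B k → (∀ e → h e ℕ.< k → Saturated B (suc (h e))) → Saturated B k
  saturated-prefix B zero    sat = trans (cong (λ p → ∣ B ∩ p ∣) (prefix-0 h))
    (trans (cong ∣_∣ (∩-zeroʳ B)) (trans (∣⊥∣≡0 (size E))
      (sym (trans (cong (rank M) (prefix-0 h)) (rank-⊥ M)))))
  saturated-prefix B (suc k) sat with any? (λ e → h e ℕ.≟ k)
  ... | yes (e , refl) = sat e ℕ.≤-refl
  ... | no  ∄e = subst (λ p → ∣ B ∩ p ∣ ≡ rank M p) same (saturated-prefix B k (λ e → sat e ∘ ℕ.m≤n⇒m≤1+n))
    where
    same : prefix h k ≡ prefix h (suc k)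
    same = ⊆-antisym (prefix-mono h (ℕ.n≤1+n k)) λ {i} i∈ →
      ∈-prefix⁺ h (ℕ.≤∧≢⇒< (ℕ.≤-pred (∈-prefix⁻ h i∈)) λ eq → ∄e (i , eq))

-- The perturbed points and their membership

module Perturbation {n} (h : Fin n → ℕ) {H} (h<H : ∀ i → h i ℕ.< H) (B : Subset n)
         {m} (src tgt : Fin m → Fin n)
         (edge : ∀ p → src p ∉ B × tgt p ∈ B × h (src p) ℕ.< h (tgt p)) where

  -- The m moves may contribute one unit each to a digit and toggling adds one more, so the base has
  -- to exceed m + 1.
  K : ℕ
  K = suc (suc m)

  scale : ℕ
  scale = K ℕ.^ H

  instance
    scale≢0 : ℕ.NonZero scale
    scale≢0 = ℕ.m^n≢0 K H

  -- The step δ multiplied by `scale`: for source e it is δ = K^(h e - H).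
  weight : Fin m → ℤ
  weight p = + (K ℕ.^ h (src p))

  perturbed : Subset m → Vector ℤ n
  perturbed G i = + scale * χ B i + sumᶻ (λ p → χ G p * (weight p * shift (src p) (tgt p) i))

  term : Subset n → Fin m → ℤ
  term S p = weight p * (χ S (src p) - χ S (tgt p))

  excess : Subset m → Subset n → ℤ
  excess G S = sumᶻ (λ p → χ G p * term S p)

  total-perturbed : ∀ G S → total (perturbed G) S ≡ + scale * + ∣ B ∩ S ∣ + excess G S
  total-perturbed G S = trans
      (total-+ (λ i → + scale * χ B i) (λ i → sumᶻ (λ p → χ G p * (weight p * shift (src p) (tgt p) i))) S)
    (cong₂ _+_ (trans (total-* (+ scale) (χ B) S) (cong (+ scale *_) (total-χ B S)))
      (trans (total-sum (λ p i → χ G p * (weight p * shift (src p) (tgt p) i)) S)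
        (sum-cong-≗ λ p → trans (total-* (χ G p) (λ i → weight p * shift (src p) (tgt p) i) S) (cong (χ G p *_)
          (trans (total-* (weight p) (shift (src p) (tgt p)) S) (cong (weight p *_) (total-shift (src p) (tgt p) S)))))))

  weight>0 : ∀ p → 0ℤ < weight p
  weight>0 p = ℤ.+<+ (ℕ.m^n>0 K (h (src p)))

  K*weight≤scale : ∀ p → + K * weight p ≤ + scale
  K*weight≤scale p = ℤ.≤-trans (ℤ.≤-reflexive (sym (ℤ.pos-* K (K ℕ.^ h (src p)))))
    (ℤ.+≤+ (ℕ.^-monoʳ-≤ K (h<H (src p))))

  scale>0 : 0ℤ < + scale
  scale>0 = ℤ.+<+ (ℕ.m^n>0 K H)

  power-split : ∀ {k l} → k ℕ.< l → + (K ℕ.^ l) ≡ (+ K * + (K ℕ.^ k)) * + (K ℕ.^ (l ℕ.∸ suc k))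
  power-split {k} {l} k<l = begin
    + (K ℕ.^ l)                                       ≡⟨ cong (λ l → + (K ℕ.^ l)) (ℕ.m+[n∸m]≡n k<l) ⟨
    + (K ℕ.^ (suc k ℕ.+ (l ℕ.∸ suc k)))               ≡⟨ cong +_ (ℕ.^-distribˡ-+-* K (suc k) (l ℕ.∸ suc k)) ⟩
    + (K ℕ.^ suc k ℕ.* K ℕ.^ (l ℕ.∸ suc k))           ≡⟨ ℤ.pos-* (K ℕ.^ suc k) _ ⟩
    + (K ℕ.^ suc k) * + (K ℕ.^ (l ℕ.∸ suc k))         ≡⟨ cong (_* + (K ℕ.^ (l ℕ.∸ suc k))) (ℤ.pos-* K (K ℕ.^ k)) ⟩
    (+ K * + (K ℕ.^ k)) * + (K ℕ.^ (l ℕ.∸ suc k))     ∎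
    where open ≡-Reasoning

  private

    module _ {a d w : ℤ} (0≤a : 0ℤ ≤ a) (a≤1 : a ≤ 1ℤ) (0≤w : 0ℤ ≤ w) where
      scaled≤ : d ≤ 1ℤ → a * (w * d) ≤ w
      scaled≤ d≤1 = ≤-lin (0≤+ (ℤ.i≤j⇒0≤j-i p) (ℤ.i≤j⇒0≤j-i q)) (arith w a d)
        where
        instance
          _ = ℤ.nonNegative 0≤a
          _ = ℤ.nonNegative 0≤w
        p : a * (w * d) ≤ a * (w * 1ℤ)
        p = ℤ.*-monoˡ-≤-nonNeg a (ℤ.*-monoˡ-≤-nonNeg w d≤1)
        q : a * w ≤ 1ℤ * w
        q = ℤ.*-monoʳ-≤-nonNeg w a≤1
        arith : ∀ w a d → w - a * (w * d) ≡ (a * (w * 1ℤ) - a * (w * d)) + (1ℤ * w - a * w)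
        arith = solve-∀

  -- Perturbations are smaller than one step of the lattice of multiples of scale.
  sum<scale : ∀ (f : Fin m → ℤ) → (∀ p → f p ≤ weight p) → sumᶻ f < + scale
  sum<scale f f≤ = ℤ.*-cancelˡ-<-nonNeg (+ K) (ℤ.≤-<-trans
    (ℤ.≤-trans (ℤ.≤-reflexive (*-distribˡ-sum (+ K) f))
      (ℤ.≤-trans (sumᶻ-mono λ p → ℤ.≤-trans (ℤ.*-monoˡ-≤-nonNeg (+ K) (f≤ p)) (K*weight≤scale p))
        (ℤ.≤-reflexive (sumᶻ-const m (+ scale)))))
    (ℤ.*-monoʳ-<-pos (+ scale) {{ℤ.positive scale>0}} (ℤ.+<+ (ℕ.m<n⇒m<1+n (ℕ.n<1+n m)))))

  excess<scale : ∀ G S → excess G S < + scale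
  excess<scale G S = sum<scale _ λ p → scaled≤ {χ G p} {_} {weight p} (χ≥0 G p) (χ≤1 G p) (ℤ.<⇒≤ (weight>0 p))
    (ℤ.≤-trans (ℤ.+-monoʳ-≤ (χ S (src p)) (ℤ.neg-mono-≤ (χ≥0 S (tgt p))))
      (ℤ.≤-trans (ℤ.≤-reflexive (ℤ.+-identityʳ _)) (χ≤1 S (src p))))

  -- The upper estimate applied to the reversed moves.
  -scale<excess : ∀ G S → 0ℤ < + scale + excess G S
  -scale<excess G S = subst (0ℤ <_)
      (trans (cong (λ z → + scale + - z) negated) (cong (_+_ (+ scale)) (ℤ.neg-involutive (excess G S))))
      (ℤ.≤-<-trans (ℤ.≤-reflexive (sym (ℤ.+-inverseʳ (sumᶻ f)))) (ℤ.+-monoˡ-< (- sumᶻ f) (sum<scale f f≤)))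
    where
    f : Fin m → ℤ
    f p = χ G p * (weight p * (χ S (tgt p) - χ S (src p)))
    f≤ : ∀ p → f p ≤ weight p
    f≤ p = scaled≤ {χ G p} {_} {weight p} (χ≥0 G p) (χ≤1 G p) (ℤ.<⇒≤ (weight>0 p))
      (ℤ.≤-trans (ℤ.+-monoʳ-≤ (χ S (tgt p)) (ℤ.neg-mono-≤ (χ≥0 S (src p))))
        (ℤ.≤-trans (ℤ.≤-reflexive (ℤ.+-identityʳ _)) (χ≤1 S (tgt p))))
    negated : sumᶻ f ≡ - excess G S
    negated = trans (sum-cong-≗ λ p → arith (χ G p) (weight p) (χ S (tgt p)) (χ S (src p)))
      (trans (sym (*-distribˡ-sum ℤ.-1ℤ (λ p → χ G p * term S p))) (ℤ.-1*i≡-i _))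
      where
      arith : ∀ g w a b → g * (w * (a - b)) ≡ ℤ.-1ℤ * (g * (w * (b - a)))
      arith = solve-∀

  excess-⊤ : ∀ G → excess G ⊤ ≡ 0ℤ
  excess-⊤ G = trans (sum-cong-≗ λ p → trans (cong (λ z → χ G p * (weight p * z))
      (cong₂ _-_ (χ-∈ (∈⊤ {x = src p})) (χ-∈ (∈⊤ {x = tgt p})))) (arith (χ G p) (weight p)))
    (trans (sumᶻ-const m 0ℤ) (ℤ.*-zeroʳ (+ m)))
    where
    arith : ∀ g w → g * (w * 0ℤ) ≡ 0ℤ
    arith = solve-∀

  -- Every move in G goes to a target strictly after its own source, hence after the lowest source.
  -- All targets thus lie outside this initial segment, which loses nothing and gains at least the
  -- weight of p.
  excess-prefix : ∀ G {p} → p ∈ G → (∀ q → q ∈ G → h (src p) ℕ.≤ h (src q)) →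
    0ℤ < excess G (prefix h (suc (h (src p))))
  excess-prefix G {p} p∈G lowest = sumᶻ->0 p nonneg positive
    where
    T = prefix h (suc (h (src p)))
    tgt∉T : ∀ q → q ∈ G → χ T (tgt q) ≡ 0ℤ
    tgt∉T q q∈G = χ-∉ {S = T} λ tgt∈T → ℕ.<⇒≱ (proj₂ (proj₂ (edge q)))
      (ℕ.≤-trans (ℕ.≤-pred (∈-prefix⁻ h tgt∈T)) (lowest q q∈G))
    nonneg : ∀ q → 0ℤ ≤ χ G q * term T q
    nonneg q with χ-cases G q
    ... | inj₂ (_ , g)   = ℤ.≤-reflexive (sym (trans (cong (_* term T q) g) (ℤ.*-zeroˡ (term T q))))
    ... | inj₁ (q∈G , g) = subst (0ℤ ≤_) (sym (trans (cong₂ (λ g t → g * (weight q * (χ T (src q) - t))) g (tgt∉T q q∈G))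
            (arith (weight q) (χ T (src q)))))
            (subst (_≤ weight q * χ T (src q)) (ℤ.*-zeroʳ (weight q))
              (ℤ.*-monoˡ-≤-nonNeg (weight q) {{ℤ.nonNegative (ℤ.<⇒≤ (weight>0 q))}} (χ≥0 T (src q))))
      where
      arith : ∀ w a → 1ℤ * (w * (a - 0ℤ)) ≡ w * a
      arith = solve-∀
    positive : 0ℤ < χ G p * term T p
    positive = subst (0ℤ <_) (sym (trans (cong₂ (λ g t → g * (weight p * t)) (χ-∈ p∈G)
        (cong₂ _-_ (χ-∈ (∈-prefix⁺ h (ℕ.n<1+n (h (src p))))) (tgt∉T p p∈G))) (arith (weight p)))) (weight>0 p)
      where
      arith : ∀ w → 1ℤ * (w * 1ℤ) ≡ w
      arith = solve-∀

module _ {E : GroundSet} (M : Matroid E) (h : Fin (size E) → ℕ) (h-injective : ∀ {i j} → h i ≡ h j → i ≡ j)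
         {H} (h<H : ∀ i → h i ℕ.< H) (B : Subset (size E))
         {m} (src tgt : Fin m → Fin (size E))
         (edge : ∀ p → src p ∉ B × tgt p ∈ B × h (src p) ℕ.< h (tgt p))
         (complete : ∀ {e j} → e ∉ B → j ∈ B → h e ℕ.< h j → ∃[ p ] src p ≡ e × tgt p ≡ j) where

  open Matroid M using (Basis; basis?)
  open Perturbation h h<H B src tgt edge

  InPolytope : Pred (Subset m) 0ℓ
  InPolytope G = Feasible M scale (perturbed G)

  inPolytope? : Decidable InPolytope
  inPolytope? G = feasible? M scale (perturbed G)

  private
    N = + scale

    instance
      N-positive : ℤ.Positive N
      N-positive = ℤ.positive scale>0

      N-nonNeg : ℤ.NonNegative N
      N-nonNeg = ℤ.nonNegative (ℤ.<⇒≤ scale>0)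

      N-nonZero : ℤ.NonZero N
      N-nonZero = ℤ.≢-nonZero (ℤ.<⇒≢ scale>0 ∘ sym)

  -- By rounding: the total over `⊤` is unperturbed, and the total over B is off by less than one
  -- multiple of `scale`.
  inPolytope⇒basis : ∀ G → InPolytope G → Basis B
  inPolytope⇒basis G (below , full) = full-rank⇒basis M card≡ card≤
    where
    card≡ : ∣ B ∣ ≡ rank M ⊤
    card≡ = ℤ.+-injective (ℤ.*-cancelˡ-≡ N _ _ (begin
      N * + ∣ B ∣                        ≡⟨ cong (λ p → N * + ∣ p ∣) (∩-identityʳ B) ⟨
      N * + ∣ B ∩ ⊤ ∣                    ≡⟨ ℤ.+-identityʳ _ ⟨
      N * + ∣ B ∩ ⊤ ∣ + 0ℤ               ≡⟨ cong (_+_ (N * + ∣ B ∩ ⊤ ∣)) (excess-⊤ G) ⟨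
      N * + ∣ B ∩ ⊤ ∣ + excess G ⊤       ≡⟨ total-perturbed G ⊤ ⟨
      total (perturbed G) ⊤              ≡⟨ full ⟩
      N * + rank M ⊤                     ∎))
      where open ≡-Reasoning
    card≤ : ∣ B ∣ ℕ.≤ rank M B
    card≤ = ℕ.≮⇒≥ λ rank<card → ℤ.<⇒≱ (-scale<excess G B)
        (≤-lin {c = bound M scale B - total (perturbed G) B + N * (+ ∣ B ∣ - (1ℤ + + rank M B))}
      (0≤+ (ℤ.i≤j⇒0≤j-i (below B))
        (subst (_≤ N * (+ ∣ B ∣ - (1ℤ + + rank M B))) (ℤ.*-zeroʳ N)
            (ℤ.*-monoˡ-≤-nonNeg N (ℤ.i≤j⇒0≤j-i (ℤ.+≤+ rank<card)))))
      (trans (arith N (+ rank M B) (+ ∣ B ∣) (excess G B))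
        (cong (λ z → bound M scale B - z + N * (+ ∣ B ∣ - (1ℤ + + rank M B)))
          (sym (trans (total-perturbed G B) (cong (λ p → N * + ∣ p ∣ + excess G B) (∩-idem B)))))))
      where
      arith : ∀ N r b x → 0ℤ - (N + x) ≡ N * r - (N * b + x) + N * (b - (1ℤ + r))
      arith = solve-∀

  module _ (basis : Basis B) where
    private
      below-basis : ∀ S → total (χ B) S ≤ bound M 1 S
      below-basis S = subst₂ _≤_ (sym (total-χ B S)) (sym (ℤ.*-identityˡ _)) (ℤ.+≤+ (∣B∩S∣≤rank M basis S))

      tight⇒saturated : ∀ {S} → Tight M 1 (χ B) S → ∣ B ∩ S ∣ ≡ rank M S
      tight⇒saturated {S} tS = ℤ.+-injective (trans (sym (total-χ B S)) (trans tS (ℤ.*-identityˡ _)))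

      saturated⇒tight : ∀ {S} → ∣ B ∩ S ∣ ≡ rank M S → Tight M 1 (χ B) S
      saturated⇒tight {S} eq = trans (total-χ B S) (trans (cong +_ eq) (sym (ℤ.*-identityˡ _)))

      saturated-⊤ : ∣ B ∩ ⊤ ∣ ≡ rank M ⊤
      saturated-⊤ = trans (cong ∣_∣ (∩-identityʳ B)) (basis⇒∣B∣≡rank M basis)

    -- A saturated initial segment has no room for the positive excess at the lowest source.
    overfull : ∀ G {p} → p ∈ G → (∀ q → q ∈ G → h (src p) ℕ.≤ h (src q)) →
      Saturated M h B (suc (h (src p))) → ¬ InPolytope G
    overfull G {p} p∈G lowest sat (below , _) = ℤ.<⇒≱ (excess-prefix G p∈G lowest)
      (≤-lin (ℤ.i≤j⇒0≤j-i (below T)) (trans (arith (N * + rank M T) (excess G T))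
        (cong (_-_ (bound M scale T)) (sym (trans (total-perturbed G T) (cong (λ r → N * + r + excess G T) sat))))))
      where
      T = prefix h (suc (h (src p)))
      arith : ∀ b x → 0ℤ - x ≡ b - (b + x)
      arith = solve-∀

    lowest-edge : ∀ G {p} → p ∈ G → ∃[ p ] p ∈ G × ∀ q → q ∈ G → h (src p) ℕ.≤ h (src q)
    lowest-edge G p∈G = minimalBy (h ∘ src) any? (λ p → p ∈? G) (_ , p∈G)

    inPolytope-⊥ : InPolytope ⊥
    inPolytope-⊥ = (λ S → subst (_≤ bound M scale S) (sym (total≡ S)) (ℤ.*-monoˡ-≤-nonNeg N (ℤ.+≤+ (∣B∩S∣≤rank M basis S))))
      , trans (total≡ ⊤) (cong (λ r → N * + r) saturated-⊤)
      where
      total≡ : ∀ S → total (perturbed ⊥) S ≡ N * + ∣ B ∩ S ∣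
      total≡ S = trans (total-perturbed ⊥ S) (trans (cong (_+_ (N * + ∣ B ∩ S ∣))
        (trans (sum-cong-≗ λ p → trans (cong (_* term S p) (χ-∉ {S = ⊥} {p} ∉⊥)) (ℤ.*-zeroˡ (term S p)))
          (trans (sumᶻ-const m 0ℤ) (ℤ.*-zeroʳ (+ m))))) (ℤ.+-identityʳ _))

    altsum-greedy : (∀ e → Saturated M h B (suc (h e))) → altsum (λ G → 𝟙 (inPolytope? G)) ≡ 1ℤ
    altsum-greedy sat = trans (altsum-⊥ λ {p} G p∈G →
        let q , q∈G , lowest = lowest-edge G p∈G in
        cong (λ b → if b then 1ℤ else 0ℤ) (dec-false (inPolytope? G) (overfull G q∈G lowest (sat (src q)))))
      (cong (λ b → if b then 1ℤ else 0ℤ) (dec-true (inPolytope? ⊥) inPolytope-⊥))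

    module _ {e} (unsat : ¬ Saturated M h B (suc (h e)))
             (least : ∀ f → ¬ Saturated M h B (suc (h f)) → h e ℕ.≤ h f) where
      private
        sat-below : ∀ f → h f ℕ.< h e → Saturated M h B (suc (h f))
        sat-below f f<e with ∣ B ∩ prefix h (suc (h f)) ∣ ℕ.≟ rank M (prefix h (suc (h f)))
        ... | yes sat = sat
        ... | no ¬sat = contradiction (least f ¬sat) (ℕ.<⇒≱ f<e)

        T₀ = prefix h (h e)
        T₁ = prefix h (suc (h e))

        sat₀ : ∣ B ∩ T₀ ∣ ≡ rank M T₀
        sat₀ = saturated-prefix M h B (h e) sat-below

        unsat₁ : ∣ B ∩ T₁ ∣ ℕ.< rank M T₁
        unsat₁ = ℕ.≤∧≢⇒< (∣B∩S∣≤rank M basis T₁) unsat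

        e∈T₁ : e ∈ T₁
        e∈T₁ = ∈-prefix⁺ h ℕ.≤-refl

        T₁⊆T₀∪e : T₁ ⊆ T₀ ∪ ⁅ e ⁆
        T₁⊆T₀∪e {i} i∈ with h i ℕ.≟ h e
        ... | yes eq = x∈p∪q⁺ (inj₂ (subst (_∈ ⁅ e ⁆) (sym (h-injective eq)) (x∈⁅x⁆ e)))
        ... | no neq = x∈p∪q⁺ (inj₁ (∈-prefix⁺ h (ℕ.≤∧≢⇒< (ℕ.≤-pred (∈-prefix⁻ h i∈)) neq)))

        T₀⊆T₁ : T₀ ⊆ T₁
        T₀⊆T₁ = prefix-mono h (ℕ.n≤1+n (h e))

        -- Passing from T₀ to T₁ raises the rank by at most one. If e were in B, it would raise the
        -- count of B by one as well, and T₁ would be saturated like T₀.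
        e∉B : e ∉ B
        e∉B e∈B = ℕ.<⇒≱ unsat₁ (begin
          rank M T₁              ≤⟨ rank-mono M T₁⊆T₀∪e ⟩
          rank M (T₀ ∪ ⁅ e ⁆)    ≤⟨ rank-∪⁅⁆ M T₀ e ⟩
          suc (rank M T₀)        ≡⟨ cong suc sat₀ ⟨
          suc ∣ B ∩ T₀ ∣         ≤⟨ p⊂q⇒∣p∣<∣q∣ (∩-monoʳ B T₀⊆T₁ , e , x∈p∩q⁺ (e∈B , e∈T₁)
                                    , λ e∈ → ℕ.<-irrefl refl (∈-prefix⁻ h (proj₂ (x∈p∩q⁻ B T₀ e∈)))) ⟩
          ∣ B ∩ T₁ ∣             ∎)
          where open ℕ.≤-Reasoning

      -- j lies in every saturated set containing e: it is an element of the
      -- fundamental circuit of e in B.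
      improvement : ∃[ j ] j ∈ B × h e ℕ.< h j × (∀ S → Tight M 1 (χ B) S → e ∈ S → j ∈ S)
      improvement with minimalBy ∣_∣ anySubset? (λ S → total (χ B) S ℤ.≟ bound M 1 S ×-dec e ∈? S)
                         (⊤ , saturated⇒tight saturated-⊤ , ∈⊤)
      ... | C , (tC , e∈C) , smallest with any? (λ j → j ∈? C ×-dec j ∈? B ×-dec h e ℕ.<? h j)
      ... | yes (j , j∈C , j∈B , e<j) = j , j∈B , e<j , λ S tS e∈S →
              ∩-minimal⇒⊆ S C (smallest (S ∩ C) (tight-∩ M 1 below-basis {S} {C} tS tC , x∈p∩q⁺ (e∈S , e∈C))) j∈C
      -- Otherwise B meets the tight set C ∪ T₀ only inside T₁. As T₁ is contained in C ∪ T₀, it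
      -- would be saturated.
      ... | no ∄j = contradiction overflow (ℕ.<⇒≱ unsat₁)
        where
        B∩[C∪T₀]⊆ : B ∩ (C ∪ T₀) ⊆ B ∩ T₁
        B∩[C∪T₀]⊆ {i} i∈ with x∈p∩q⁻ B (C ∪ T₀) i∈
        ... | i∈B , i∈C∪T₀ with x∈p∪q⁻ C T₀ i∈C∪T₀
        ... | inj₂ i∈T₀ = x∈p∩q⁺ (i∈B , T₀⊆T₁ i∈T₀)
        ... | inj₁ i∈C  = x∈p∩q⁺ (i∈B , ∈-prefix⁺ h (ℕ.s≤s (ℕ.≮⇒≥ λ e<i → ∄j (i , i∈C , i∈B , e<i))))
        T₁⊆C∪T₀ : T₁ ⊆ C ∪ T₀
        T₁⊆C∪T₀ i∈ with x∈p∪q⁻ T₀ ⁅ e ⁆ (T₁⊆T₀∪e i∈)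
        ... | inj₁ i∈T₀ = x∈p∪q⁺ (inj₂ i∈T₀)
        ... | inj₂ i∈e  = x∈p∪q⁺ {p = C} (inj₁ (subst (_∈ C) (sym (x∈⁅y⁆⇒x≡y e i∈e)) e∈C))
        overflow : rank M T₁ ℕ.≤ ∣ B ∩ T₁ ∣
        overflow = begin
          rank M T₁              ≤⟨ rank-mono M T₁⊆C∪T₀ ⟩
          rank M (C ∪ T₀)        ≡⟨ tight⇒saturated (tight-∪ M 1 below-basis {C} {T₀} tC (saturated⇒tight sat₀)) ⟨
          ∣ B ∩ (C ∪ T₀) ∣       ≤⟨ p⊆q⇒∣p∣≤∣q∣ B∩[C∪T₀]⊆ ⟩
          ∣ B ∩ T₁ ∣             ∎
          where open ℕ.≤-Reasoning

      module _ {p} (src≡e : src p ≡ e) (inseparable : ∀ S → Tight M 1 (χ B) S → e ∈ S → tgt p ∈ S)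
               (G : Subset m) (p∉G : lookup G p ≡ outside) where
        private
          G′ = G Vec.[ p ]≔ inside
          w = weight p

          inserted : ∀ S → total (perturbed G′) S ≡ total (perturbed G) S + term S p
          inserted S = trans (total-perturbed G′ S)
            (trans (cong (_+_ (N * + ∣ B ∩ S ∣)) (sumᶻ-insert G p (term S) p∉G))
              (trans (sym (ℤ.+-assoc (N * + ∣ B ∩ S ∣) _ _)) (cong (_+ term S p) (sym (total-perturbed G S)))))

          term-≡ : ∀ S {a b} → χ S (src p) ≡ a → χ S (tgt p) ≡ b → term S p ≡ w * (a - b)
          term-≡ S = cong₂ (λ a b → w * (a - b))

          inserted-⊤ : total (perturbed G′) ⊤ ≡ total (perturbed G) ⊤
          inserted-⊤ = trans (inserted ⊤) (trans (cong (_+_ (total (perturbed G) ⊤))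
            (trans (term-≡ ⊤ (χ-∈ (∈⊤ {x = src p})) (χ-∈ (∈⊤ {x = tgt p}))) (ℤ.*-zeroʳ w))) (ℤ.+-identityʳ _))

          term≤0 : ∀ S {a b} → χ S (src p) ≡ a → χ S (tgt p) ≡ b → a - b ≤ 0ℤ → term S p ≤ 0ℤ
          term≤0 S {a} {b} p≡ q≡ le = ℤ.≤-trans (ℤ.≤-reflexive (term-≡ S p≡ q≡))
            (subst (w * (a - b) ≤_) (ℤ.*-zeroʳ w) (ℤ.*-monoˡ-≤-nonNeg w {{ℤ.nonNegative (ℤ.<⇒≤ (weight>0 p))}} le))

          term≥0 : ∀ S {a b} → χ S (src p) ≡ a → χ S (tgt p) ≡ b → 0ℤ ≤ a - b → 0ℤ ≤ term S p
          term≥0 S {a} {b} p≡ q≡ le = ℤ.≤-trans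
            (subst (_≤ w * (a - b)) (ℤ.*-zeroʳ w) (ℤ.*-monoˡ-≤-nonNeg w {{ℤ.nonNegative (ℤ.<⇒≤ (weight>0 p))}} le))
            (ℤ.≤-reflexive (sym (term-≡ S p≡ q≡)))

        -- Only sets S that contain e but not the target gain weight. By `inseparable` they are not
        -- saturated, so their slack before perturbation is at least `scale`, more than any excess.
        insert⁺ : InPolytope G → InPolytope G′
        insert⁺ (below , full) = below′ , trans inserted-⊤ full
          where
          easy : ∀ S → term S p ≤ 0ℤ → total (perturbed G′) S ≤ bound M scale S
          easy S le = ℤ.≤-trans (ℤ.≤-reflexive (inserted S))
            (ℤ.≤-trans (ℤ.+-monoʳ-≤ (total (perturbed G) S) le)
              (ℤ.≤-trans (ℤ.≤-reflexive (ℤ.+-identityʳ _)) (below S)))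
          below′ : ∀ S → total (perturbed G′) S ≤ bound M scale S
          below′ S with χ-cases S (src p) | χ-cases S (tgt p)
          ... | inj₁ (_ , a) | inj₁ (_ , b) = easy S (term≤0 S a b ℤ.≤-refl)
          ... | inj₂ (_ , a) | inj₂ (_ , b) = easy S (term≤0 S a b ℤ.≤-refl)
          ... | inj₂ (_ , a) | inj₁ (_ , b) = easy S (term≤0 S a b ℤ.-≤+)
          ... | inj₁ (src∈S , _) | inj₂ (tgt∉S , _) = ≤-lin
              (0≤+ (ℤ.i≤j⇒0≤j-i (ℤ.*-monoˡ-≤-nonNeg N slack)) (ℤ.i≤j⇒0≤j-i (ℤ.<⇒≤ (excess<scale G′ S))))
              (trans (cong (_-_ (bound M scale S)) (total-perturbed G′ S))
                (arith N (+ rank M S) (+ ∣ B ∩ S ∣) (excess G′ S)))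
            where
            slack : 1ℤ + + ∣ B ∩ S ∣ ≤ + rank M S
            slack = ℤ.+≤+ (ℕ.≤∧≢⇒< (∣B∩S∣≤rank M basis S) λ eq →
              tgt∉S (inseparable S (saturated⇒tight eq) (subst (_∈ S) src≡e src∈S)))
            arith : ∀ N r b x → N * r - (N * b + x) ≡ (N * r - N * (1ℤ + b)) + (N - x)
            arith = solve-∀

        -- Removal gives weight back only to sets S that contain the target but not e. Their slack
        -- is a (K D + c + 1) with the move and a (K D + c) without it, where 0 ≤ c ≤ m.
        -- Nonnegativity of the first forces D ≥ 0, and with it that of the second.
        insert⁻ : InPolytope G′ → InPolytope G
        insert⁻ feas′@(below′ , full′) = below , trans (sym inserted-⊤) full′
          where
          -- With a move starting before e, the lowest source of G′ would be at a saturated initial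
          -- segment, and G′ would be overfull there.
          no-lower : ∀ q → q ∈ G → h e ℕ.≤ h (src q)
          no-lower q q∈G = ℕ.≮⇒≥ λ q<e →
            let q∈G′ = Vec.[]≔-minimal G q p (λ { refl → contradiction (trans (sym p∉G) (Vec.[]=⇒lookup q∈G)) λ () }) q∈G
                q₀ , q₀∈G′ , lowest = lowest-edge G′ q∈G′
            in overfull G′ q₀∈G′ lowest (sat-below (src q₀) (ℕ.≤-<-trans (lowest q q∈G′) q<e)) feas′
          easy : ∀ S → 0ℤ ≤ term S p → total (perturbed G) S ≤ bound M scale S
          easy S le = ℤ.≤-trans (ℤ.≤-trans (ℤ.≤-reflexive (sym (ℤ.+-identityʳ _)))
            (ℤ.≤-trans (ℤ.+-monoʳ-≤ (total (perturbed G) S) le) (ℤ.≤-reflexive (sym (inserted S))))) (below′ S)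
          a = + (K ℕ.^ h e)
          a>0 : 0ℤ < a
          a>0 = ℤ.+<+ (ℕ.m^n>0 K (h e))
          w≡a : w ≡ a
          w≡a = cong (λ f → + (K ℕ.^ h f)) src≡e
          below : ∀ S → total (perturbed G) S ≤ bound M scale S
          below S with χ-cases S (src p) | χ-cases S (tgt p)
          ... | inj₁ (_ , a) | inj₁ (_ , b) = easy S (term≥0 S a b ℤ.≤-refl)
          ... | inj₂ (_ , a) | inj₂ (_ , b) = easy S (term≥0 S a b ℤ.≤-refl)
          ... | inj₁ (_ , a) | inj₂ (_ , b) = easy S (term≥0 S a b (ℤ.+≤+ ℕ.z≤n))
          ... | inj₂ (src∉S , χsrc) | inj₁ (_ , χtgt) = ≤-lin {c = a * (+ K * D + c)}
              (subst (_≤ a * (+ K * D + c)) (ℤ.*-zeroʳ a) (ℤ.*-monoˡ-≤-nonNeg a {{ℤ.nonNegative (ℤ.<⇒≤ a>0)}}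
                (0≤+ (subst (_≤ + K * D) (ℤ.*-zeroʳ (+ K)) (ℤ.*-monoˡ-≤-nonNeg (+ K) D≥0)) 0≤c)))
              (trans (cong (_-_ (bound M scale S)) (total-perturbed G S))
                (trans (cong₂ (λ N x → N * + rank M S - (N * + ∣ B ∩ S ∣ + x)) N≡ decomposed)
                  (arith (+ K) a N′ (+ rank M S) (+ ∣ B ∩ S ∣) Q c)))
            where
            -- Edges at e contribute 0 or - a, all others multiples of K a.
            each : ∀ q → ∃[ Q ] ∃[ c ] χ G q * term S q ≡ a * (+ K * Q - c) × 0ℤ ≤ c × c ≤ 1ℤ
            each q with χ-cases G q
            ... | inj₂ (_ , g) = 0ℤ , 0ℤ , trans (cong (_* term S q) g)
                    (trans (ℤ.*-zeroˡ (term S q)) (zeros a (+ K))) , ℤ.≤-refl , ℤ.+≤+ ℕ.z≤n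
              where
              zeros : ∀ a K → 0ℤ ≡ a * (K * 0ℤ - 0ℤ)
              zeros = solve-∀
            ... | inj₁ (q∈G , g) with h e ℕ.≟ h (src q)
            ...   | yes eq = 0ℤ , χ S (tgt q) , trans (cong₂ (λ g f → g * (+ (K ℕ.^ f) * (χ S (src q) - χ S (tgt q))))
                g (sym eq))
                      (trans (cong (λ s → 1ℤ * (a * (s - χ S (tgt q))))
                          (trans (cong (χ S) (h-injective (trans (sym eq) (cong h (sym src≡e))))) χsrc))
                        (zeros a (+ K) (χ S (tgt q)))) , χ≥0 S (tgt q) , χ≤1 S (tgt q)
              where
              zeros : ∀ a K c → 1ℤ * (a * (0ℤ - c)) ≡ a * (K * 0ℤ - c)
              zeros = solve-∀
            ...   | no neq = + (K ℕ.^ (h (src q) ℕ.∸ suc (h e))) * (χ S (src q) - χ S (tgt q)) , 0ℤ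
                    , trans (cong₂ (λ g k → g * (k * (χ S (src q) - χ S (tgt q)))) g power)
                        (factor a (+ K) (+ (K ℕ.^ (h (src q) ℕ.∸ suc (h e)))) (χ S (src q) - χ S (tgt q)))
                    , ℤ.≤-refl , ℤ.+≤+ ℕ.z≤n
              where
              factor : ∀ a K k d → 1ℤ * ((K * a) * k * d) ≡ a * (K * (k * d) - 0ℤ)
              factor = solve-∀
              power : + (K ℕ.^ h (src q)) ≡ (+ K * a) * + (K ℕ.^ (h (src q) ℕ.∸ suc (h e)))
              power = power-split (ℕ.≤∧≢⇒< (no-lower q q∈G) neq)
            carry = sumᶻ-carry a (+ K) each
            Q = proj₁ carry
            c = proj₁ (proj₂ carry)
            decomposed : excess G S ≡ a * (+ K * Q - c)
            decomposed = proj₁ (proj₂ (proj₂ carry))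
            0≤c = proj₁ (proj₂ (proj₂ (proj₂ carry)))
            c≤m = proj₂ (proj₂ (proj₂ (proj₂ carry)))
            N′ = + (K ℕ.^ (H ℕ.∸ suc (h e)))
            N≡ : N ≡ (+ K * a) * N′
            N≡ = power-split (h<H e)
            D = N′ * (+ rank M S - + ∣ B ∩ S ∣) - Q
            arith : ∀ K a N′ r b Q c → (K * a) * N′ * r - ((K * a) * N′ * b + a * (K * Q - c))
                ≡ a * (K * (N′ * (r - b) - Q) + c)
            arith = solve-∀
            nonneg : 0ℤ ≤ + K * D + (c + 1ℤ)
            nonneg = ℤ.*-cancelˡ-≤-pos 0ℤ _ a {{ℤ.positive a>0}}
              (subst₂ _≤_ (sym (ℤ.*-zeroʳ a))
                (trans (cong (_-_ (bound M scale S)) (trans (inserted S)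
                    (cong₂ _+_ (total-perturbed G S) (trans (term-≡ S χsrc χtgt) (cong (_* (0ℤ - 1ℤ)) w≡a)))))
                  (trans (cong₂ (λ N x → N * + rank M S - (N * + ∣ B ∩ S ∣ + x + a * (0ℤ - 1ℤ))) N≡ decomposed)
                    (arith′ (+ K) a N′ (+ rank M S) (+ ∣ B ∩ S ∣) Q c)))
                (ℤ.i≤j⇒0≤j-i (below′ S)))
              where
              arith′ : ∀ K a N′ r b Q c → (K * a) * N′ * r - ((K * a) * N′ * b + a * (K * Q - c) + a * (0ℤ - 1ℤ))
                  ≡ a * (K * (N′ * (r - b) - Q) + (c + 1ℤ))
              arith′ = solve-∀
            -- D ≤ -1 would give K D + c + 1 ≤ -(m + 2) + m + 1 < 0.
            D≥0 : 0ℤ ≤ D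
            D≥0 = ℤ.≮⇒≥ λ D<0 → ℤ.<⇒≱ (ℤ.+<+ (ℕ.n<1+n (suc m)))
              (≤-lin {a = + K} {b = + suc m} (0≤+ (0≤+ nonneg (ℤ.i≤j⇒0≤j-i c≤m))
                  (subst (_≤ + K * (0ℤ - (1ℤ + D))) (ℤ.*-zeroʳ (+ K))
                      (ℤ.*-monoˡ-≤-nonNeg (+ K) (ℤ.i≤j⇒0≤j-i (ℤ.i<j⇒suc[i]≤j D<0)))))
                (arith″ (+ K) D c (+ m)))
              where
              arith″ : ∀ K D c m → (1ℤ + m) - K ≡ (K * D + (c + 1ℤ)) + (m - c) + K * (0ℤ - (1ℤ + D))
              arith″ = solve-∀

      altsum-not-greedy : altsum (λ G → 𝟙 (inPolytope? G)) ≡ 0ℤ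
      altsum-not-greedy =
        let j , j∈B , e<j , inseparable = improvement
            p , src≡e , tgt≡j = complete e∉B j∈B e<j
            inseparable′ = λ S tS e∈S → subst (_∈ S) (sym tgt≡j) (inseparable S tS e∈S)
        in altsum-toggle p λ G p∉G → cong (λ b → if b then 1ℤ else 0ℤ)
          (does-⇔ (mk⇔ (insert⁻ src≡e inseparable′ G p∉G) (insert⁺ src≡e inseparable′ G p∉G))
              (inPolytope? (G Vec.[ p ]≔ inside)) (inPolytope? G))

  altsum-inPolytope : altsum (λ G → 𝟙 (inPolytope? G)) ≡ 𝟙 (greedy? M h B)
  altsum-inPolytope with basis? B
  ... | no ¬basis = altsum-0 λ G → cong (λ b → if b then 1ℤ else 0ℤ) (dec-false (inPolytope? G) (¬basis ∘ inPolytope⇒basis G))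
  ... | yes basis with any? (λ e → ¬? (∣ B ∩ prefix h (suc (h e)) ∣ ℕ.≟ rank M (prefix h (suc (h e)))))
  ...   | no ∄e = trans (altsum-greedy basis sat) (sym (cong (λ b → if b then 1ℤ else 0ℤ) (dec-true (all? _) sat)))
    where
    sat : ∀ e → Saturated M h B (suc (h e))
    sat e = decidable-stable (_ ℕ.≟ _) λ ¬sat → ∄e (e , ¬sat)
  ...   | yes ∃e with minimalBy h any? (λ e → ¬? (∣ B ∩ prefix h (suc (h e)) ∣ ℕ.≟ rank M (prefix h (suc (h e))))) ∃e
  ...     | e , unsat , least = trans (altsum-not-greedy basis unsat least)
              (sym (cong (λ b → if b then 1ℤ else 0ℤ) (dec-false (all? _) λ sat → unsat (sat e))))

-- Valuative functions

𝟙-⇔ : ∀ {P Q : Set} → (P → Q) → (Q → P) → (p : Dec P) (q : Dec Q) → 𝟙 p ≡ 𝟙 q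
𝟙-⇔ to from p q = cong (λ b → if b then 1ℤ else 0ℤ) (does-⇔ (mk⇔ to from) p q)

𝟙-true : ∀ {P : Set} (p : Dec P) → P → 𝟙 p ≡ 1ℤ
𝟙-true p P = cong (λ b → if b then 1ℤ else 0ℤ) (dec-true p P)

𝟙-false : ∀ {P : Set} (p : Dec P) → ¬ P → 𝟙 p ≡ 0ℤ
𝟙-false p ¬P = cong (λ b → if b then 1ℤ else 0ℤ) (dec-false p ¬P)

listsum : {A : Set} → List A → (A → ℤ) → ℤ
listsum []       f = 0ℤ
listsum (x ∷ xs) f = f x + listsum xs f

length-filter : ∀ {A : Set} {P : Pred A 0ℓ} (P? : Decidable P) xs →
  + List.length (List.filter P? xs) ≡ listsum xs (𝟙 ∘ P?)
length-filter P? []       = refl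
length-filter P? (x ∷ xs) with P? x
... | yes _ = cong (_+_ 1ℤ) (length-filter P? xs)
... | no _  = trans (length-filter P? xs) (sym (ℤ.+-identityˡ _))

allsum : (Subset n → ℤ) → ℤ
allsum {zero}  φ = φ []
allsum {suc n} φ = allsum (φ ∘ (outside ∷_)) + allsum (φ ∘ (inside ∷_))

allsum-0 : ∀ {φ : Subset n → ℤ} → (∀ S → φ S ≡ 0ℤ) → allsum φ ≡ 0ℤ
allsum-0 {zero}  eq = eq []
allsum-0 {suc n} eq = cong₂ _+_ (allsum-0 (eq ∘ (outside ∷_))) (allsum-0 (eq ∘ (inside ∷_)))

allsum-unique : ∀ {φ : Subset n → ℤ} S → (∀ T → T ≢ S → φ T ≡ 0ℤ) → allsum φ ≡ φ S
allsum-unique []            eq = refl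
allsum-unique (outside ∷ S) eq = trans
  (cong₂ _+_ (allsum-unique S λ T T≢S → eq (outside ∷ T) (T≢S ∘ Vec.∷-injectiveʳ)) (allsum-0 λ T → eq (inside ∷ T) λ ()))
  (ℤ.+-identityʳ _)
allsum-unique (inside ∷ S)  eq = trans
  (cong₂ _+_ (allsum-0 λ T → eq (outside ∷ T) λ ()) (allsum-unique S λ T T≢S → eq (inside ∷ T) (T≢S ∘ Vec.∷-injectiveʳ)))
  (ℤ.+-identityˡ _)

χ-injective : ∀ {S T : Subset n} → χ S ≗ χ T → S ≡ T
χ-injective {S = S} {T} eq = ⊆-antisym (λ {i} i∈S → χ⇒∈ S T i∈S (eq i)) (λ {i} i∈T → χ⇒∈ T S i∈T (sym (eq i)))
  where
  χ⇒∈ : ∀ (S T : Subset _) {i} → i ∈ S → χ S i ≡ χ T i → i ∈ T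
  χ⇒∈ S T {i} i∈S eq with i ∈? T
  ... | yes i∈T = i∈T
  ... | no i∉T  = contradiction (trans (sym (χ-∈ i∈S)) (trans eq (χ-∉ i∉T))) λ ()

module _ {E : GroundSet} where

  -- Integer-valued functions on one ground set suffice, because an indicator relation involves a
  -- single E and equality in `ℤ-Functions` is pointwise.
  record Valuative (f : Matroid E → ℤ) : Set₁ where
    constructor valuative
    field
      relation : ∀ {s} (a : Vector ℤ s) (M : Vector (Matroid E) s) →
                 IndicatorRelation a M → sumᶻ (λ i → a i * f (M i)) ≡ 0ℤ

  open Valuative public

  valuative-cong : ∀ {f g} → (∀ M → f M ≡ g M) → Valuative f → Valuative g
  valuative-cong eq val = valuative λ a M rel → trans (sum-cong-≗ λ i → cong (a i *_) (sym (eq (M i)))) (relation val a M rel)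

  valuative-0 : Valuative (λ _ → 0ℤ)
  valuative-0 = valuative λ {s} a M rel → trans (sum-cong-≗ λ i → ℤ.*-zeroʳ (a i)) (sum-replicate-zero s)

  valuative-+ : ∀ {f g} → Valuative f → Valuative g → Valuative (λ M → f M + g M)
  valuative-+ {f} {g} vf vg = valuative λ a M rel → trans (sum-cong-≗ λ i → ℤ.*-distribˡ-+ (a i) (f (M i)) (g (M i)))
    (trans (∑-distrib-+ (λ i → a i * f (M i)) (λ i → a i * g (M i))) (cong₂ _+_ (relation vf a M rel) (relation vg a M rel)))

  valuative-* : ∀ c {f} → Valuative f → Valuative (λ M → c * f M)
  valuative-* c {f} vf = valuative λ a M rel → trans (sum-cong-≗ λ i → arith (a i) c (f (M i)))
    (trans (sym (*-distribˡ-sum c (λ i → a i * f (M i)))) (trans (cong (c *_) (relation vf a M rel)) (ℤ.*-zeroʳ c)))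
    where
    arith : ∀ a c x → a * (c * x) ≡ c * (a * x)
    arith = solve-∀

  valuative-altsum : ∀ {φ : Subset m → Matroid E → ℤ} → (∀ G → Valuative (φ G)) →
    Valuative (λ M → altsum (λ G → φ G M))
  valuative-altsum {zero}      vφ = vφ []
  valuative-altsum {suc m} {φ} vφ = valuative-+ (valuative-altsum (vφ ∘ (outside ∷_)))
    (valuative-cong (λ M → ℤ.-1*i≡-i (altsum (λ G → φ (inside ∷ G) M)))
      (valuative-* ℤ.-1ℤ (valuative-altsum (vφ ∘ (inside ∷_)))))

  valuative-allsum : ∀ {φ : Subset m → Matroid E → ℤ} → (∀ G → Valuative (φ G)) →
    Valuative (λ M → allsum (λ G → φ G M))
  valuative-allsum {zero}  vφ = vφ []
  valuative-allsum {suc m} vφ = valuative-+ (valuative-allsum (vφ ∘ (outside ∷_))) (valuative-allsum (vφ ∘ (inside ∷_)))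

  valuative-listsum : ∀ {A : Set} (xs : List A) {φ : A → Matroid E → ℤ} → (∀ x → Valuative (φ x)) →
    Valuative (λ M → listsum xs (λ x → φ x M))
  valuative-listsum []       vφ = valuative-0
  valuative-listsum (x ∷ xs) vφ = valuative-+ (vφ x) (valuative-listsum xs vφ)

  -- The relation is evaluated at the rational point x / N. `basePolytope?` has the same truth value
  -- as `feasible?` by construction.
  valuative-feasible : ∀ N .{{_ : ℕ.NonZero N}} x → Valuative (λ M → 𝟙 (feasible? M N x))
  valuative-feasible N x = valuative λ a M rel → rel (point N x) (λ i → basePolytope? (M i) N x)

  module _ (h : Fin (size E) → ℕ) (h-injective : ∀ {i j} → h i ≡ h j → i ≡ j) where

    private
      H : ℕ
      H = suc (max 0 (List.map h (List.allFin (size E))))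

      h<H : ∀ i → h i ℕ.< H
      h<H i = ℕ.s≤s (All.lookup (xs≤max 0 (List.map h (List.allFin (size E)))) (∈-map⁺ h (∈-allFin i)))

    valuative-greedy? : ∀ B → Valuative (λ M → 𝟙 (greedy? M h B))
    valuative-greedy? B = valuative-cong
      (λ M → altsum-inPolytope M h h-injective h<H B src tgt edge complete)
      (valuative-altsum λ G → valuative-feasible scale (perturbed G))
      where
      Improving : Pred (Fin (size E) × Fin (size E)) 0ℓ
      Improving (e , j) = e ∉ B × j ∈ B × h e ℕ.< h j
      improving? : Decidable Improving
      improving? (e , j) = ¬? (e ∈? B) ×-dec j ∈? B ×-dec h e ℕ.<? h j
      pairs = List.cartesianProduct (List.allFin (size E)) (List.allFin (size E))
      edges = List.filter improving? pairs
      src tgt : Fin (List.length edges) → Fin (size E)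
      src p = proj₁ (List.lookup edges p)
      tgt p = proj₂ (List.lookup edges p)
      edge : ∀ p → Improving (src p , tgt p)
      edge p = proj₂ (∈-filter⁻ improving? {xs = pairs} (∈-lookup p))
      complete : ∀ {e j} → e ∉ B → j ∈ B → h e ℕ.< h j → ∃[ p ] src p ≡ e × tgt p ≡ j
      complete {e} {j} e∉B j∈B e<j = index e,j∈
          , cong proj₁ (sym (lookup-index e,j∈)) , cong proj₂ (sym (lookup-index e,j∈))
        where
        e,j∈ : (e , j) ∈ˡ edges
        e,j∈ = ∈-filter⁺ improving? (∈-cartesianProduct⁺ (∈-allFin e) (∈-allFin j)) (e∉B , j∈B , e<j)
      open Perturbation h h<H B src tgt edge using (scale; perturbed; scale≢0)

    module _ (M : Matroid E) where
      -- The greedy algorithm: the initial segments are saturated in increasing order, and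
      -- `saturate` preserves what has been achieved on the smaller ones.
      saturated-upto : ∀ k → ∃[ B ] Matroid.Basis M B × ∀ l → l ℕ.≤ k → Saturated M h B l
      saturated-upto zero = let B , bB = Matroid.nonempty M in
        B , bB , λ { zero ℕ.z≤n → saturated-prefix M h B 0 λ _ () }
      saturated-upto (suc k) =
        let A , bA , sat = saturated-upto k
            B , bB , eq , grow = saturate M bA (prefix h (suc k))
        in B , bB , λ l l≤ → case ℕ.m≤n⇒m<n∨m≡n l≤ of λ where
          (inj₂ refl) → eq
          (inj₁ (ℕ.s≤s l≤k)) → ℕ.≤-antisym (∣B∩S∣≤rank M bB (prefix h l))
            (subst (ℕ._≤ ∣ B ∩ prefix h l ∣) (sat l l≤k) (grow (prefix-mono h l≤)))

      greedy-exists : ∃[ B ] Greedy M h B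
      greedy-exists = let B , bB , sat = saturated-upto H in B , bB , λ e → sat (suc (h e)) (h<H e)

      -- The greedy basis consists of the elements at which the rank of the initial segments jumps,
      -- so the rank function determines it.
      greedy-χ : ∀ {B} → Greedy M h B → ∀ e → + rank M (prefix h (h e)) + χ B e ≡ + rank M (prefix h (suc (h e)))
      greedy-χ {B} (_ , sat) e = begin
        + rank M (prefix h (h e)) + χ B e                        ≡⟨ cong (λ r → + r + χ B e) (saturated-prefix M h B (h e) (λ f _ → sat f)) ⟨
        + ∣ B ∩ prefix h (h e) ∣ + χ B e                         ≡⟨ cong (_+ χ B e) (total-χ B (prefix h (h e))) ⟨
        total (χ B) (prefix h (h e)) + χ B e                     ≡⟨ cong (λ S → total (χ B) S + χ B e) remove ⟨
        total (χ B) (prefix h (suc (h e)) ∖ e) + χ B e           ≡⟨ total-∖ (χ B) (∈-prefix⁺ h (ℕ.n<1+n (h e))) ⟩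
        total (χ B) (prefix h (suc (h e)))                       ≡⟨ total-χ B (prefix h (suc (h e))) ⟩
        + ∣ B ∩ prefix h (suc (h e)) ∣                           ≡⟨ cong +_ (sat e) ⟩
        + rank M (prefix h (suc (h e)))                          ∎
        where
        open ≡-Reasoning
        remove : prefix h (suc (h e)) ∖ e ≡ prefix h (h e)
        remove = ⊆-antisym
          (λ {i} i∈ → let i∈T , i∉e = x∈p─q⁻ (prefix h (suc (h e))) ⁅ e ⁆ i∈ in
            ∈-prefix⁺ h (ℕ.≤∧≢⇒< (ℕ.≤-pred (∈-prefix⁻ h i∈T))
              λ eq → i∉e (subst (_∈ ⁅ e ⁆) (sym (h-injective eq)) (x∈⁅x⁆ e))))
          (λ {i} i∈ → x∈p∧x≢y⇒x∈p-y (prefix-mono h (ℕ.n≤1+n (h e)) i∈)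
            λ { refl → ℕ.<-irrefl refl (∈-prefix⁻ h i∈) })

      greedy-unique : ∀ {B B′} → Greedy M h B → Greedy M h B′ → B′ ≡ B
      greedy-unique {B} {B′} gB gB′ = χ-injective λ e → cancel (+ rank M (prefix h (h e)))
        (trans (greedy-χ gB′ e) (sym (greedy-χ gB e)))
        where
        cancel : ∀ r {a b} → r + a ≡ r + b → a ≡ b
        cancel r {a} {b} eq = trans (drop r a) (trans (cong (_- r) eq) (sym (drop r b)))
          where
          drop : ∀ r a → a ≡ r + a - r
          drop = solve-∀

    -- f M is the sum of φ B [B is greedy in M] over all B, a sum with a single nonzero term.
    valuative-greedy : ∀ (φ : Subset (size E) → ℤ) {f} → (∀ M B → Greedy M h B → f M ≡ φ B) → Valuative f
    valuative-greedy φ {f} f≡ = valuative-cong eq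
      (valuative-allsum λ B → valuative-* (φ B) (valuative-greedy? B))
      where
      eq : ∀ M → allsum (λ B → φ B * 𝟙 (greedy? M h B)) ≡ f M
      eq M = let B , gB = greedy-exists M in begin
        allsum (λ B → φ B * 𝟙 (greedy? M h B))
          ≡⟨ allsum-unique B (λ B′ B′≢B → trans
               (cong (φ B′ *_) (𝟙-false (greedy? M h B′) (B′≢B ∘ greedy-unique M gB)))
               (ℤ.*-zeroʳ (φ B′))) ⟩
        φ B * 𝟙 (greedy? M h B)
          ≡⟨ cong (φ B *_) (𝟙-true (greedy? M h B) gB) ⟩
        φ B * 1ℤ
          ≡⟨ ℤ.*-identityʳ (φ B) ⟩
        φ B
          ≡⟨ f≡ M B gB ⟨
        f M ∎
        where open ≡-Reasoning

-- Flags of flats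

module _ {n : ℕ} where

  -- For a chain, this is the number of members not containing e.
  level : ∀ {s} → Vec (Subset n) s → Fin n → ℕ
  level []       e = 0
  level (F ∷ Fs) e = if does (e ∈? F) then 0 else suc (level Fs e)

  chain-∈ : ∀ {s} {F : Subset n} {Fs : Vec (Subset n) s} → Linked _⊆_ (F ∷ Fs) → ∀ {e} → e ∈ F →
    ∀ i → e ∈ lookup (F ∷ Fs) i
  chain-∈ chain        e∈F zero    = e∈F
  chain-∈ {Fs = _ ∷ _} (F⊆G ∷ chain) e∈F (suc i) = chain-∈ chain (F⊆G e∈F) i

  level-∈⁺ : ∀ {s} {Fs : Vec (Subset n) s} → Linked _⊆_ Fs → ∀ {e} i → e ∈ lookup Fs i → level Fs e ℕ.≤ Fin.toℕ i
  level-∈⁺ {Fs = F ∷ Fs} chain {e} i e∈ with e ∈? F | i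
  ... | yes _  | _     = ℕ.z≤n
  ... | no e∉F | zero  = contradiction e∈ e∉F
  ... | no _   | suc j = ℕ.s≤s (level-∈⁺ (Linked.tail chain) j e∈)

  level-∈⁻ : ∀ {s} {Fs : Vec (Subset n) s} → Linked _⊆_ Fs → ∀ {e} i → level Fs e ℕ.≤ Fin.toℕ i → e ∈ lookup Fs i
  level-∈⁻ {Fs = F ∷ Fs} chain {e} i le with e ∈? F | i
  ... | yes e∈F | i′    = chain-∈ chain e∈F i′
  ... | no _    | suc j = level-∈⁻ (Linked.tail chain) j (ℕ.≤-pred le)

  level-bound : ∀ {s} (Fs : Vec (Subset n) s) e → level Fs e ℕ.≤ s
  level-bound []       e = ℕ.z≤n
  level-bound (F ∷ Fs) e with e ∈? F
  ... | yes _ = ℕ.z≤n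
  ... | no _  = ℕ.s≤s (level-bound Fs e)

Pointwise⁺ : ∀ {A B : Set} {R : A → B → Set} {s} {xs : Vec A s} {ys : Vec B s} →
  (∀ i → R (lookup xs i) (lookup ys i)) → VecPointwise R xs ys
Pointwise⁺ {xs = []}     {[]}     r = VecPointwise.[]
Pointwise⁺ {xs = x ∷ xs} {y ∷ ys} r = r zero VecPointwise.∷ Pointwise⁺ (r ∘ suc)

module _ {n : ℕ} (ℓ : Fin n → ℕ) where

  -- Ties of ℓ are broken by position within blocks of length n. The order becomes injective, and ℓ
  -- e < c turns into the threshold c n.
  refine : Fin n → ℕ
  refine e = ℓ e ℕ.* n ℕ.+ Fin.toℕ e

  refine-< : ∀ {e c} → ℓ e ℕ.< c → refine e ℕ.< c ℕ.* n
  refine-< {e} {c} ℓ<c = begin-strict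
    ℓ e ℕ.* n ℕ.+ Fin.toℕ e   <⟨ ℕ.+-monoʳ-< (ℓ e ℕ.* n) (Fin.toℕ<n e) ⟩
    ℓ e ℕ.* n ℕ.+ n           ≡⟨ ℕ.+-comm (ℓ e ℕ.* n) n ⟩
    suc (ℓ e) ℕ.* n           ≤⟨ ℕ.*-monoˡ-≤ n ℓ<c ⟩
    c ℕ.* n                   ∎
    where open ℕ.≤-Reasoning

  refine-<⁻ : ∀ {e c} → refine e ℕ.< c ℕ.* n → ℓ e ℕ.< c
  refine-<⁻ {e} {c} lt = ℕ.≰⇒> λ c≤ℓ → ℕ.<⇒≱ lt (ℕ.≤-trans (ℕ.*-monoˡ-≤ n c≤ℓ) (ℕ.m≤m+n _ _))

  refine-injective : ∀ {i j} → refine i ≡ refine j → i ≡ j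
  refine-injective {i} {j} eq with ℕ.<-cmp (ℓ i) (ℓ j)
  ... | tri< lt _ _ = contradiction eq (ℕ.<⇒≢ (ℕ.<-≤-trans (refine-< {i} lt) (ℕ.m≤m+n _ _)))
  ... | tri> _ _ gt = contradiction (sym eq) (ℕ.<⇒≢ (ℕ.<-≤-trans (refine-< {j} gt) (ℕ.m≤m+n _ _)))
  ... | tri≈ _ ℓ≡ _ = Fin.toℕ-injective (ℕ.+-cancelˡ-≡ (ℓ i ℕ.* n) _ _
          (trans eq (cong (λ l → l ℕ.* n ℕ.+ Fin.toℕ j) (sym ℓ≡))))

module _ {E : GroundSet} (M : Matroid E) where

  -- What S spans is also spanned by a larger T: submodularity for S ∪ e and T.
  rank-∪⁅⁆-≤ : ∀ {S T} e → S ⊆ T → rank M (S ∪ ⁅ e ⁆) ℕ.≤ rank M S → rank M (T ∪ ⁅ e ⁆) ℕ.≤ rank M T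
  rank-∪⁅⁆-≤ {S} {T} e S⊆T spans = ℕ.+-cancelʳ-≤ (rank M S) _ _ (begin
    rank M (T ∪ ⁅ e ⁆) ℕ.+ rank M S                                  ≤⟨ ℕ.+-mono-≤ (rank-mono M T∪e⊆) (rank-mono M S⊆∩) ⟩
    rank M ((S ∪ ⁅ e ⁆) ∪ T) ℕ.+ rank M ((S ∪ ⁅ e ⁆) ∩ T)            ≤⟨ rank-submodular M (S ∪ ⁅ e ⁆) T ⟩
    rank M (S ∪ ⁅ e ⁆) ℕ.+ rank M T                                  ≤⟨ ℕ.+-monoˡ-≤ (rank M T) spans ⟩
    rank M S ℕ.+ rank M T                                            ≡⟨ ℕ.+-comm (rank M S) (rank M T) ⟩
    rank M T ℕ.+ rank M S                                            ∎)
    where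
    open ℕ.≤-Reasoning
    T∪e⊆ : T ∪ ⁅ e ⁆ ⊆ (S ∪ ⁅ e ⁆) ∪ T
    T∪e⊆ x∈ with x∈p∪q⁻ T ⁅ e ⁆ x∈
    ... | inj₁ x∈T = x∈p∪q⁺ (inj₂ x∈T)
    ... | inj₂ x∈e = x∈p∪q⁺ {p = S ∪ ⁅ e ⁆} (inj₁ (x∈p∪q⁺ (inj₂ x∈e)))
    S⊆∩ : S ⊆ (S ∪ ⁅ e ⁆) ∩ T
    S⊆∩ x∈S = x∈p∩q⁺ (x∈p∪q⁺ (inj₁ x∈S) , S⊆T x∈S)

module _ {n s : ℕ} (Fs : Vec (Subset n) s) (chain : Linked _⊆_ Fs) where

  extended? : ∀ L k → Decidable (λ x → level Fs x ℕ.≤ k ⊎ (level Fs x ≡ suc k × x ∈ L))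
  extended? L k x = level Fs x ℕ.≤? k ⊎-dec (level Fs x ℕ.≟ suc k ×-dec x ∈? L)

  -- The k-th member together with the elements of L in the next one.
  extended : Subset n → ℕ → Subset n
  extended L k = select (extended? L k)

  -- Each member of the chain and its extension by L are initial segments.
  height : Subset n → Fin n → ℕ
  height L e = 2 ℕ.* level Fs e ℕ.∸ (if does (e ∈? L) then 1 else 0)

  order : Subset n → Fin n → ℕ
  order L = refine (height L)

  private
    2*suc : ∀ k → 2 ℕ.* suc k ≡ suc (suc (2 ℕ.* k))
    2*suc = ℕsolve-∀

    height-≤ : ∀ L {e k} → level Fs e ℕ.≤ k → height L e ℕ.≤ 2 ℕ.* k
    height-≤ L {e} le = ℕ.≤-trans (ℕ.m∸n≤m _ (if does (e ∈? L) then 1 else 0)) (ℕ.*-monoʳ-≤ 2 le)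

    height-≥ : ∀ L {e k} → k ℕ.< level Fs e → 2 ℕ.* k ℕ.< height L e
    height-≥ L {e} {k} lt with e ∈? L
    ... | yes _ = ℕ.∸-monoˡ-≤ 1 (ℕ.≤-trans (ℕ.≤-reflexive (sym (2*suc k))) (ℕ.*-monoʳ-≤ 2 lt))
    ... | no _  = ℕ.≤-trans (ℕ.n≤1+n _) (ℕ.≤-trans (ℕ.≤-reflexive (sym (2*suc k))) (ℕ.*-monoʳ-≤ 2 lt))

    height-∈ : ∀ L {e k} → level Fs e ≡ suc k → e ∈ L → height L e ≡ suc (2 ℕ.* k)
    height-∈ L {e} {k} eq e∈L with e ∈? L
    ... | yes _  = cong (ℕ._∸ 1) (trans (cong (2 ℕ.*_) eq) (2*suc k))
    ... | no e∉L = contradiction e∈L e∉L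

    height-∉ : ∀ L {e k} → level Fs e ≡ suc k → e ∉ L → height L e ≡ suc (suc (2 ℕ.* k))
    height-∉ L {e} {k} eq e∉L with e ∈? L
    ... | yes e∈L = contradiction e∈L e∉L
    ... | no _    = trans (cong (2 ℕ.*_) eq) (2*suc k)

  -- Even heights 2 i close off the members. The odd height 2 i + 1 is reserved for those elements
  -- of L that enter at the next member, which gives `extended`.
  member-prefix : ∀ L i → lookup Fs i ≡ prefix (order L) (suc (2 ℕ.* Fin.toℕ i) ℕ.* n)
  member-prefix L i = ⊆-antisym
    (λ {x} x∈ → ∈-prefix⁺ (order L) (refine-< (height L) {x} (ℕ.s≤s (height-≤ L (level-∈⁺ chain i x∈)))))
    (λ {x} x∈ → level-∈⁻ chain i (ℕ.≮⇒≥ λ i<ℓ → ℕ.<⇒≱ (refine-<⁻ (height L) {x} (∈-prefix⁻ (order L) x∈)) (height-≥ L i<ℓ)))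

  extended-prefix : ∀ L k → extended L k ≡ prefix (order L) (suc (suc (2 ℕ.* k)) ℕ.* n)
  extended-prefix L k = ⊆-antisym
    (λ {x} x∈ → ∈-prefix⁺ (order L) (refine-< (height L) {x} (to (∈-select⁻ (extended? L k) x∈))))
    (λ {x} x∈ → ∈-select⁺ (extended? L k) (from (refine-<⁻ (height L) {x} (∈-prefix⁻ (order L) x∈))))
    where
    to : ∀ {x} → level Fs x ℕ.≤ k ⊎ (level Fs x ≡ suc k × x ∈ L) → height L x ℕ.< suc (suc (2 ℕ.* k))
    to (inj₁ le)         = ℕ.m≤n⇒m≤1+n (ℕ.s≤s (height-≤ L le))
    to (inj₂ (eq , x∈L)) = ℕ.≤-reflexive (cong suc (height-∈ L eq x∈L))
    from : ∀ {x} → height L x ℕ.< suc (suc (2 ℕ.* k)) → level Fs x ℕ.≤ k ⊎ (level Fs x ≡ suc k × x ∈ L)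
    from {x} lt with ℕ.<-cmp (level Fs x) (suc k)
    ... | tri< le _ _ = inj₁ (ℕ.≤-pred le)
    ... | tri≈ _ eq _ = inj₂ (eq , decidable-stable (x ∈? L) λ x∉L → ℕ.<⇒≢ lt (height-∉ L eq x∉L))
    ... | tri> _ _ gt = contradiction (height-≥ L gt)
            (ℕ.≤⇒≯ (ℕ.≤-trans (ℕ.<⇒≤ lt) (ℕ.≤-reflexive (sym (2*suc k)))))

  member⊆extended : ∀ L i → lookup Fs i ⊆ extended L (Fin.toℕ i)
  member⊆extended L i x∈ = ∈-select⁺ (extended? L (Fin.toℕ i)) (inj₁ (level-∈⁺ chain i x∈))

  level-index : ∀ {e k} → level Fs e ≡ suc k → ∃[ i ] Fin.toℕ i ≡ k
  level-index {e} eq = Fin.fromℕ< k<s , Fin.toℕ-fromℕ< k<s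
    where k<s = subst (ℕ._≤ s) eq (level-bound Fs e)

module _ {E : GroundSet} {s} (rs : Vec ℕ s) (Fs : Vec (Subset (size E)) s) (chain : Linked _⊆_ Fs) where

  -- For r = rank M the conditions say that the chain has ranks rs and that every element of L is
  -- spanned by the last member of the chain not containing it. A chain has no such element
  -- precisely when all members are flats.
  Ranks : (Subset (size E) → ℕ) → Pred (Subset (size E)) 0ℓ
  Ranks r L = (∀ i → r (lookup Fs i) ≡ lookup rs i × r (extended Fs chain L (Fin.toℕ i)) ≡ lookup rs i)
            × (∀ e → e ∈ L → 0 ℕ.< level Fs e)

  ranks? : ∀ r → Decidable (Ranks r)
  ranks? r L = all? (λ i → r (lookup Fs i) ℕ.≟ lookup rs i ×-dec r (extended Fs chain L (Fin.toℕ i)) ℕ.≟ lookup rs i)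
         ×-dec all? (λ e → e ∈? L →-dec 0 ℕ.<? level Fs e)

  -- In this order all sets in question are initial segments, which the greedy basis B saturates.
  -- Replacing their ranks by ∣ B ∩ S ∣ makes the condition a function of B alone.
  valuative-ranks : ∀ L → Valuative {E} (λ M → 𝟙 (ranks? (rank M) L))
  valuative-ranks L = valuative-greedy h (λ {i} {j} → refine-injective (height Fs chain L) {i} {j})
    (λ B → 𝟙 (ranks? (λ S → ∣ B ∩ S ∣) L)) λ M B (_ , sat) →
      let r≡ : ∀ k → ∣ B ∩ prefix h k ∣ ≡ rank M (prefix h k)
          r≡ k = saturated-prefix M h B k λ e _ → sat e
          member : ∀ i → ∣ B ∩ lookup Fs i ∣ ≡ rank M (lookup Fs i)
          member i = subst (λ S → ∣ B ∩ S ∣ ≡ rank M S) (sym (member-prefix Fs chain L i)) (r≡ (suc (2 ℕ.* Fin.toℕ i) ℕ.* size E))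
          ext : ∀ k → ∣ B ∩ extended Fs chain L k ∣ ≡ rank M (extended Fs chain L k)
          ext k = subst (λ S → ∣ B ∩ S ∣ ≡ rank M S) (sym (extended-prefix Fs chain L k)) (r≡ (suc (suc (2 ℕ.* k)) ℕ.* size E))
      in 𝟙-⇔
        (λ (ranks , pos) → (λ i → trans (member i) (proj₁ (ranks i)) , trans (ext (Fin.toℕ i)) (proj₂ (ranks i))) , pos)
        (λ (ranks , pos) → (λ i → trans (sym (member i)) (proj₁ (ranks i)) , trans (sym (ext (Fin.toℕ i))) (proj₂ (ranks i))) , pos)
        (ranks? (rank M) L) (ranks? (λ S → ∣ B ∩ S ∣) L)
    where h = order Fs chain L

  module _ (M : Matroid E) where

    altsum-flag : Flag M rs Fs → altsum (λ L → 𝟙 (ranks? (rank M) L)) ≡ 1ℤ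
    altsum-flag (flats , _) = trans
      (altsum-⊥ λ {e} L e∈L → 𝟙-false (ranks? (rank M) L) (breaks e∈L))
      (𝟙-true (ranks? (rank M) ⊥)
          ((λ i → rank≡ i , trans (cong (rank M) (extended-⊥ i)) (rank≡ i)) , λ e e∈⊥ → contradiction e∈⊥ ∉⊥))
      where
      rank≡ : ∀ i → rank M (lookup Fs i) ≡ lookup rs i
      rank≡ i = proj₂ (VecPointwise.lookup flats i)
      extended-⊥ : ∀ i → extended Fs chain ⊥ (Fin.toℕ i) ≡ lookup Fs i
      extended-⊥ i = ⊆-antisym
        (λ x∈ → case (∈-select⁻ (extended? Fs chain ⊥ (Fin.toℕ i)) x∈) of λ where
          (inj₁ le)        → level-∈⁻ chain i le
          (inj₂ (_ , x∈⊥)) → contradiction x∈⊥ ∉⊥)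
        (member⊆extended Fs chain ⊥ i)
      -- The positivity condition provides a last member not containing e. It is a flat, so its
      -- extension, which contains e, has larger rank than prescribed.
      breaks : ∀ {e L} → e ∈ L → ¬ Ranks (rank M) L
      breaks {e} {L} e∈L (ranks , pos) with level Fs e in eq | pos e e∈L
      ... | suc k | _ with level-index Fs chain {e} eq
      ... | i , refl = ℕ.<⇒≱ (proj₁ (VecPointwise.lookup flats i) e λ e∈ →
                ℕ.<⇒≱ (ℕ.n<1+n (Fin.toℕ i)) (subst (ℕ._≤ Fin.toℕ i) eq (level-∈⁺ chain i e∈)))
              (ℕ.≤-trans (rank-mono M F∪e⊆) (ℕ.≤-reflexive (trans (proj₂ (ranks i)) (sym (rank≡ i)))))
        where
        F∪e⊆ : lookup Fs i ∪ ⁅ e ⁆ ⊆ extended Fs chain L (Fin.toℕ i)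
        F∪e⊆ x∈ with x∈p∪q⁻ (lookup Fs i) ⁅ e ⁆ x∈
        ... | inj₁ x∈F = member⊆extended Fs chain L i x∈F
        ... | inj₂ x∈e = ∈-select⁺ (extended? Fs chain L (Fin.toℕ i))
                (inj₂ (subst (λ x → level Fs x ≡ _ × x ∈ L) (sym (x∈⁅y⁆⇒x≡y e x∈e)) (eq , e∈L)))

    -- An element in the closure of a member not containing it can be added to
    -- or removed from L without changing any rank.
    altsum-not-flat : ∀ i e → e ∉ lookup Fs i → rank M (lookup Fs i ∪ ⁅ e ⁆) ℕ.≤ rank M (lookup Fs i) →
      altsum (λ L → 𝟙 (ranks? (rank M) L)) ≡ 0ℤ
    altsum-not-flat i e e∉F spans = altsum-toggle e λ L e∉L → 𝟙-⇔
      (λ (ranks , pos) → (λ j → proj₁ (ranks j) , trans (sym (toggled L e∉L j)) (proj₂ (ranks j)))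
          , λ x x∈L → pos x (L⊆ L e∉L x∈L))
      (λ (ranks , pos) → (λ j → proj₁ (ranks j) , trans (toggled L e∉L j) (proj₂ (ranks j)))
        , λ x x∈ → case (⊆L∪e L x∈) of λ where
            (inj₁ x∈L) → pos x x∈L
            (inj₂ refl) → ℕ.≤-<-trans ℕ.z≤n i<ℓ)
      (ranks? (rank M) (L Vec.[ e ]≔ inside)) (ranks? (rank M) L)
      where
      i<ℓ : Fin.toℕ i ℕ.< level Fs e
      i<ℓ = ℕ.≰⇒> (e∉F ∘ level-∈⁻ chain i)
      L⊆ : ∀ L → lookup L e ≡ outside → L ⊆ L Vec.[ e ]≔ inside
      L⊆ L e∉L {x} x∈L = Vec.[]≔-minimal L x e
        (λ { refl → contradiction (trans (sym e∉L) (Vec.[]=⇒lookup x∈L)) λ () }) x∈L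
      ⊆L∪e : ∀ L {x} → x ∈ L Vec.[ e ]≔ inside → x ∈ L ⊎ x ≡ e
      ⊆L∪e L {x} x∈ with x Fin.≟ e
      ... | yes x≡e = inj₂ x≡e
      ... | no x≢e  = inj₁ (Vec.lookup⇒[]= x L (trans (sym (Vec.lookup∘updateAt′ x e x≢e L)) (Vec.[]=⇒lookup x∈)))
      toggled : ∀ L → lookup L e ≡ outside → ∀ j →
        rank M (extended Fs chain (L Vec.[ e ]≔ inside) (Fin.toℕ j)) ≡ rank M (extended Fs chain L (Fin.toℕ j))
      toggled L e∉L j = ℕ.≤-antisym upper (rank-mono M λ {x} x∈ →
        ∈-select⁺ (extended? Fs chain L′ k) (Sum.map₂ (Product.map₂ (L⊆ L e∉L)) (∈-select⁻ (extended? Fs chain L k) x∈)))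
        where
        k = Fin.toℕ j
        L′ = L Vec.[ e ]≔ inside
        D = extended Fs chain L k
        D′⊆ : ∀ {x} → x ∈ extended Fs chain L′ k → x ∈ D ⊎ (x ≡ e × level Fs e ≡ suc k)
        D′⊆ x∈ with ∈-select⁻ (extended? Fs chain L′ k) x∈
        ... | inj₁ le        = inj₁ (∈-select⁺ (extended? Fs chain L k) (inj₁ le))
        ... | inj₂ (eq , x∈L′) with ⊆L∪e L x∈L′
        ...   | inj₁ x∈L  = inj₁ (∈-select⁺ (extended? Fs chain L k) (inj₂ (eq , x∈L)))
        ...   | inj₂ refl = inj₂ (refl , eq)
        upper : rank M (extended Fs chain L′ k) ℕ.≤ rank M D
        upper with level Fs e ℕ.≟ suc k
        ... | no neq = rank-mono M λ x∈ → case (D′⊆ x∈) of λ where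
                (inj₁ x∈D)     → x∈D
                (inj₂ (_ , eq)) → contradiction eq neq
        -- Toggling e affects only the extension just before e enters the chain. That set contains
        -- the i-th member, so it spans e too.
        ... | yes eq = ℕ.≤-trans (rank-mono M D′⊆D∪e) (rank-∪⁅⁆-≤ M e F⊆D spans)
          where
          D′⊆D∪e : extended Fs chain L′ k ⊆ D ∪ ⁅ e ⁆
          D′⊆D∪e x∈ with D′⊆ x∈
          ... | inj₁ x∈D        = x∈p∪q⁺ (inj₁ x∈D)
          ... | inj₂ (refl , _) = x∈p∪q⁺ {p = D} (inj₂ (x∈⁅x⁆ e))
          F⊆D : lookup Fs i ⊆ D
          F⊆D x∈ = ∈-select⁺ (extended? Fs chain L k) (inj₁ (ℕ.≤-trans (level-∈⁺ chain i x∈)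
            (ℕ.≤-pred (subst (Fin.toℕ i ℕ.<_) eq i<ℓ))))

    altsum-ranks : altsum (λ L → 𝟙 (ranks? (rank M) L)) ≡ 𝟙 (flag? M rs Fs)
    altsum-ranks with any? (λ i → ¬? (rank M (lookup Fs i) ℕ.≟ lookup rs i))
    ... | yes (i , rank≢) = trans (altsum-0 λ L → 𝟙-false (ranks? (rank M) L) λ (ranks , _) → rank≢ (proj₁ (ranks i)))
            (sym (𝟙-false (flag? M rs Fs) λ (flats , _) → rank≢ (proj₂ (VecPointwise.lookup flats i))))
    ... | no ∄i with any? (λ i → ¬? (flat? M (lookup Fs i)))
    ...   | no ∄j = trans (altsum-flag flag) (sym (𝟙-true (flag? M rs Fs) flag))
      where
      flag : Flag M rs Fs
      flag = Pointwise⁺ (λ i → decidable-stable (flat? M (lookup Fs i)) (λ ¬flat → ∄j (i , ¬flat))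
                             , decidable-stable (rank M (lookup Fs i) ℕ.≟ lookup rs i) (λ ≢ → ∄i (i , ≢)))
           , chain
    ...   | yes (i , ¬flat) with any? (λ e → ¬? (e ∈? lookup Fs i)
        ×-dec ¬? (rank M (lookup Fs i) ℕ.<? rank M (lookup Fs i ∪ ⁅ e ⁆)))
    ...     | yes (e , e∉F , ¬lt) = trans (altsum-not-flat i e e∉F (ℕ.≮⇒≥ ¬lt))
                (sym (𝟙-false (flag? M rs Fs) λ (flats , _) → ¬flat (proj₁ (VecPointwise.lookup flats i))))
    ...     | no ∄e = contradiction (λ e e∉F → decidable-stable (_ ℕ.<? _) λ ¬lt → ∄e (e , e∉F , ¬lt)) ¬flat

valuative-flag : ∀ {E : GroundSet} {s} (rs : Vec ℕ s) (Fs : Vec (Subset (size E)) s) →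
  Valuative {E} (λ M → 𝟙 (flag? M rs Fs))
valuative-flag {E} rs Fs = go (linked? _⊆?_ Fs)
  where
  go : Dec (Linked _⊆_ Fs) → Valuative {E} (λ M → 𝟙 (flag? M rs Fs))
  go (yes chain) = valuative-cong (altsum-ranks rs Fs chain) (valuative-altsum (valuative-ranks rs Fs chain))
  go (no ¬chain) = valuative-cong (λ M → sym (𝟙-false (flag? M rs Fs) (¬chain ∘ proj₂))) valuative-0

valuative-α : ∀ {E : GroundSet} R → Valuative {E} (λ M → α M R)
valuative-α {E} R = valuative-cong
  (λ M → sym (length-filter (flag? M elements) (vectors (subsets (size E)) card)))
  (valuative-listsum (vectors (subsets (size E)) card) (valuative-flag elements))
  where open FiniteSet R

-- Isomorphisms

module _ {A : Set} {xs : List A} (unique : Unique xs) where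
  Unique-lookup-injective : ∀ {i j} → List.lookup xs i ≡ List.lookup xs j → i ≡ j
  Unique-lookup-injective = go unique
    where
    go : ∀ {xs : List A} → Unique xs → ∀ {i j} → List.lookup xs i ≡ List.lookup xs j → i ≡ j
    go (x≢ ∷ u) {zero}  {zero}  eq = refl
    go (x≢ ∷ u) {zero}  {suc j} eq = contradiction eq (All.lookup x≢ (∈-lookup j))
    go (x≢ ∷ u) {suc i} {zero}  eq = contradiction (sym eq) (All.lookup x≢ (∈-lookup i))
    go (x≢ ∷ u) {suc i} {suc j} eq = cong suc (go u eq)

  -- Positions in xs inject into positions in ys.
  length-≤ : ∀ {B : Set} {ys : List B} (f : A → B) → (∀ {x y} → f x ≡ f y → x ≡ y) →
    (∀ {x} → x ∈ˡ xs → f x ∈ˡ ys) → List.length xs ℕ.≤ List.length ys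
  length-≤ {ys = ys} f f-injective f∈ = Fin.injective⇒≤ {f = λ i → index (f∈ (∈-lookup i))} λ {i} {j} eq →
    Unique-lookup-injective (f-injective (trans (lookup-index (f∈ (∈-lookup i)))
      (trans (cong (List.lookup ys) eq) (sym (lookup-index (f∈ (∈-lookup j)))))))

vectors-unique : ∀ {A : Set} {xs : List A} → Unique xs → ∀ n → Unique (vectors xs n)
vectors-unique u zero    = [] ∷ []
vectors-unique u (suc n) = Unique.cartesianProductWith⁺ _∷_ Vec.∷-injective u (vectors-unique u n)

subsets-unique : ∀ n → Unique (subsets n)
subsets-unique = vectors-unique (((λ ()) ∷ []) ∷ ([] ∷ []))

-- As a sum, the size is visibly invariant under bijections of the index set.
card-sum : ∀ (S : Subset n) → + ∣ S ∣ ≡ sumᶻ (χ S)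
card-sum []            = refl
card-sum (inside ∷ S)  = cong (_+_ 1ℤ) (card-sum S)
card-sum (outside ∷ S) = trans (card-sum S) (sym (ℤ.+-identityˡ _))

module _ (φ : Fin m ↔ Fin n) where
  open Inverse φ using (to; from; strictlyInverseˡ; strictlyInverseʳ)

  lookup-image : ∀ S i → lookup (image φ S) (to i) ≡ lookup S i
  lookup-image S i = trans (Vec.lookup∘tabulate (λ j → lookup S (from j)) (to i)) (cong (lookup S) (strictlyInverseʳ i))

  ∈-image⁺ : ∀ {S j} → from j ∈ S → j ∈ image φ S
  ∈-image⁺ {S} {j} j∈ = Vec.lookup⇒[]= j _ (trans (Vec.lookup∘tabulate (λ j → lookup S (from j)) j) (Vec.[]=⇒lookup j∈))

  ∈-image⁻ : ∀ {S j} → j ∈ image φ S → from j ∈ S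
  ∈-image⁻ {S} {j} j∈ = Vec.lookup⇒[]= (from j) S
      (trans (sym (Vec.lookup∘tabulate (λ j → lookup S (from j)) j)) (Vec.[]=⇒lookup j∈))

  image-mono : ∀ {S T} → S ⊆ T → image φ S ⊆ image φ T
  image-mono S⊆T j∈ = ∈-image⁺ (S⊆T (∈-image⁻ j∈))

  ∣image∣ : ∀ S → ∣ image φ S ∣ ≡ ∣ S ∣
  ∣image∣ S = ℤ.+-injective (trans (card-sum (image φ S)) (trans (sum-permute (χ (image φ S)) φ)
    (trans (sum-cong-≗ λ i → cong (λ b → if b then 1ℤ else 0ℤ) (lookup-image S i)) (sym (card-sum S)))))

  image-∩ : ∀ S T → image φ (S ∩ T) ⊆ image φ S ∩ image φ T
  image-∩ S T j∈ = let ∈S , ∈T = x∈p∩q⁻ S T (∈-image⁻ j∈) in x∈p∩q⁺ (∈-image⁺ ∈S , ∈-image⁺ ∈T)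

image-inverse : ∀ (φ : Fin m ↔ Fin n) S → image (↔-sym φ) (image φ S) ≡ S
image-inverse φ S = trans (Vec.tabulate-cong (lookup-image φ S)) (Vec.tabulate∘lookup S)

image-inverse′ : ∀ (φ : Fin m ↔ Fin n) S → image φ (image (↔-sym φ) S) ≡ S
image-inverse′ φ S = trans (Vec.tabulate-cong (lookup-image (↔-sym φ) S)) (Vec.tabulate∘lookup S)

≅-sym : ∀ {E E′} {M : Matroid E} {N : Matroid E′} → M ≅ N → N ≅ M
≅-sym {N = N} (φ , iso) = ↔-sym φ , λ B → mk⇔
  (λ bB → Equivalence.from (iso _) (subst (Matroid.Basis N) (sym (image-inverse′ φ B)) bB))
  (λ bB → subst (Matroid.Basis N) (image-inverse′ φ B) (Equivalence.to (iso _) bB))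

rank-image-≤ : ∀ {E E′} (M : Matroid E) (N : Matroid E′) ((φ , _) : M ≅ N) S → rank M S ℕ.≤ rank N (image φ S)
rank-image-≤ M N (φ , iso) S = let B , bB , eq = rank-attained M S in begin
  rank M S                       ≡⟨ eq ⟨
  ∣ B ∩ S ∣                      ≡⟨ ∣image∣ φ (B ∩ S) ⟨
  ∣ image φ (B ∩ S) ∣            ≤⟨ p⊆q⇒∣p∣≤∣q∣ (image-∩ φ B S) ⟩
  ∣ image φ B ∩ image φ S ∣      ≤⟨ ∣B∩S∣≤rank N (Equivalence.to (iso B) bB) (image φ S) ⟩
  rank N (image φ S)             ∎
  where open ℕ.≤-Reasoning

module _ {E E′ : GroundSet} (M : Matroid E) (N : Matroid E′) (M≅N : M ≅ N) where
  private φ = proj₁ M≅N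
  open Inverse φ using (from; strictlyInverseˡ)

  rank-image : ∀ S → rank N (image φ S) ≡ rank M S
  rank-image S = ℕ.≤-antisym
    (subst (λ T → rank N (image φ S) ℕ.≤ rank M T) (image-inverse φ S)
      (rank-image-≤ N M (≅-sym {M = M} {N} M≅N) (image φ S)))
    (rank-image-≤ M N M≅N S)

  flat-image : ∀ {F} → Flat M F → Flat N (image φ F)
  flat-image {F} flat e e∉ = begin-strict
    rank N (image φ F)                    ≡⟨ rank-image F ⟩
    rank M F                              <⟨ flat (from e) (e∉ ∘ ∈-image⁺ φ) ⟩
    rank M (F ∪ ⁅ from e ⁆)               ≡⟨ rank-image (F ∪ ⁅ from e ⁆) ⟨
    rank N (image φ (F ∪ ⁅ from e ⁆))     ≤⟨ rank-mono N image-∪⁅⁆ ⟩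
    rank N (image φ F ∪ ⁅ e ⁆)            ∎
    where
    open ℕ.≤-Reasoning
    image-∪⁅⁆ : image φ (F ∪ ⁅ from e ⁆) ⊆ image φ F ∪ ⁅ e ⁆
    image-∪⁅⁆ {j} j∈ with x∈p∪q⁻ F ⁅ from e ⁆ (∈-image⁻ φ j∈)
    ... | inj₁ ∈F = x∈p∪q⁺ (inj₁ (∈-image⁺ φ ∈F))
    ... | inj₂ ∈e = x∈p∪q⁺ {p = image φ F} (inj₂ (subst (_∈ ⁅ e ⁆)
            (trans (sym (strictlyInverseˡ e)) (trans (cong (Inverse.to φ) (sym (x∈⁅y⁆⇒x≡y (from e) ∈e))) (strictlyInverseˡ j)))
            (x∈⁅x⁆ e)))

  flag-image : ∀ {s} (rs : Vec ℕ s) {Fs} → Flag M rs Fs → Flag N rs (Vec.map (image φ) Fs)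
  flag-image rs {Fs} (flats , chain) =
    subst (VecPointwise _ (Vec.map (image φ) Fs)) (Vec.map-id rs)
      (VecPointwise.map⁺ (λ {F} (flat , eq) → flat-image flat , trans (rank-image F) eq) flats)
    , Linked.map⁺ (Linked.map (image-mono φ) chain)

  -- Taking images injects the flags of M into those of N. The inverse isomorphism supplies the
  -- opposite inequality.
  α-≤ : ∀ R → α M R ≤ α N R
  α-≤ R = ℤ.+≤+ (length-≤
    (Unique.filter⁺ (flag? M elements) (vectors-unique (subsets-unique (size E)) card))
    (Vec.map (image φ)) map-injective
    λ {Fs} Fs∈ → ∈-filter⁺ (flag? N elements) (∈-vectors ∈-subsets (Vec.map (image φ) Fs))
      (flag-image elements (proj₂ (∈-filter⁻ (flag? M elements) {xs = vectors (subsets (size E)) card} Fs∈))))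
    where
    open FiniteSet R
    unmap : ∀ {s} (Fs : Vec (Subset (size E)) s) → Vec.map (image (↔-sym φ)) (Vec.map (image φ) Fs) ≡ Fs
    unmap Fs = trans (sym (Vec.map-∘ _ _ Fs)) (trans (Vec.map-cong (image-inverse φ) Fs) (Vec.map-id Fs))
    map-injective : ∀ {s} {Fs Gs : Vec (Subset (size E)) s} → Vec.map (image φ) Fs ≡ Vec.map (image φ) Gs → Fs ≡ Gs
    map-injective {Fs = Fs} {Gs} eq = trans (sym (unmap Fs)) (trans (cong (Vec.map _) eq) (unmap Gs))

α-invariant : IsInvariant ℤ-Functions α
α-invariant M N M≅N R = ℤ.≤-antisym (α-≤ M N M≅N R) (α-≤ N M (≅-sym {M = M} {N} M≅N) R)

-- Sums and multiples in the group of functions, evaluated pointwise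

private
  module ℤFun = AbelianGroup ℤ-Functions
  open RawMonoidOps ℤFun.rawMonoid using () renaming (_×_ to _×ᶠ_; sum to sumᶠ)

  ×ᶠ-value : ∀ k f R → (k ×ᶠ f) R ≡ + k * f R
  ×ᶠ-value zero    f R = refl
  ×ᶠ-value (suc k) f R = trans (cong (_+_ (f R)) (×ᶠ-value k f R)) (arith (f R) (+ k))
    where
    arith : ∀ x k → x + k * x ≡ (1ℤ + k) * x
    arith = solve-∀

  ·-value : ∀ a f R → (_·_ ℤ-Functions a f) R ≡ a * f R
  ·-value (+ k)        f R = ×ᶠ-value k f R
  ·-value ℤ.-[1+ k ]   f R = trans (cong -_ (×ᶠ-value (suc k) f R)) (ℤ.neg-distribˡ-* (+ suc k) (f R))

  sumᶠ-value : ∀ {s} (f : Fin s → FiniteSet → ℤ) R → sumᶠ f R ≡ sumᶻ (λ i → f i R)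
  sumᶠ-value {zero}  f R = refl
  sumᶠ-value {suc s} f R = cong (_+_ (f zero R)) (sumᶠ-value (f ∘ suc) R)

α-valuation : IsValuation ℤ-Functions α
α-valuation a M rel R = trans (sumᶠ-value (λ i → _·_ ℤ-Functions (a i) (α (M i))) R)
  (trans (sum-cong-≗ λ i → ·-value (a i) (α (M i)) R) (relation (valuative-α R) a M rel))

theorem8p2 : IsValuativeInvariant ℤ-Functions α
theorem8p2 = record { isValuation = α-valuation ; isInvariant = α-invariant }
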